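{- Let $\lambda\vdash n$ and $M\in\operatorname{SSYT}(\lambda)$. Then $\{F_{M,T}:T\in\operatorname{SYT}(\lambda)\}$ is a basis of $V_M$. Moreover, $V_M$ is an irreducible representation of $S_n$ on a subspace of $\mathbb{Q}[x_1,\ldots,x_n]$ that is homogeneous of degree $\Sigma(M)$, and it is isomorphic to the Specht module $\mathcal{S}^\lambda$.
   Context: $S_n$ acts on $\mathbb{Q}[x_1,\ldots,x_n]$ by $\sigma\cdot x_i=x_{\sigma(i)}$. $\operatorname{SSYT}(\lambda)$ consists of the semistandard fillings of $\lambda$ by non-negative integers, and $\Sigma(M)$ is the entry sum. $\operatorname{SYT}(\lambda)$ is the set of standard Young tableaux. For a filling $T$ of $\lambda$ by $1,\ldots,n$, each used once, $R(T)$ and $C(T)$ are the row and column stabilizers, and $\varepsilon_T=\sum_{\sigma\in C(T)}\sum_{\tau\in R(T)}\operatorname{sgn}(\sigma)\sigma\tau$. $p_{M,T}=\prod x_i^{h_i}$, where $h_i$ is the entry of $M$ in the box of $T$ containing $i$. $s_{M,T}$ is the order of the stabilizer of $p_{M,T}$ in $R(T)$, and $F_{M,T}=\varepsilon_Tp_{M,T}/s_{M,T}$. $V_M$ is the $\mathbb{Q}$-span of $F_{M,T}$ over all such fillings $T$. -}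

module Defs where

open import Data.Bool using (Bool; true; false; if_then_else_; _∧_; _∨_; not)
open import Data.Nat as ℕ using (ℕ; zero; suc; _≤_; _<_; _≥_; _≡ᵇ_)
open import Data.Fin using (Fin; toℕ)
open import Data.Fin.Properties using () renaming (_≟_ to _≟F_)
open import Data.List using (List; []; _∷_; map; concatMap; foldr; length; allFin; lookup; _++_)
open import Data.Nat.ListAction using (sum)
open import Data.List.Relation.Unary.All using (All)
open import Data.List.Relation.Unary.AllPairs using (AllPairs)
open import Data.List.Relation.Unary.Linked using (Linked)
open import Data.Product using (Σ; Σ-syntax; ∃; ∃-syntax; _×_; _,_; proj₁; proj₂)
open import Data.Rational as ℚ using (ℚ; 0ℚ; 1ℚ)
open import Data.Integer using (+_)
open import Function using (_∘_)
open import Function.Definitions using (Bijective)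
open import Relation.Binary.PropositionalEquality using (_≡_)
open import Relation.Nullary using (¬_; does)

filterB : {A : Set} → (A → Bool) → List A → List A
filterB p [] = []
filterB p (x ∷ xs) = if p x then x ∷ filterB p xs else filterB p xs

_==F_ : {n : ℕ} → Fin n → Fin n → Bool
i ==F j = does (i ≟F j)

all : {A : Set} → (A → Bool) → List A → Bool
all p [] = true
all p (x ∷ xs) = p x ∧ all p xs

evenB : ℕ → Bool
evenB zero = true
evenB (suc k) = not (evenB k)

-- 1/k in ℚ (k = 0 never occurs below: stabilizers contain the identity)
invℕ : ℕ → ℚ
invℕ zero = 0ℚ
invℕ (suc k) = (+ 1) ℚ./ (suc k)

IsPartition : ℕ → List ℕ → Set
IsPartition n sh = Linked _≥_ sh × All (λ k → 0 < k) sh × sum sh ≡ n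

record Box (sh : List ℕ) : Set where
  constructor box
  field
    r : Fin (length sh)
    c : Fin (lookup sh r)

rowOf : {sh : List ℕ} → Box sh → ℕ
rowOf b = toℕ (Box.r b)

colOf : {sh : List ℕ} → Box sh → ℕ
colOf b = toℕ (Box.c b)

boxes : (sh : List ℕ) → List (Box sh)
boxes sh = concatMap (λ r → map (λ c → box r c) (allFin (lookup sh r))) (allFin (length sh))

IsSSYT : (sh : List ℕ) → (Box sh → ℕ) → Set
IsSSYT sh M =
  (∀ (b b' : Box sh) → rowOf b ≡ rowOf b' → colOf b < colOf b' → M b ≤ M b')
  × (∀ (b b' : Box sh) → colOf b ≡ colOf b' → rowOf b < rowOf b' → M b < M b')

entrySum : (sh : List ℕ) → (Box sh → ℕ) → ℕ
entrySum sh M = sum (map M (boxes sh))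

-- A filling T of λ by 1..n, each used once, is recorded by the bijection
-- pos : Fin n → Box λ sending the number i (i.e. i+1) to the box containing it.
Filling : ℕ → List ℕ → Set
Filling n sh = Σ (Fin n → Box sh) (Bijective _≡_ _≡_)

pos : {n : ℕ} {sh : List ℕ} → Filling n sh → Fin n → Box sh
pos T = proj₁ T

IsStandard : {n : ℕ} {sh : List ℕ} → Filling n sh → Set
IsStandard {n} T =
  (∀ (i j : Fin n) → rowOf (pos T i) ≡ rowOf (pos T j) → colOf (pos T i) < colOf (pos T j) → toℕ i < toℕ j)
  × (∀ (i j : Fin n) → colOf (pos T i) ≡ colOf (pos T j) → rowOf (pos T i) < rowOf (pos T j) → toℕ i < toℕ j)

SYT : ℕ → List ℕ → Set
SYT n sh = Σ (Filling n sh) IsStandard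

SameT : {n : ℕ} {sh : List ℕ} → SYT n sh → SYT n sh → Set
SameT {n} T T' = ∀ (i : Fin n) → pos (proj₁ T) i ≡ pos (proj₁ T') i

IsPerm : {n : ℕ} → (Fin n → Fin n) → Set
IsPerm σ = Bijective _≡_ _≡_ σ

consF : {n m : ℕ} → Fin m → (Fin n → Fin m) → Fin (suc n) → Fin m
consF j f Fin.zero = j
consF j f (Fin.suc i) = f i

allFuns : (n m : ℕ) → List (Fin n → Fin m)
allFuns zero m = (λ ()) ∷ []
allFuns (suc n) m = concatMap (λ f → map (λ j → consF j f) (allFin m)) (allFuns n m)

injB : {n : ℕ} → (Fin n → Fin n) → Bool
injB {n} f = all (λ i → all (λ j → not (f i ==F f j) ∨ (i ==F j)) (allFin n)) (allFin n)

Sn : (n : ℕ) → List (Fin n → Fin n)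
Sn n = filterB injB (allFuns n n)

inversions : {n : ℕ} → (Fin n → Fin n) → ℕ
inversions {n} σ =
  length (filterB (λ ij → (toℕ (proj₁ ij) ℕ.<ᵇ toℕ (proj₂ ij)) ∧ (toℕ (σ (proj₂ ij)) ℕ.<ᵇ toℕ (σ (proj₁ ij))))
    (concatMap (λ i → map (λ j → (i , j)) (allFin n)) (allFin n)))

sgn : {n : ℕ} → (Fin n → Fin n) → ℚ
sgn σ = if evenB (inversions σ) then 1ℚ else ℚ.- 1ℚ

rowStab : {n : ℕ} {sh : List ℕ} → Filling n sh → List (Fin n → Fin n)
rowStab {n} T = filterB (λ σ → all (λ i → rowOf (pos T (σ i)) ≡ᵇ rowOf (pos T i)) (allFin n)) (Sn n)

colStab : {n : ℕ} {sh : List ℕ} → Filling n sh → List (Fin n → Fin n)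
colStab {n} T = filterB (λ σ → all (λ i → colOf (pos T (σ i)) ≡ᵇ colOf (pos T i)) (allFin n)) (Sn n)

-- Finite formal ℚ-linear combinations of elements of X (free ℚ-vector space)

FV : Set → Set
FV X = List (ℚ × X)

coeffFV : {X : Set} → (X → X → Bool) → FV X → X → ℚ
coeffFV eq v x = foldr (λ cy acc → if eq (proj₂ cy) x then proj₁ cy ℚ.+ acc else acc) 0ℚ v

scaleFV : {X : Set} → ℚ → FV X → FV X
scaleFV c v = map (λ dy → (c ℚ.* proj₁ dy , proj₂ dy)) v

Exp : ℕ → Set
Exp n = Fin n → ℕ

eqExp : {n : ℕ} → Exp n → Exp n → Bool
eqExp {n} e e' = all (λ i → e i ≡ᵇ e' i) (allFin n)

Poly : ℕ → Set
Poly n = FV (Exp n)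

coeff : {n : ℕ} → Poly n → Exp n → ℚ
coeff = coeffFV eqExp

_≈P_ : {n : ℕ} → Poly n → Poly n → Set
p ≈P q = ∀ e → coeff p e ≡ coeff q e

0P : {n : ℕ} → Poly n
0P = []

_+P_ : {n : ℕ} → Poly n → Poly n → Poly n
p +P q = p ++ q

degree : {n : ℕ} → Exp n → ℕ
degree {n} e = sum (map e (allFin n))

-- σ · x_i = x_{σ(i)}: the exponent of x_j in σ·(∏ x_i^{e_i}) is Σ_{σ(i)=j} e_i
actExp : {n : ℕ} → (Fin n → Fin n) → Exp n → Exp n
actExp {n} σ e j = sum (map (λ i → if σ i ==F j then e i else 0) (allFin n))

actP : {n : ℕ} → (Fin n → Fin n) → Poly n → Poly n
actP σ p = map (λ ce → (proj₁ ce , actExp σ (proj₂ ce))) p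

epsT : {n : ℕ} {sh : List ℕ} → Filling n sh → Poly n → Poly n
epsT T f = concatMap (λ σ → concatMap (λ τ → scaleFV (sgn σ) (actP (σ ∘ τ) f)) (rowStab T)) (colStab T)

hMT : {n : ℕ} {sh : List ℕ} → (Box sh → ℕ) → Filling n sh → Exp n
hMT M T i = M (pos T i)

pMT : {n : ℕ} {sh : List ℕ} → (Box sh → ℕ) → Filling n sh → Poly n
pMT M T = (1ℚ , hMT M T) ∷ []

sMT : {n : ℕ} {sh : List ℕ} → (Box sh → ℕ) → Filling n sh → ℕ
sMT M T = length (filterB (λ τ → eqExp (actExp τ (hMT M T)) (hMT M T)) (rowStab T))

FMT : {n : ℕ} {sh : List ℕ} → (Box sh → ℕ) → Filling n sh → Poly n
FMT M T = scaleFV (invℕ (sMT M T)) (epsT T (pMT M T))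

lincomb : {n : ℕ} {I : Set} → (I → Poly n) → List (ℚ × I) → Poly n
lincomb f xs = concatMap (λ ci → scaleFV (proj₁ ci) (f (proj₂ ci))) xs

InSpan : {n : ℕ} {I : Set} → (I → Poly n) → Poly n → Set
InSpan {I = I} f p = ∃[ xs ] (p ≈P lincomb {I = I} f xs)

InVM : (n : ℕ) (sh : List ℕ) → (Box sh → ℕ) → Poly n → Set
InVM n sh M = InSpan {n} {Filling n sh} (FMT M)

LinIndep : {n : ℕ} {I : Set} → (I → I → Set) → (I → Poly n) → Set
LinIndep {I = I} _≈I_ f =
  ∀ (xs : List (ℚ × I)) → AllPairs (λ a b → ¬ (proj₂ a ≈I proj₂ b)) xs →
    lincomb f xs ≈P 0P → All (λ a → proj₁ a ≡ 0ℚ) xs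

IsBasisOf : {n : ℕ} {I : Set} → (I → I → Set) → (I → Poly n) → (Poly n → Set) → Set
IsBasisOf _≈I_ f V = (∀ i → V (f i)) × LinIndep _≈I_ f × (∀ p → V p → InSpan f p)

record IsSubspace {n : ℕ} (W : Poly n → Set) : Set where
  field
    respects : ∀ {p q} → p ≈P q → W p → W q
    has0 : W 0P
    closed+ : ∀ {p q} → W p → W q → W (p +P q)
    closed* : ∀ c {p} → W p → W (scaleFV c p)

Invariant : {n : ℕ} → (Poly n → Set) → Set
Invariant {n} W = ∀ (σ : Fin n → Fin n) → IsPerm σ → ∀ p → W p → W (actP σ p)

HomogeneousOfDegree : {n : ℕ} → ℕ → (Poly n → Set) → Set
HomogeneousOfDegree d W = ∀ p → W p → ∀ e → ¬ (coeff p e ≡ 0ℚ) → degree e ≡ d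

-- irreducible: nonzero, and every nonzero invariant subspace of V is V
-- (constructive form of "the only invariant subspaces are 0 and V")
Irreducible : {n : ℕ} → (Poly n → Set) → Set₁
Irreducible {n} V =
  (∃[ p ] (V p × ¬ (p ≈P 0P)))
  × (∀ (W : Poly n → Set) → IsSubspace W → Invariant W → (∀ p → W p → V p) →
       (∃[ p ] (W p × ¬ (p ≈P 0P))) → ∀ p → V p → W p)

-- Specht module S^λ (Sagan): inside the permutation module M^λ spanned by tabloids.
-- The tabloid {T} is recorded as the function sending each number to its row.

TabFun : ℕ → ℕ → Set
TabFun n ℓ = Fin n → Fin ℓ

eqTab : {n ℓ : ℕ} → TabFun n ℓ → TabFun n ℓ → Bool
eqTab {n} r r' = all (λ i → r i ==F r' i) (allFin n)

ML : ℕ → List ℕ → Set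
ML n sh = FV (TabFun n (length sh))

EqM : (n : ℕ) (sh : List ℕ) → ML n sh → ML n sh → Set
EqM n sh u v = ∀ (r : TabFun n (length sh)) → coeffFV eqTab u r ≡ coeffFV eqTab v r

tabloid : {n : ℕ} {sh : List ℕ} → Filling n sh → TabFun n (length sh)
tabloid T i = Box.r (pos T i)

-- preimage of j under σ (σ a permutation; default j never used then)
preimage : {n : ℕ} → (Fin n → Fin n) → Fin n → Fin n
preimage {n} σ j = foldr (λ i acc → if σ i ==F j then i else acc) j (allFin n)

-- σ{T} = {σT}, where σT puts σ(i) in the box where T has i
actM : {n : ℕ} {sh : List ℕ} → (Fin n → Fin n) → ML n sh → ML n sh
actM σ v = map (λ cr → (proj₁ cr , proj₂ cr ∘ preimage σ)) v

polytabloid : {n : ℕ} {sh : List ℕ} → Filling n sh → ML n sh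
polytabloid T = map (λ σ → (sgn σ , tabloid T ∘ preimage σ)) (colStab T)

InSpecht : (n : ℕ) (sh : List ℕ) → ML n sh → Set
InSpecht n sh v = ∃[ xs ] (EqM n sh v (concatMap (λ ci → scaleFV (proj₁ ci) (polytabloid {n} {sh} (proj₂ ci))) xs))

record RepIso (n : ℕ) (sh : List ℕ) (V : Poly n → Set) (S : ML n sh → Set) : Set where
  field
    φ : (p : Poly n) → V p → ML n sh
    into : ∀ p (hp : V p) → S (φ p hp)
    respects : ∀ p q (hp : V p) (hq : V q) → p ≈P q → EqM n sh (φ p hp) (φ q hq)
    additive : ∀ p q (hp : V p) (hq : V q) (hpq : V (p +P q)) → EqM n sh (φ (p +P q) hpq) (φ p hp ++ φ q hq)
    homog : ∀ c p (hp : V p) (hcp : V (scaleFV c p)) → EqM n sh (φ (scaleFV c p) hcp) (scaleFV c (φ p hp))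
    equivariant : ∀ (σ : Fin n → Fin n) → IsPerm σ → ∀ p (hp : V p) (hσp : V (actP σ p)) →
      EqM n sh (φ (actP σ p) hσp) (actM {n} {sh} σ (φ p hp))
    injective : ∀ p q (hp : V p) (hq : V q) → EqM n sh (φ p hp) (φ q hq) → p ≈P q
    surjective : ∀ v → S v → ∃[ p ] Σ (V p) (λ hp → EqM n sh (φ p hp) v)

{-# OPTIONS --safe #-}

-- Let θ be the linear map sending the tabloid {T} to the sum of the distinct row rearrangements of p_{M,T}. It is
-- S_n-equivariant and maps the polytabloid e_T to F_{M,T}, so V_M is the image of the Specht module. For v in the
-- Specht module, the column antisymmetrizer κ_T maps v to ⟨v , e_T⟩ e_T, hence θ v to ⟨v , e_T⟩ F_{M,T}. Column
-- strictness of M makes the coefficient of p_{M,T} in F_{M,T} nonzero, and the form is positive definite over ℚ;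
-- therefore θ is injective on the Specht module and every nonzero invariant subspace of V_M contains some, hence
-- every, F_{M,T}. The basis statement is thereby reduced to polytabloids. In the lexicographic order of tabloids {T}
-- is the least term of e_T for standard T, which gives independence; a Garnir relation shows that the least term of
-- any vector of the Specht module is the tabloid of a standard tableau, which gives spanning.
module Submission where

open import Defs
open import Algebra.Structures using (IsCommutativeSemiring; IsCommutativeRing)
open import Data.Bool using (Bool; true; false; if_then_else_; _∧_; _∨_; not; _xor_)
import Data.Bool.Properties as BP
open import Data.Empty using (⊥; ⊥-elim)
open import Data.Fin as F using (Fin; toℕ)
open import Data.Fin.Permutation using (Permutation′; permutation; transpose; flip; _∘ₚ_; _⟨$⟩ʳ_; _⟨$⟩ˡ_; inverseˡ; inverseʳ)
import Data.Fin.Properties as FP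
import Data.Integer as ℤ
open import Data.List using (List; []; _∷_; map; concatMap; foldr; length; allFin; tabulate; lookup; _++_)
open import Data.List.Membership.Propositional using (_∈_)
open import Data.List.Membership.Propositional.Properties using (∈-allFin; ∈-lookup)
open import Data.List.Relation.Unary.All as All using (All; []; _∷_)
open import Data.List.Relation.Unary.AllPairs using (AllPairs; []; _∷_)
open import Data.List.Relation.Unary.Any using (here; there)
open import Data.List.Relation.Unary.Linked using (Linked)
open import Data.List.Relation.Unary.Linked.Properties using (Linked⇒AllPairs)
open import Data.Nat as ℕ using (ℕ; zero; suc; _≡ᵇ_; _≤_; _<_)
open import Data.Nat.ListAction using (sum)
import Data.Nat.Properties as ℕP
open import Data.Product using (Σ; _×_; _,_; proj₁; proj₂; ∃-syntax)
open import Data.Rational as ℚ using (ℚ; 0ℚ; 1ℚ)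
import Data.Rational.Properties as ℚP
open import Data.Sum using (_⊎_; inj₁; inj₂; [_,_]′)
open import Function using (_∘_; id)
open import Function.Definitions using (Injective)
open import Relation.Binary.Definitions using (tri<; tri≈; tri>)
open import Relation.Binary.PropositionalEquality
open import Relation.Nullary using (¬_; Dec; yes; no; does)
open import Relation.Nullary.Decidable using (_×-dec_; ¬?)

-- Finite sums

-- Group algebra computations are done on coefficients. A sum over a stabilizer is a sum over all
-- functions on `Fin n` weighted by a 0/1 indicator, so that a substitution σ ↦ πσ is a reindexing
-- of one fixed list. Functions are compared by boolean tests up to pointwise equality, which every
-- coefficient function must be shown to respect. On coefficients σ acts by r ↦ r ∘ σ, with no
-- inverse.
--
-- A vector of the Specht module comes with a list of fillings that spans it. A function to the rows
-- need not have the row sizes of λ, so the identity for κ_T is available only where the vector has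
-- a nonzero coefficient, which produces a filling.
--
-- The Garnir relation is used in dual form. No polytabloid is rewritten; instead, the functional
-- that sums the coefficients over all redistributions of a set of numbers over two rows vanishes on
-- every polytabloid, hence on every vector. If the least tabloid of a vector had a column descent,
-- it would be the only nonzero term of such a sum.

bool-ext : {a b : Bool} → (a ≡ true → b ≡ true) → (b ≡ true → a ≡ true) → a ≡ b
bool-ext {false} {false} _ _ = refl
bool-ext {false} {true} _ g = g refl
bool-ext {true} f _ = sym (f refl)

∧-true : (a : Bool) {b : Bool} → a ∧ b ≡ true → a ≡ true × b ≡ true
∧-true true e = refl , e

∧-intro : {a b : Bool} → a ≡ true → b ≡ true → a ∧ b ≡ true
∧-intro refl refl = refl

≡false : {b : Bool} → ¬ (b ≡ true) → b ≡ false
≡false {false} _ = refl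
≡false {true} f = ⊥-elim (f refl)

does⇒ : {P : Set} (d : Dec P) → does d ≡ true → P
does⇒ (yes p) _ = p

⇒does : {P : Set} (d : Dec P) → P → does d ≡ true
⇒does (yes _) _ = refl
⇒does (no ¬p) p = ⊥-elim (¬p p)

≡ᵇ⇒ : (a b : ℕ) → (a ≡ᵇ b) ≡ true → a ≡ b
≡ᵇ⇒ zero zero _ = refl
≡ᵇ⇒ (suc a) (suc b) e = cong suc (≡ᵇ⇒ a b e)

⇒≡ᵇ : {a b : ℕ} → a ≡ b → (a ≡ᵇ b) ≡ true
⇒≡ᵇ {zero} refl = refl
⇒≡ᵇ {suc a} refl = ⇒≡ᵇ {a} refl

==F⇒ : {n : ℕ} {i j : Fin n} → (i ==F j) ≡ true → i ≡ j
==F⇒ {i = i} {j} = does⇒ (i FP.≟ j)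

⇒==F : {n : ℕ} {i j : Fin n} → i ≡ j → (i ==F j) ≡ true
⇒==F {i = i} {j} = ⇒does (i FP.≟ j)

all-cong : {A : Set} {p q : A → Bool} (xs : List A) → (∀ x → p x ≡ q x) → all p xs ≡ all q xs
all-cong [] _ = refl
all-cong (x ∷ xs) h = cong₂ _∧_ (h x) (all-cong xs h)

all-tabulate : {A : Set} (p : A → Bool) {n : ℕ} (f : Fin n → A) →
  all p (tabulate f) ≡ all (p ∘ f) (allFin n)
all-tabulate p {zero} f = refl
all-tabulate p {suc n} f = cong (p (f F.zero) ∧_)
  (trans (all-tabulate p (f ∘ F.suc)) (sym (all-tabulate (p ∘ f) F.suc)))

allFin⇒ : {n : ℕ} (p : Fin n → Bool) → all p (allFin n) ≡ true → ∀ i → p i ≡ true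
allFin⇒ p e F.zero = proj₁ (∧-true (p F.zero) e)
allFin⇒ {suc n} p e (F.suc i) =
  allFin⇒ (p ∘ F.suc) (trans (sym (all-tabulate p F.suc)) (proj₂ (∧-true (p F.zero) e))) i

⇒allFin : {n : ℕ} (p : Fin n → Bool) → (∀ i → p i ≡ true) → all p (allFin n) ≡ true
⇒allFin {zero} p h = refl
⇒allFin {suc n} p h = ∧-intro (h F.zero)
  (trans (all-tabulate p F.suc) (⇒allFin (p ∘ F.suc) (h ∘ F.suc)))

eqTab⇒ : {n m : ℕ} (f g : Fin n → Fin m) → eqTab f g ≡ true → f ≗ g
eqTab⇒ f g e i = ==F⇒ (allFin⇒ (λ i → f i ==F g i) e i)

⇒eqTab : {n m : ℕ} {f g : Fin n → Fin m} → f ≗ g → eqTab f g ≡ true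
⇒eqTab {f = f} {g} h = ⇒allFin (λ i → f i ==F g i) (⇒==F ∘ h)

eqExp⇒ : {n : ℕ} (f g : Exp n) → eqExp f g ≡ true → f ≗ g
eqExp⇒ f g e i = ≡ᵇ⇒ _ _ (allFin⇒ (λ i → f i ≡ᵇ g i) e i)

⇒eqExp : {n : ℕ} {f g : Exp n} → f ≗ g → eqExp f g ≡ true
⇒eqExp {f = f} {g} h = ⇒allFin (λ i → f i ≡ᵇ g i) (⇒≡ᵇ ∘ h)

eqTab-cong : {n m : ℕ} {f f′ g g′ : Fin n → Fin m} → f ≗ f′ → g ≗ g′ → eqTab f g ≡ eqTab f′ g′
eqTab-cong {n} p q = all-cong (allFin n) (λ i → cong₂ _==F_ (p i) (q i))

eqExp-cong : {n : ℕ} {f f′ g g′ : Exp n} → f ≗ f′ → g ≗ g′ → eqExp f g ≡ eqExp f′ g′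
eqExp-cong {n} p q = all-cong (allFin n) (λ i → cong₂ _≡ᵇ_ (p i) (q i))

eqTab-congʳ : {n m : ℕ} (f : Fin n → Fin m) {g g′ : Fin n → Fin m} → g ≗ g′ → eqTab f g ≡ eqTab f g′
eqTab-congʳ f = eqTab-cong {f = f} (λ _ → refl)

eqTab-sym : {n m : ℕ} (f g : Fin n → Fin m) → eqTab f g ≡ eqTab g f
eqTab-sym f g = bool-ext (λ e → ⇒eqTab (sym ∘ eqTab⇒ f g e)) (λ e → ⇒eqTab (sym ∘ eqTab⇒ g f e))

-- A decidable equality together with a list meeting every class exactly once.
record Enum (A : Set) : Set where
  field
    list : List A
    eq : A → A → Bool
    once : ∀ y → length (filterB (λ x → eq x y) list) ≡ 1

module Sums (C : Set) (_+_ _*_ : C → C → C) (0# 1# : C)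
            (isCS : IsCommutativeSemiring {A = C} _≡_ _+_ _*_ 0# 1#) where
  open IsCommutativeSemiring isCS
    using (+-assoc; +-comm; +-identityˡ; +-identityʳ; *-comm; *-assoc; *-identityˡ; distribˡ; zeroˡ; zeroʳ)
  open ≡-Reasoning

  ⟦_⟧ : Bool → C
  ⟦ b ⟧ = if b then 1# else 0#

  ∑ : {A : Set} → List A → (A → C) → C
  ∑ [] f = 0#
  ∑ (x ∷ xs) f = f x + ∑ xs f

  ⟦⟧-cong : (b : Bool) {x y : C} → (b ≡ true → x ≡ y) → (⟦ b ⟧ * x) ≡ (⟦ b ⟧ * y)
  ⟦⟧-cong true h = cong (1# *_) (h refl)
  ⟦⟧-cong false {x} {y} h = trans (zeroˡ x) (sym (zeroˡ y))

  ⟦∧⟧ : (a b : Bool) → ⟦ a ∧ b ⟧ ≡ (⟦ a ⟧ * ⟦ b ⟧)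
  ⟦∧⟧ true b = sym (*-identityˡ _)
  ⟦∧⟧ false b = sym (zeroˡ _)

  ⟦∧⟧* : (a b : Bool) (x : C) → (⟦ a ∧ b ⟧ * x) ≡ (⟦ a ⟧ * (⟦ b ⟧ * x))
  ⟦∧⟧* a b x = trans (cong (_* x) (⟦∧⟧ a b)) (*-assoc _ _ _)

  *-left-comm : (x y z : C) → (x * (y * z)) ≡ (y * (x * z))
  *-left-comm x y z = begin
    x * (y * z) ≡⟨ *-assoc x y z ⟨
    (x * y) * z ≡⟨ cong (_* z) (*-comm x y) ⟩
    (y * x) * z ≡⟨ *-assoc y x z ⟩
    y * (x * z) ∎

  ∑-cong∈ : {A : Set} (xs : List A) {f g : A → C} → (∀ x → x ∈ xs → f x ≡ g x) → ∑ xs f ≡ ∑ xs g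
  ∑-cong∈ [] h = refl
  ∑-cong∈ (x ∷ xs) h = cong₂ _+_ (h x (here refl)) (∑-cong∈ xs (λ y y∈ → h y (there y∈)))

  ∑-cong : {A : Set} (xs : List A) {f g : A → C} → (∀ x → f x ≡ g x) → ∑ xs f ≡ ∑ xs g
  ∑-cong xs h = ∑-cong∈ xs (λ x _ → h x)

  ∑-0 : {A : Set} (xs : List A) → ∑ xs (λ _ → 0#) ≡ 0#
  ∑-0 [] = refl
  ∑-0 (x ∷ xs) = trans (+-identityˡ _) (∑-0 xs)

  ∑-zero : {A : Set} (xs : List A) {f : A → C} → (∀ x → f x ≡ 0#) → ∑ xs f ≡ 0#
  ∑-zero xs h = trans (∑-cong xs h) (∑-0 xs)

  +-interchange : (a b c d : C) → ((a + b) + (c + d)) ≡ ((a + c) + (b + d))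
  +-interchange a b c d = begin
    (a + b) + (c + d) ≡⟨ +-assoc a b (c + d) ⟩
    a + (b + (c + d)) ≡⟨ cong (a +_) (+-assoc b c d) ⟨
    a + ((b + c) + d) ≡⟨ cong (λ z → a + (z + d)) (+-comm b c) ⟩
    a + ((c + b) + d) ≡⟨ cong (a +_) (+-assoc c b d) ⟩
    a + (c + (b + d)) ≡⟨ +-assoc a c (b + d) ⟨
    (a + c) + (b + d) ∎

  ∑-+ : {A : Set} (xs : List A) (f g : A → C) → ∑ xs (λ x → f x + g x) ≡ (∑ xs f + ∑ xs g)
  ∑-+ [] f g = sym (+-identityˡ 0#)
  ∑-+ (x ∷ xs) f g = trans (cong ((f x + g x) +_) (∑-+ xs f g)) (+-interchange _ _ _ _)

  ∑-* : {A : Set} (c : C) (xs : List A) (f : A → C) → (c * ∑ xs f) ≡ ∑ xs (λ x → c * f x)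
  ∑-* c [] f = zeroʳ c
  ∑-* c (x ∷ xs) f = trans (distribˡ c _ _) (cong ((c * f x) +_) (∑-* c xs f))

  ∑-*ʳ : {A : Set} (xs : List A) (f : A → C) (c : C) → (∑ xs f * c) ≡ ∑ xs (λ x → f x * c)
  ∑-*ʳ xs f c = trans (*-comm _ c) (trans (∑-* c xs f) (∑-cong xs (λ x → *-comm c (f x))))

  ∑-swap : {A B : Set} (xs : List A) (ys : List B) (f : A → B → C) →
    ∑ xs (λ x → ∑ ys (f x)) ≡ ∑ ys (λ y → ∑ xs (λ x → f x y))
  ∑-swap [] ys f = sym (∑-0 ys)
  ∑-swap (x ∷ xs) ys f = trans (cong (∑ ys (f x) +_) (∑-swap xs ys f)) (sym (∑-+ ys _ _))

  ∑-++ : {A : Set} (xs ys : List A) (f : A → C) → ∑ (xs ++ ys) f ≡ (∑ xs f + ∑ ys f)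
  ∑-++ [] ys f = sym (+-identityˡ _)
  ∑-++ (x ∷ xs) ys f = trans (cong (f x +_) (∑-++ xs ys f)) (sym (+-assoc _ _ _))

  ∑-map : {A B : Set} (g : A → B) (xs : List A) (f : B → C) → ∑ (map g xs) f ≡ ∑ xs (f ∘ g)
  ∑-map g [] f = refl
  ∑-map g (x ∷ xs) f = cong (f (g x) +_) (∑-map g xs f)

  ∑-concatMap : {A B : Set} (g : A → List B) (xs : List A) (f : B → C) →
    ∑ (concatMap g xs) f ≡ ∑ xs (λ x → ∑ (g x) f)
  ∑-concatMap g [] f = refl
  ∑-concatMap g (x ∷ xs) f = trans (∑-++ (g x) _ f) (cong (∑ (g x) f +_) (∑-concatMap g xs f))

  ∑-filter : {A : Set} (p : A → Bool) (xs : List A) (f : A → C) →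
    ∑ (filterB p xs) f ≡ ∑ xs (λ x → ⟦ p x ⟧ * f x)
  ∑-filter p [] f = refl
  ∑-filter p (x ∷ xs) f with p x
  ... | true = cong₂ _+_ (sym (*-identityˡ _)) (∑-filter p xs f)
  ... | false = trans (∑-filter p xs f) (sym (trans (cong (_+ ∑ xs (λ x → ⟦ p x ⟧ * f x)) (zeroˡ (f x))) (+-identityˡ _)))

  ∑-none : {A : Set} (p : A → Bool) (xs : List A) → length (filterB p xs) ≡ 0 → ∑ xs (λ x → ⟦ p x ⟧) ≡ 0#
  ∑-none p [] e = refl
  ∑-none p (x ∷ xs) e with p x
  ... | false = trans (+-identityˡ _) (∑-none p xs e)

  ∑-once : {A : Set} (p : A → Bool) (xs : List A) → length (filterB p xs) ≡ 1 → ∑ xs (λ x → ⟦ p x ⟧) ≡ 1#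
  ∑-once p (x ∷ xs) e with p x
  ... | true = trans (cong (1# +_) (∑-none p xs (ℕP.suc-injective e))) (+-identityʳ 1#)
  ... | false = trans (+-identityˡ _) (∑-once p xs e)

  ∑-tabulate : {A : Set} {n : ℕ} (g : Fin n → A) (f : A → C) → ∑ (tabulate g) f ≡ ∑ (allFin n) (f ∘ g)
  ∑-tabulate {n = zero} g f = refl
  ∑-tabulate {n = suc n} g f = cong (f (g F.zero) +_)
    (trans (∑-tabulate (g ∘ F.suc) f) (sym (∑-tabulate F.suc (f ∘ g))))

  ∑-suc : {n : ℕ} (f : Fin (suc n) → C) → ∑ (allFin (suc n)) f ≡ (f F.zero + ∑ (allFin n) (f ∘ F.suc))
  ∑-suc f = cong (f F.zero +_) (∑-tabulate F.suc f)

  ∑-allFuns : {n m : ℕ} (f : (Fin (suc n) → Fin m) → C) →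
    ∑ (allFuns (suc n) m) f ≡ ∑ (allFuns n m) (λ g → ∑ (allFin m) (λ j → f (consF j g)))
  ∑-allFuns {n} {m} f = trans (∑-concatMap _ (allFuns n m) f)
    (∑-cong (allFuns n m) (λ g → ∑-map (λ j → consF j g) (allFin m) f))

  module _ {A : Set} (E : Enum A) where
    open Enum E

    ∑-δ : (y : A) (f : A → C) → (∀ x → eq x y ≡ true → f x ≡ f y) → ∑ list (λ x → ⟦ eq x y ⟧ * f x) ≡ f y
    ∑-δ y f h = begin
      ∑ list (λ x → ⟦ eq x y ⟧ * f x) ≡⟨ ∑-cong list (λ x → ⟦⟧-cong (eq x y) (h x)) ⟩
      ∑ list (λ x → ⟦ eq x y ⟧ * f y) ≡⟨ ∑-*ʳ list _ (f y) ⟨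
      ∑ list (λ x → ⟦ eq x y ⟧) * f y ≡⟨ cong (_* f y) (∑-once _ list (once y)) ⟩
      1# * f y ≡⟨ *-identityˡ _ ⟩
      f y ∎

  -- The hypothesis states that `ψ` and `ψ⁻¹` are mutually inverse in the form of an adjunction
  -- between the two boolean equalities. Writing f(ψ x) as a sum against a delta and exchanging the
  -- sums turns one enumeration into the other.
  ∑-reindex : {A B : Set} (EA : Enum A) (EB : Enum B) (ψ : A → B) (ψ⁻¹ : B → A) →
    (∀ x y → Enum.eq EB y (ψ x) ≡ Enum.eq EA x (ψ⁻¹ y)) →
    (f : B → C) → (∀ x y → Enum.eq EB x y ≡ true → f x ≡ f y) →
    ∑ (Enum.list EA) (f ∘ ψ) ≡ ∑ (Enum.list EB) f
  ∑-reindex EA EB ψ ψ⁻¹ adj f h = begin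
    ∑ LA (f ∘ ψ)
      ≡⟨ ∑-cong LA (λ x → sym (∑-δ EB (ψ x) f (λ y → h y (ψ x)))) ⟩
    ∑ LA (λ x → ∑ LB (λ y → ⟦ Enum.eq EB y (ψ x) ⟧ * f y))
      ≡⟨ ∑-swap LA LB _ ⟩
    ∑ LB (λ y → ∑ LA (λ x → ⟦ Enum.eq EB y (ψ x) ⟧ * f y))
      ≡⟨ ∑-cong LB (λ y → ∑-cong LA (λ x → cong (λ b → ⟦ b ⟧ * f y) (adj x y))) ⟩
    ∑ LB (λ y → ∑ LA (λ x → ⟦ Enum.eq EA x (ψ⁻¹ y) ⟧ * f y))
      ≡⟨ ∑-cong LB (λ y → ∑-δ EA (ψ⁻¹ y) (λ _ → f y) (λ _ _ → refl)) ⟩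
    ∑ LB f ∎
    where
    LA = Enum.list EA
    LB = Enum.list EB

module N = Sums ℕ ℕ._+_ ℕ._*_ 0 1 ℕP.+-*-isCommutativeSemiring
module Q = Sums ℚ ℚ._+_ ℚ._*_ 0ℚ 1ℚ (IsCommutativeRing.isCommutativeSemiring ℚP.+-*-isCommutativeRing)

length-filterB : {A : Set} (p : A → Bool) (xs : List A) → length (filterB p xs) ≡ N.∑ xs (λ x → N.⟦ p x ⟧)
length-filterB p [] = refl
length-filterB p (x ∷ xs) with p x
... | true = cong suc (length-filterB p xs)
... | false = length-filterB p xs

allFin-once : {n : ℕ} (y : Fin n) → N.∑ (allFin n) (λ x → N.⟦ x ==F y ⟧) ≡ 1
allFin-once {suc n} F.zero = trans (N.∑-suc {n} (λ x → N.⟦ x ==F F.zero ⟧)) (cong suc (N.∑-0 (allFin n)))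
allFin-once {suc n} (F.suc y) = trans (N.∑-suc {n} (λ x → N.⟦ x ==F F.suc y ⟧)) (allFin-once y)

allFuns-once : {n m : ℕ} (y : Fin n → Fin m) → N.∑ (allFuns n m) (λ x → N.⟦ eqTab x y ⟧) ≡ 1
allFuns-once {zero} y = refl
allFuns-once {suc n} {m} y = begin
  N.∑ (allFuns (suc n) m) (λ x → N.⟦ eqTab x y ⟧)
    ≡⟨ N.∑-allFuns {n} {m} _ ⟩
  N.∑ (allFuns n m) (λ g → N.∑ (allFin m) (λ j → N.⟦ eqTab (consF j g) y ⟧))
    ≡⟨ N.∑-cong (allFuns n m) (λ g → trans
        (N.∑-cong (allFin m) (λ j → trans (cong N.⟦_⟧ (cong ((j ==F y F.zero) ∧_) (all-tabulate (λ i → consF j g i ==F y i) F.suc)))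
                                          (N.⟦∧⟧ (j ==F y F.zero) (eqTab g (y ∘ F.suc)))))
        (trans (sym (N.∑-*ʳ (allFin m) (λ j → N.⟦ j ==F y F.zero ⟧) N.⟦ eqTab g (y ∘ F.suc) ⟧))
               (trans (cong (ℕ._* N.⟦ eqTab g (y ∘ F.suc) ⟧) (allFin-once (y F.zero))) (ℕP.*-identityˡ _)))) ⟩
  N.∑ (allFuns n m) (λ g → N.⟦ eqTab g (y ∘ F.suc) ⟧)
    ≡⟨ allFuns-once (y ∘ F.suc) ⟩
  1 ∎
  where open ≡-Reasoning

FinE : (n : ℕ) → Enum (Fin n)
FinE n = record { list = allFin n ; eq = _==F_ ; once = λ y → trans (length-filterB _ (allFin n)) (allFin-once y) }

FunE : (n m : ℕ) → Enum (Fin n → Fin m)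
FunE n m = record { list = allFuns n m ; eq = eqTab ; once = λ y → trans (length-filterB _ (allFuns n m)) (allFuns-once y) }

-- Permutations and their signs

injB⇒ : {n : ℕ} (f : Fin n → Fin n) → injB f ≡ true → Injective _≡_ _≡_ f
injB⇒ {n} f e {i} {j} fi≡fj = ==F⇒ (lemma (f i ==F f j) (⇒==F fi≡fj)
  (allFin⇒ (λ j → not (f i ==F f j) ∨ (i ==F j)) (allFin⇒ (λ i → all (λ j → not (f i ==F f j) ∨ (i ==F j)) (allFin n)) e i) j))
  where
  lemma : (a : Bool) {b : Bool} → a ≡ true → not a ∨ b ≡ true → b ≡ true
  lemma true refl e = e

⇒injB : {n : ℕ} {f : Fin n → Fin n} → Injective _≡_ _≡_ f → injB f ≡ true
⇒injB {n} {f} inj = ⇒allFin _ (λ i → ⇒allFin _ (λ j → lemma (f i ==F f j) (λ e → ⇒==F (inj (==F⇒ e)))))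
  where
  lemma : (a : Bool) {b : Bool} → (a ≡ true → b ≡ true) → not a ∨ b ≡ true
  lemma true h = h refl
  lemma false h = refl

injB-cong : {n : ℕ} {f g : Fin n → Fin n} → f ≗ g → injB f ≡ injB g
injB-cong {n} h = all-cong (allFin n) (λ i → all-cong (allFin n) (λ j →
  cong (λ b → not b ∨ (i ==F j)) (cong₂ _==F_ (h i) (h j))))

-- Pigeonhole: a missed value could be punched out, leaving an injection into a smaller `Fin`.
injective⇒surjective : {n : ℕ} {f : Fin n → Fin n} → Injective _≡_ _≡_ f → ∀ y → ∃[ x ] f x ≡ y
injective⇒surjective {suc n} {f} inj y with FP.any? (λ x → f x FP.≟ y)
... | yes p = p
... | no ¬p = ⊥-elim (ℕP.1+n≰n (FP.injective⇒≤ {f = λ x → F.punchOut {i = y} (λ e → ¬p (x , sym e))}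
                (λ {a} {b} e → inj (FP.punchOut-injective {i = y} _ _ e))))

fromInjective : {n : ℕ} (f : Fin n → Fin n) → Injective _≡_ _≡_ f → Permutation′ n
fromInjective f inj = permutation f (proj₁ ∘ sur) (λ y → proj₂ (sur y)) (λ x → inj (proj₂ (sur (f x))))
  where sur = injective⇒surjective inj

fromInjB : {n : ℕ} (f : Fin n → Fin n) → injB f ≡ true → Permutation′ n
fromInjB f e = fromInjective f (injB⇒ f e)

ʳ-injective : {n : ℕ} (π : Permutation′ n) → Injective _≡_ _≡_ (π ⟨$⟩ʳ_)
ʳ-injective π {i} {j} e = trans (sym (inverseˡ π)) (trans (cong (π ⟨$⟩ˡ_) e) (inverseˡ π))

ʳ-isPerm : {n : ℕ} (π : Permutation′ n) → IsPerm (π ⟨$⟩ʳ_)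
ʳ-isPerm π = (λ {i} {j} → ʳ-injective π {i} {j}) , λ y → π ⟨$⟩ˡ y , λ { refl → inverseʳ π }

ʳ-injB : {n : ℕ} (π : Permutation′ n) → injB (π ⟨$⟩ʳ_) ≡ true
ʳ-injB π = ⇒injB (λ {i} {j} → ʳ-injective π {i} {j})

module _ {n : ℕ} (π : Permutation′ n) where

  -- This and the next two lemmas supply the adjunction required by `∑-reindex`, for π acting on
  -- points and, by composition on either side, on functions.
  adjoint-Fin : (x y : Fin n) → (y ==F (π ⟨$⟩ʳ x)) ≡ (x ==F (π ⟨$⟩ˡ y))
  adjoint-Fin x y = bool-ext
    (λ e → ⇒==F (trans (sym (inverseˡ π)) (cong (π ⟨$⟩ˡ_) (sym (==F⇒ {i = y} e)))))
    (λ e → ⇒==F (trans (sym (inverseʳ π)) (cong (π ⟨$⟩ʳ_) (sym (==F⇒ {i = x} e)))))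

  adjoint-pre : {m : ℕ} (x y : Fin n → Fin m) → eqTab y (x ∘ (π ⟨$⟩ʳ_)) ≡ eqTab x (y ∘ (π ⟨$⟩ˡ_))
  adjoint-pre x y = bool-ext
    (λ e → ⇒eqTab (λ i → trans (cong x (sym (inverseʳ π))) (sym (eqTab⇒ y _ e (π ⟨$⟩ˡ i)))))
    (λ e → ⇒eqTab (λ i → trans (cong y (sym (inverseˡ π))) (sym (eqTab⇒ x _ e (π ⟨$⟩ʳ i)))))

  adjoint-post : {m : ℕ} (x y : Fin m → Fin n) → eqTab y ((π ⟨$⟩ʳ_) ∘ x) ≡ eqTab x ((π ⟨$⟩ˡ_) ∘ y)
  adjoint-post x y = bool-ext
    (λ e → ⇒eqTab (λ i → trans (sym (inverseˡ π)) (cong (π ⟨$⟩ˡ_) (sym (eqTab⇒ y _ e i)))))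
    (λ e → ⇒eqTab (λ i → trans (sym (inverseʳ π)) (cong (π ⟨$⟩ʳ_) (sym (eqTab⇒ x _ e i)))))

  injB-pre : (σ : Fin n → Fin n) → injB (σ ∘ (π ⟨$⟩ʳ_)) ≡ injB σ
  injB-pre σ = bool-ext
    (λ e → ⇒injB (λ {i} {j} eq → trans (sym (inverseʳ π)) (trans (cong (π ⟨$⟩ʳ_)
       (injB⇒ (σ ∘ (π ⟨$⟩ʳ_)) e (trans (cong σ (inverseʳ π)) (trans eq (cong σ (sym (inverseʳ π))))))) (inverseʳ π))))
    (λ e → ⇒injB (λ {i} {j} eq → ʳ-injective π (injB⇒ σ e eq)))

  injB-post : (σ : Fin n → Fin n) → injB ((π ⟨$⟩ʳ_) ∘ σ) ≡ injB σ
  injB-post σ = bool-ext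
    (λ e → ⇒injB (λ {i} {j} eq → injB⇒ ((π ⟨$⟩ʳ_) ∘ σ) e (cong (π ⟨$⟩ʳ_) eq)))
    (λ e → ⇒injB (λ {i} {j} eq → injB⇒ σ e (ʳ-injective π eq)))

-- Inversions and the multiplicativity of the sign

lt : {n : ℕ} → Fin n → Fin n → Bool
lt i j = toℕ i ℕ.<ᵇ toℕ j

-- Both boolean comparisons are recorded in each case, so that `rewrite` evaluates the inversion
-- tests.
data Order {n : ℕ} (i j : Fin n) : Set where
  lt′ : lt i j ≡ true → lt j i ≡ false → ¬ (i ≡ j) → Order i j
  eq′ : lt i j ≡ false → lt j i ≡ false → i ≡ j → Order i j
  gt′ : lt i j ≡ false → lt j i ≡ true → ¬ (i ≡ j) → Order i j

<ᵇ-irrefl : (a : ℕ) → (a ℕ.<ᵇ a) ≡ false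
<ᵇ-irrefl zero = refl
<ᵇ-irrefl (suc a) = <ᵇ-irrefl a

<ᵇ-asym : (a b : ℕ) → a ℕ.< b → (a ℕ.<ᵇ b) ≡ true × (b ℕ.<ᵇ a) ≡ false
<ᵇ-asym zero (suc b) _ = refl , refl
<ᵇ-asym (suc a) (suc b) (ℕ.s≤s a<b) = <ᵇ-asym a b a<b

order : {n : ℕ} (i j : Fin n) → Order i j
order i j with FP.<-cmp i j
... | tri< a ≢ _ = lt′ (proj₁ (<ᵇ-asym _ _ a)) (proj₂ (<ᵇ-asym _ _ a)) ≢
... | tri≈ _ refl _ = eq′ (<ᵇ-irrefl (toℕ i)) (<ᵇ-irrefl (toℕ i)) refl
... | tri> _ ≢ a = gt′ (proj₂ (<ᵇ-asym _ _ a)) (proj₁ (<ᵇ-asym _ _ a)) ≢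

∑∑ : {n : ℕ} → (Fin n → Fin n → ℕ) → ℕ
∑∑ {n} f = N.∑ (allFin n) (λ i → N.∑ (allFin n) (f i))

∑∑-cong : {n : ℕ} {f g : Fin n → Fin n → ℕ} → (∀ i j → f i j ≡ g i j) → ∑∑ f ≡ ∑∑ g
∑∑-cong {n} h = N.∑-cong (allFin n) (λ i → N.∑-cong (allFin n) (h i))

∑∑-+ : {n : ℕ} (f g : Fin n → Fin n → ℕ) → ∑∑ (λ i j → f i j ℕ.+ g i j) ≡ ∑∑ f ℕ.+ ∑∑ g
∑∑-+ {n} f g = trans (N.∑-cong (allFin n) (λ i → N.∑-+ (allFin n) (f i) (g i))) (N.∑-+ (allFin n) _ _)

inversions-∑∑ : {n : ℕ} (σ : Fin n → Fin n) → inversions σ ≡ ∑∑ (λ i j → N.⟦ lt i j ∧ lt (σ j) (σ i) ⟧)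
inversions-∑∑ {n} σ = trans (length-filterB _ (concatMap (λ i → map (λ j → (i , j)) (allFin n)) (allFin n)))
  (trans (N.∑-concatMap (λ i → map (λ j → (i , j)) (allFin n)) (allFin n) _)
         (N.∑-cong (allFin n) (λ i → N.∑-map (λ j → (i , j)) (allFin n) _)))

pairs : {n : ℕ} → (Fin n → Fin n → Bool) → ℕ
pairs u = ∑∑ (λ i j → N.⟦ lt i j ∧ u i j ⟧)

module _ {n : ℕ} (u : Fin n → Fin n → Bool) (u-sym : ∀ i j → u i j ≡ u j i) (u-irr : ∀ i → u i i ≡ false) where

  pairs-double : ∑∑ (λ i j → N.⟦ u i j ⟧) ≡ pairs u ℕ.+ pairs u
  pairs-double = begin
    ∑∑ (λ i j → N.⟦ u i j ⟧) ≡⟨ ∑∑-cong split ⟩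
    ∑∑ (λ i j → N.⟦ lt i j ∧ u i j ⟧ ℕ.+ N.⟦ lt j i ∧ u j i ⟧) ≡⟨ ∑∑-+ (λ i j → N.⟦ lt i j ∧ u i j ⟧) _ ⟩
    pairs u ℕ.+ ∑∑ (λ i j → N.⟦ lt j i ∧ u j i ⟧) ≡⟨ cong (pairs u ℕ.+_) (N.∑-swap (allFin n) (allFin n) (λ i j → N.⟦ lt j i ∧ u j i ⟧)) ⟩
    pairs u ℕ.+ pairs u ∎
    where
    open ≡-Reasoning
    split : ∀ i j → N.⟦ u i j ⟧ ≡ N.⟦ lt i j ∧ u i j ⟧ ℕ.+ N.⟦ lt j i ∧ u j i ⟧
    split i j with order i j
    ... | lt′ p q _ rewrite p | q = sym (ℕP.+-identityʳ _)
    ... | eq′ p q refl rewrite p | u-irr i = refl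
    ... | gt′ p q _ rewrite p | q = cong N.⟦_⟧ (u-sym i j)

double-injective : {a b : ℕ} → a ℕ.+ a ≡ b ℕ.+ b → a ≡ b
double-injective {a} {b} e = trans (ℕP.n≡⌊n+n/2⌋ a) (trans (cong ℕ.⌊_/2⌋ e) (sym (ℕP.n≡⌊n+n/2⌋ b)))

-- Twice the number of unordered pairs is the number of ordered pairs, by `pairs-double`. The latter
-- count does not mention the order on `Fin n`, so π may be reindexed away in each coordinate.
pairs-perm : {n : ℕ} (u : Fin n → Fin n → Bool) → (∀ i j → u i j ≡ u j i) → (∀ i → u i i ≡ false) →
  (π : Permutation′ n) → pairs (λ i j → u (π ⟨$⟩ʳ i) (π ⟨$⟩ʳ j)) ≡ pairs u
pairs-perm {n} u u-sym u-irr π = double-injective (begin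
  pairs u∘π ℕ.+ pairs u∘π ≡⟨ pairs-double u∘π (λ i j → u-sym _ _) (λ i → u-irr _) ⟨
  ∑∑ (λ i j → N.⟦ u∘π i j ⟧)
    ≡⟨ N.∑-cong (allFin n) (λ i → reindex (λ j → N.⟦ u (π ⟨$⟩ʳ i) j ⟧)) ⟩
  N.∑ (allFin n) (λ i → N.∑ (allFin n) (λ j → N.⟦ u (π ⟨$⟩ʳ i) j ⟧))
    ≡⟨ reindex (λ i → N.∑ (allFin n) (λ j → N.⟦ u i j ⟧)) ⟩
  ∑∑ (λ i j → N.⟦ u i j ⟧) ≡⟨ pairs-double u u-sym u-irr ⟩
  pairs u ℕ.+ pairs u ∎)
  where
  open ≡-Reasoning
  u∘π = λ i j → u (π ⟨$⟩ʳ i) (π ⟨$⟩ʳ j)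
  reindex : (f : Fin n → ℕ) → N.∑ (allFin n) (λ i → f (π ⟨$⟩ʳ i)) ≡ N.∑ (allFin n) f
  reindex f = N.∑-reindex (FinE n) (FinE n) (π ⟨$⟩ʳ_) (π ⟨$⟩ˡ_) (adjoint-Fin π) f (λ x y e → cong f (==F⇒ e))

sg : ℕ → ℚ
sg k = if evenB k then 1ℚ else ℚ.- 1ℚ

sg-suc : ∀ k → sg (suc k) ≡ ℚ.- sg k
sg-suc k with evenB k
... | true = refl
... | false = refl

sg-+ : ∀ a b → sg (a ℕ.+ b) ≡ sg a ℚ.* sg b
sg-+ zero b = sym (ℚP.*-identityˡ (sg b))
sg-+ (suc a) b = begin
  sg (suc (a ℕ.+ b)) ≡⟨ sg-suc (a ℕ.+ b) ⟩
  ℚ.- sg (a ℕ.+ b) ≡⟨ cong ℚ.-_ (sg-+ a b) ⟩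
  ℚ.- (sg a ℚ.* sg b) ≡⟨ ℚP.neg-distribˡ-* (sg a) (sg b) ⟩
  (ℚ.- sg a) ℚ.* sg b ≡⟨ cong (ℚ._* sg b) (sg-suc a) ⟨
  sg (suc a) ℚ.* sg b ∎
  where open ≡-Reasoning

sg-square : ∀ a → sg a ℚ.* sg a ≡ 1ℚ
sg-square a with evenB a
... | true = refl
... | false = refl

sgn-square : {n : ℕ} (σ : Fin n → Fin n) → sgn σ ℚ.* sgn σ ≡ 1ℚ
sgn-square σ = sg-square (inversions σ)

inversions-cong : {n : ℕ} {σ τ : Fin n → Fin n} → σ ≗ τ → inversions σ ≡ inversions τ
inversions-cong {σ = σ} {τ} h = trans (inversions-∑∑ σ) (trans
  (∑∑-cong (λ i j → cong₂ (λ a b → N.⟦ lt i j ∧ lt a b ⟧) (h j) (h i)))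
  (sym (inversions-∑∑ τ)))

sgn-cong : {n : ℕ} {σ τ : Fin n → Fin n} → σ ≗ τ → sgn σ ≡ sgn τ
sgn-cong h = cong sg (inversions-cong h)

sgn-id : (n : ℕ) → sgn {n} id ≡ 1ℚ
sgn-id n = cong sg (trans (inversions-∑∑ {n} id)
  (N.∑-zero (allFin n) (λ i → N.∑-zero (allFin n) (λ j → cong N.⟦_⟧ (lemma i j)))))
  where
  lemma : (i j : Fin n) → lt i j ∧ lt j i ≡ false
  lemma i j with order i j
  ... | lt′ p q _ rewrite p = q
  ... | eq′ p q _ rewrite p = refl
  ... | gt′ p q _ rewrite p = refl

-- Modulo 2, inv(σπ) = inv π + #{i<j : σ changes the order of π i and π j}; the second set of pairs
-- is a set of unordered pairs, so π only permutes it.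
sgn-∘ : {n : ℕ} (σ : Fin n → Fin n) → injB σ ≡ true → (π : Permutation′ n) →
  sgn (σ ∘ (π ⟨$⟩ʳ_)) ≡ sgn σ ℚ.* sgn (π ⟨$⟩ʳ_)
sgn-∘ {n} σ σ-inj π = begin
  sg (inversions (σ ∘ p)) ≡⟨ ℚP.*-identityʳ _ ⟨
  sg (inversions (σ ∘ p)) ℚ.* 1ℚ ≡⟨ cong (sg (inversions (σ ∘ p)) ℚ.*_) (trans (sg-+ d d) (sg-square d)) ⟨
  sg (inversions (σ ∘ p)) ℚ.* sg (d ℕ.+ d) ≡⟨ sg-+ (inversions (σ ∘ p)) _ ⟨
  sg (inversions (σ ∘ p) ℕ.+ (d ℕ.+ d)) ≡⟨ cong sg count ⟩
  sg (inversions σ ℕ.+ inversions p) ≡⟨ sg-+ (inversions σ) _ ⟩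
  sg (inversions σ) ℚ.* sg (inversions p) ∎
  where
  open ≡-Reasoning
  p = π ⟨$⟩ʳ_
  u : Fin n → Fin n → Bool
  u x y = lt y x xor lt (σ y) (σ x)
  u-sym : ∀ x y → u x y ≡ u y x
  u-sym x y with order x y
  ... | eq′ a b refl = refl
  ... | lt′ a b ne with order (σ x) (σ y)
  ...   | lt′ c d _ rewrite a | b | c | d = refl
  ...   | eq′ c d e = ⊥-elim (ne (injB⇒ σ σ-inj e))
  ...   | gt′ c d _ rewrite a | b | c | d = refl
  u-sym x y | gt′ a b ne with order (σ x) (σ y)
  ...   | lt′ c d _ rewrite a | b | c | d = refl
  ...   | eq′ c d e = ⊥-elim (ne (injB⇒ σ σ-inj e))
  ...   | gt′ c d _ rewrite a | b | c | d = refl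
  u-irr : ∀ x → u x x ≡ false
  u-irr x rewrite <ᵇ-irrefl (toℕ x) = <ᵇ-irrefl (toℕ (σ x))
  -- The pairs inverted by π and put back in order by σ. Adding their number twice makes the
  -- congruence modulo 2 an exact equality, which `bits` checks pair by pair.
  dd : Fin n → Fin n → ℕ
  dd i j = N.⟦ lt i j ∧ (lt (p j) (p i) ∧ not (lt (σ (p j)) (σ (p i)))) ⟧
  d = ∑∑ dd
  bits : (a b c : Bool) → N.⟦ a ∧ c ⟧ ℕ.+ (N.⟦ a ∧ (b ∧ not c) ⟧ ℕ.+ N.⟦ a ∧ (b ∧ not c) ⟧) ≡ N.⟦ a ∧ (b xor c) ⟧ ℕ.+ N.⟦ a ∧ b ⟧
  bits false b c = refl
  bits true false false = refl
  bits true false true = refl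
  bits true true false = refl
  bits true true true = refl
  count : inversions (σ ∘ p) ℕ.+ (d ℕ.+ d) ≡ inversions σ ℕ.+ inversions p
  count = begin
    inversions (σ ∘ p) ℕ.+ (d ℕ.+ d)
      ≡⟨ cong₂ ℕ._+_ (inversions-∑∑ (σ ∘ p)) (sym (∑∑-+ dd dd)) ⟩
    ∑∑ (λ i j → N.⟦ lt i j ∧ lt (σ (p j)) (σ (p i)) ⟧) ℕ.+ ∑∑ (λ i j → dd i j ℕ.+ dd i j)
      ≡⟨ ∑∑-+ (λ i j → N.⟦ lt i j ∧ lt (σ (p j)) (σ (p i)) ⟧) _ ⟨
    ∑∑ (λ i j → N.⟦ lt i j ∧ lt (σ (p j)) (σ (p i)) ⟧ ℕ.+ (dd i j ℕ.+ dd i j))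
      ≡⟨ ∑∑-cong (λ i j → bits (lt i j) (lt (p j) (p i)) (lt (σ (p j)) (σ (p i)))) ⟩
    ∑∑ (λ i j → N.⟦ lt i j ∧ u (p i) (p j) ⟧ ℕ.+ N.⟦ lt i j ∧ lt (p j) (p i) ⟧)
      ≡⟨ ∑∑-+ (λ i j → N.⟦ lt i j ∧ u (p i) (p j) ⟧) _ ⟩
    pairs (λ i j → u (p i) (p j)) ℕ.+ ∑∑ (λ i j → N.⟦ lt i j ∧ lt (p j) (p i) ⟧)
      ≡⟨ cong₂ ℕ._+_ (trans (pairs-perm u u-sym u-irr π) (∑∑-cong id-case)) (sym (inversions-∑∑ p)) ⟩
    ∑∑ (λ i j → N.⟦ lt i j ∧ lt (σ j) (σ i) ⟧) ℕ.+ inversions p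
      ≡⟨ cong (ℕ._+ inversions p) (inversions-∑∑ σ) ⟨
    inversions σ ℕ.+ inversions p ∎
    where
    id-case : ∀ i j → N.⟦ lt i j ∧ u i j ⟧ ≡ N.⟦ lt i j ∧ lt (σ j) (σ i) ⟧
    id-case i j with order i j
    ... | lt′ p q _ rewrite p | q = refl
    ... | eq′ p q _ rewrite p = refl
    ... | gt′ p q _ rewrite p = refl

sgn-inverse : {n : ℕ} (π : Permutation′ n) → sgn (π ⟨$⟩ˡ_) ≡ sgn (π ⟨$⟩ʳ_)
sgn-inverse {n} π = begin
  sgn g ≡⟨ ℚP.*-identityʳ _ ⟨
  sgn g ℚ.* 1ℚ ≡⟨ cong (sgn g ℚ.*_) (sgn-square f) ⟨
  sgn g ℚ.* (sgn f ℚ.* sgn f) ≡⟨ ℚP.*-assoc (sgn g) (sgn f) (sgn f) ⟨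
  sgn g ℚ.* sgn f ℚ.* sgn f ≡⟨ cong (ℚ._* sgn f) (sgn-∘ g (ʳ-injB (flip π)) π) ⟨
  sgn (g ∘ f) ℚ.* sgn f ≡⟨ cong (ℚ._* sgn f) (trans (sgn-cong {σ = g ∘ f} {id} (λ i → inverseˡ π)) (sgn-id n)) ⟩
  1ℚ ℚ.* sgn f ≡⟨ ℚP.*-identityˡ _ ⟩
  sgn f ∎
  where
  open ≡-Reasoning
  f = π ⟨$⟩ʳ_
  g = π ⟨$⟩ˡ_

module _ {n : ℕ} (a b : Fin n) where

  transpose-left : transpose a b ⟨$⟩ʳ a ≡ b
  transpose-left with a FP.≟ a
  ... | yes _ = refl
  ... | no ne = ⊥-elim (ne refl)

  transpose-right : transpose a b ⟨$⟩ʳ b ≡ a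
  transpose-right with b FP.≟ a
  ... | yes e = e
  ... | no _ with b FP.≟ b
  ...   | yes _ = refl
  ...   | no ne = ⊥-elim (ne refl)

  transpose-other : {c : Fin n} → ¬ (c ≡ a) → ¬ (c ≡ b) → transpose a b ⟨$⟩ʳ c ≡ c
  transpose-other {c} c≢a c≢b with c FP.≟ a
  ... | yes e = ⊥-elim (c≢a e)
  ... | no _ with c FP.≟ b
  ...   | yes e = ⊥-elim (c≢b e)
  ...   | no _ = refl

-- All transpositions are conjugate to (0 1), which has exactly one inversion.
sgn-transpose : {n : ℕ} (a b : Fin n) → ¬ (a ≡ b) → sgn (transpose a b ⟨$⟩ʳ_) ≡ ℚ.- 1ℚ
sgn-transpose {suc zero} F.zero F.zero a≢b = ⊥-elim (a≢b refl)
sgn-transpose {suc (suc n)} a b a≢b = begin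
  sgn τ ≡⟨ ℚP.*-identityʳ _ ⟨
  sgn τ ℚ.* 1ℚ ≡⟨ cong (sgn τ ℚ.*_) (sgn-square ρ) ⟨
  sgn τ ℚ.* (sgn ρ ℚ.* sgn ρ) ≡⟨ ℚP.*-assoc (sgn τ) _ _ ⟨
  sgn τ ℚ.* sgn ρ ℚ.* sgn ρ ≡⟨ cong (ℚ._* sgn ρ) (sgn-∘ τ (ʳ-injB (transpose a b)) ρP) ⟨
  sgn (τ ∘ ρ) ℚ.* sgn ρ ≡⟨ cong (ℚ._* sgn ρ) (sgn-cong conj) ⟩
  sgn (ρ ∘ τ₀) ℚ.* sgn ρ ≡⟨ cong (ℚ._* sgn ρ) (trans (sgn-∘ ρ (ʳ-injB ρP) (transpose F.zero one)) (ℚP.*-comm (sgn ρ) _)) ⟩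
  sgn τ₀ ℚ.* sgn ρ ℚ.* sgn ρ ≡⟨ ℚP.*-assoc (sgn τ₀) _ _ ⟩
  sgn τ₀ ℚ.* (sgn ρ ℚ.* sgn ρ) ≡⟨ cong (sgn τ₀ ℚ.*_) (sgn-square ρ) ⟩
  sgn τ₀ ℚ.* 1ℚ ≡⟨ ℚP.*-identityʳ _ ⟩
  sgn τ₀ ≡⟨ cong sg inversions-τ₀ ⟩
  ℚ.- 1ℚ ∎
  where
  open ≡-Reasoning
  one : Fin (suc (suc n))
  one = F.suc F.zero
  τ = transpose a b ⟨$⟩ʳ_
  τ₀ = transpose F.zero one ⟨$⟩ʳ_
  -- The conjugating permutation: α takes 0 to `a`, and β takes 1 to the α-preimage of `b` while
  -- fixing 0. Applying β first and then α takes 0 to `a` and 1 to `b`.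
  α = transpose F.zero a
  b′ = α ⟨$⟩ˡ b
  β = transpose one b′
  ρP = β ∘ₚ α
  ρ = ρP ⟨$⟩ʳ_
  b′≢0 : ¬ (F.zero ≡ b′)
  b′≢0 e = a≢b (trans (sym (transpose-left F.zero a)) (trans (cong (α ⟨$⟩ʳ_) e) (inverseʳ α)))
  ρ0 : ρ F.zero ≡ a
  ρ0 = trans (cong (α ⟨$⟩ʳ_) (transpose-other one b′ (λ ()) b′≢0)) (transpose-left F.zero a)
  ρ1 : ρ one ≡ b
  ρ1 = trans (cong (α ⟨$⟩ʳ_) (transpose-left one b′)) (inverseʳ α)
  conj : τ ∘ ρ ≗ ρ ∘ τ₀
  conj F.zero = trans (cong τ ρ0) (trans (transpose-left a b) (trans (sym ρ1) (cong ρ (sym (transpose-left F.zero one)))))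
  conj (F.suc F.zero) = trans (cong τ ρ1) (trans (transpose-right a b) (trans (sym ρ0) (cong ρ (sym (transpose-right F.zero one)))))
  conj (F.suc (F.suc i)) = trans
    (transpose-other a b (λ e → 0≢ (ʳ-injective ρP (trans e (sym ρ0)))) (λ e → 1≢ (ʳ-injective ρP (trans e (sym ρ1)))))
    (cong ρ (sym (transpose-other F.zero one 0≢ 1≢)))
    where
    0≢ : ¬ (F.suc (F.suc i) ≡ F.zero)
    0≢ ()
    1≢ : ¬ (F.suc (F.suc i) ≡ one)
    1≢ ()
  pointwise : ∀ i j → N.⟦ lt i j ∧ lt (τ₀ j) (τ₀ i) ⟧ ≡ N.⟦ i ==F F.zero ⟧ ℕ.* N.⟦ j ==F one ⟧
  pointwise F.zero F.zero = refl
  pointwise F.zero (F.suc F.zero) = refl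
  pointwise F.zero (F.suc (F.suc j)) = refl
  pointwise (F.suc F.zero) F.zero = refl
  pointwise (F.suc F.zero) (F.suc F.zero) = refl
  pointwise (F.suc F.zero) (F.suc (F.suc j)) = refl
  pointwise (F.suc (F.suc i)) F.zero = refl
  pointwise (F.suc (F.suc i)) (F.suc F.zero) = refl
  pointwise (F.suc (F.suc i)) (F.suc (F.suc j)) with order i j
  ... | lt′ p q _ rewrite p | q = refl
  ... | eq′ p q _ rewrite p = refl
  ... | gt′ p q _ rewrite p = refl
  inversions-τ₀ : inversions τ₀ ≡ 1
  inversions-τ₀ = begin
    inversions τ₀ ≡⟨ inversions-∑∑ τ₀ ⟩
    ∑∑ (λ i j → N.⟦ lt i j ∧ lt (τ₀ j) (τ₀ i) ⟧) ≡⟨ ∑∑-cong pointwise ⟩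
    ∑∑ (λ i j → N.⟦ i ==F F.zero ⟧ ℕ.* N.⟦ j ==F one ⟧)
      ≡⟨ N.∑-cong (allFin (suc (suc n))) (λ i → sym (N.∑-* N.⟦ i ==F F.zero ⟧ (allFin (suc (suc n))) (λ j → N.⟦ j ==F one ⟧))) ⟩
    N.∑ (allFin (suc (suc n))) (λ i → N.⟦ i ==F F.zero ⟧ ℕ.* N.∑ (allFin (suc (suc n))) (λ j → N.⟦ j ==F one ⟧))
      ≡⟨ N.∑-δ (FinE (suc (suc n))) F.zero (λ _ → N.∑ (allFin (suc (suc n))) (λ j → N.⟦ j ==F one ⟧)) (λ _ _ → refl) ⟩
    N.∑ (allFin (suc (suc n))) (λ j → N.⟦ j ==F one ⟧) ≡⟨ allFin-once one ⟩
    1 ∎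

-- Fillings and the lemma on columns and rows

search : {A : Set} (p : A → Bool) (xs : List A) → (∃[ x ] p x ≡ true) ⊎ (∀ x → x ∈ xs → p x ≡ false)
search p [] = inj₂ λ _ ()
search p (x ∷ xs) with p x in e
... | true = inj₁ (x , e)
... | false with search p xs
...   | inj₁ found = inj₁ found
...   | inj₂ none = inj₂ λ { _ (here refl) → e ; y (there y∈) → none y y∈ }

∑ℕ-mono : {A : Set} (xs : List A) {f g : A → ℕ} → (∀ x → f x ≤ g x) → N.∑ xs f ≤ N.∑ xs g
∑ℕ-mono [] h = ℕ.z≤n
∑ℕ-mono (x ∷ xs) h = ℕP.+-mono-≤ (h x) (∑ℕ-mono xs h)

-- The rigidity device for the combinatorial arguments: a quantity that can only grow pointwise but
-- has a conserved total does not change at all.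
∑ℕ-squeeze : {A : Set} (xs : List A) {f g : A → ℕ} → (∀ x → f x ≤ g x) → N.∑ xs g ≤ N.∑ xs f →
  ∀ x → x ∈ xs → f x ≡ g x
∑ℕ-squeeze (x ∷ xs) {f} {g} f≤g le y y∈ = go y y∈
  where
  gx≤fx : g x ≤ f x
  gx≤fx = ℕP.+-cancelʳ-≤ (N.∑ xs g) (g x) (f x) (ℕP.≤-trans le (ℕP.+-monoʳ-≤ (f x) (∑ℕ-mono xs f≤g)))
  go : ∀ y → y ∈ (x ∷ xs) → f y ≡ g y
  go y (here refl) = ℕP.≤-antisym (f≤g x) gx≤fx
  go y (there y∈) = ∑ℕ-squeeze xs f≤g
    (ℕP.+-cancelˡ-≤ (f x) _ _ (ℕP.≤-trans (ℕP.+-monoˡ-≤ (N.∑ xs g) (f≤g x)) le)) y y∈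

∑ℕ-strict : {n : ℕ} {f g : Fin n → ℕ} → (∀ x → f x ≤ g x) → (i : Fin n) → f i < g i →
  N.∑ (allFin n) f < N.∑ (allFin n) g
∑ℕ-strict {n} f≤g i fi<gi = ℕP.≰⇒> λ le → ℕP.<⇒≢ fi<gi (∑ℕ-squeeze (allFin n) f≤g le i (∈-allFin i))

⟦⟧-mono : (a : Bool) {b : Bool} → (a ≡ true → b ≡ true) → N.⟦ a ⟧ ≤ N.⟦ b ⟧
⟦⟧-mono false h = ℕ.z≤n
⟦⟧-mono true h rewrite h refl = ℕP.≤-refl

⟦⟧-strict : (a b : Bool) → a ≡ false → b ≡ true → N.⟦ a ⟧ < N.⟦ b ⟧
⟦⟧-strict _ _ refl refl = ℕP.≤-refl

∑ℕ-ones : (m : ℕ) → N.∑ (allFin m) (λ _ → 1) ≡ m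
∑ℕ-ones zero = refl
∑ℕ-ones (suc m) = trans (N.∑-suc (λ (_ : Fin (suc m)) → 1)) (cong suc (∑ℕ-ones m))

<⇒<ᵇ : {a b : ℕ} → a < b → (a ℕ.<ᵇ b) ≡ true
<⇒<ᵇ {a} {b} h = proj₁ (<ᵇ-asym a b h)

<ᵇ⇒< : (a b : ℕ) → (a ℕ.<ᵇ b) ≡ true → a < b
<ᵇ⇒< a b e with a ℕP.<? b
... | yes p = p
... | no ¬p with ℕP.<-cmp a b
...   | tri< p _ _ = p
...   | tri≈ _ refl _ with () ← trans (sym e) (<ᵇ-irrefl a)
...   | tri> _ _ p with () ← trans (sym e) (proj₂ (<ᵇ-asym b a p))

-- Double counting of the pairs of an element of `P` and its key: every such element occurs in a
-- pair, and every key in at most one.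
count-≤ : {n m : ℕ} (P : Fin n → Bool) (key : Fin n → ℕ) →
  (∀ i j → P i ≡ true → P j ≡ true → key i ≡ key j → i ≡ j) →
  (∀ i → P i ≡ true → key i < m) → N.∑ (allFin n) (λ i → N.⟦ P i ⟧) ≤ m
count-≤ {n} {m} P key inj bound = begin
  N.∑ (allFin n) (λ i → N.⟦ P i ⟧) ≤⟨ ∑ℕ-mono (allFin n) spread ⟩
  N.∑ (allFin n) (λ i → N.∑ (allFin m) (λ c → N.⟦ hit c i ⟧)) ≡⟨ N.∑-swap (allFin n) (allFin m) (λ i c → N.⟦ hit c i ⟧) ⟩
  N.∑ (allFin m) (λ c → N.∑ (allFin n) (λ i → N.⟦ hit c i ⟧)) ≤⟨ ∑ℕ-mono (allFin m) atMostOne ⟩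
  N.∑ (allFin m) (λ _ → 1) ≡⟨ ∑ℕ-ones m ⟩
  m ∎
  where
  open ℕP.≤-Reasoning
  hit : Fin m → Fin n → Bool
  hit c i = P i ∧ (key i ≡ᵇ toℕ c)
  spread : ∀ i → N.⟦ P i ⟧ ≤ N.∑ (allFin m) (λ c → N.⟦ hit c i ⟧)
  spread i with P i in e
  ... | false = ℕ.z≤n
  ... | true = begin
    1 ≡⟨ allFin-once (F.fromℕ< (bound i e)) ⟨
    N.∑ (allFin m) (λ c → N.⟦ c ==F F.fromℕ< (bound i e) ⟧)
      ≤⟨ ∑ℕ-mono (allFin m) (λ c → ⟦⟧-mono (c ==F F.fromℕ< (bound i e)) (λ c≡ →
           ⇒≡ᵇ (trans (sym (FP.toℕ-fromℕ< (bound i e))) (cong toℕ (sym (==F⇒ c≡)))))) ⟩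
    N.∑ (allFin m) (λ c → N.⟦ key i ≡ᵇ toℕ c ⟧) ∎
  atMostOne : ∀ c → N.∑ (allFin n) (λ i → N.⟦ hit c i ⟧) ≤ 1
  atMostOne c with search (hit c) (allFin n)
  ... | inj₁ (i₀ , e₀) = begin
    N.∑ (allFin n) (λ i → N.⟦ hit c i ⟧)
      ≤⟨ ∑ℕ-mono (allFin n) (λ i → ⟦⟧-mono (hit c i) (λ e → ⇒==F (inj i i₀
           (proj₁ (∧-true (P i) e)) (proj₁ (∧-true (P i₀) e₀))
           (trans (≡ᵇ⇒ _ _ (proj₂ (∧-true (P i) e))) (sym (≡ᵇ⇒ _ _ (proj₂ (∧-true (P i₀) e₀)))))))) ⟩
    N.∑ (allFin n) (λ i → N.⟦ i ==F i₀ ⟧) ≡⟨ allFin-once i₀ ⟩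
    1 ∎
  ... | inj₂ none = begin
    N.∑ (allFin n) (λ i → N.⟦ hit c i ⟧) ≡⟨ N.∑-zero (allFin n) (λ i → cong N.⟦_⟧ (none i (∈-allFin i))) ⟩
    0 ≤⟨ ℕ.z≤n ⟩
    1 ∎

box-≡ : {sh : List ℕ} {b b′ : Box sh} → rowOf b ≡ rowOf b′ → colOf b ≡ colOf b′ → b ≡ b′
box-≡ {b = box r c} {box r′ c′} p q with FP.toℕ-injective p
... | refl with FP.toℕ-injective q
...   | refl = refl

module _ {n : ℕ} {sh : List ℕ} where

  row : Filling n sh → Fin n → ℕ
  row T i = rowOf (pos T i)

  col : Filling n sh → Fin n → ℕ
  col T i = colOf (pos T i)

  pos-injective : (T : Filling n sh) → Injective _≡_ _≡_ (pos T)
  pos-injective T = proj₁ (proj₂ T)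

  number : Filling n sh → Box sh → Fin n
  number T b = proj₁ (proj₂ (proj₂ T) b)

  pos-number : (T : Filling n sh) (b : Box sh) → pos T (number T b) ≡ b
  pos-number T b = proj₂ (proj₂ (proj₂ T) b) refl

  -- `S` identifies the boxes with `Fin n`, where injectivity implies surjectivity.
  mkFilling : (S : Filling n sh) (f : Fin n → Box sh) → Injective _≡_ _≡_ f → Filling n sh
  mkFilling S f f-inj = f , f-inj , sur
    where
    g = λ i → number S (f i)
    g-inj : Injective _≡_ _≡_ g
    g-inj {i} {j} e = f-inj (trans (sym (pos-number S (f i))) (trans (cong (pos S) e) (pos-number S (f j))))
    sur : ∀ b → ∃[ i ] (∀ {z} → z ≡ i → f z ≡ b)
    sur b with injective⇒surjective g-inj (number S b)
    ... | i , e = i , λ { refl → trans (sym (pos-number S (f i))) (trans (cong (pos S) e) (pos-number S b)) }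

  -- For the usual left action on tableaux this is π⁻¹T. The tableau πT is therefore written
  -- `T ∘T flip π`.
  _∘T_ : Filling n sh → Permutation′ n → Filling n sh
  T ∘T π = mkFilling T (λ i → pos T (π ⟨$⟩ʳ i)) (λ e → ʳ-injective π (pos-injective T e))

  -- The permutation ρ with ρS = T.
  relabel : Filling n sh → Filling n sh → Permutation′ n
  relabel S T = permutation (λ i → number T (pos S i)) (λ i → number S (pos T i)) (there-back T S) (there-back S T)
    where
    there-back : (T S : Filling n sh) → ∀ y → number T (pos S (number S (pos T y))) ≡ y
    there-back T S y = pos-injective T (trans (pos-number T _) (pos-number S _))

  relabel-pos : (S T : Filling n sh) (i : Fin n) → pos T (relabel S T ⟨$⟩ʳ i) ≡ pos S i
  relabel-pos S T i = pos-number T (pos S i)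

  ∑-filling : (g : Box sh → ℕ) (S T : Filling n sh) →
    N.∑ (allFin n) (g ∘ pos S) ≡ N.∑ (allFin n) (g ∘ pos T)
  ∑-filling g S T = trans (N.∑-cong (allFin n) (λ i → cong g (sym (relabel-pos S T i))))
    (N.∑-reindex (FinE n) (FinE n) (ρ ⟨$⟩ʳ_) (ρ ⟨$⟩ˡ_) (adjoint-Fin ρ) (g ∘ pos T) (λ x y e → cong (g ∘ pos T) (==F⇒ e)))
    where ρ = relabel S T

  row-size : (T : Filling n sh) (k : Fin (length sh)) → N.∑ (allFin n) (λ i → N.⟦ tabloid T i ==F k ⟧) ≡ lookup sh k
  row-size T k = begin
    N.∑ (allFin n) (λ i → N.⟦ tabloid T i ==F k ⟧)
      ≡⟨ N.∑-cong (allFin n) spread ⟩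
    N.∑ (allFin n) (λ i → N.∑ (allFin (lookup sh k)) (λ c → N.⟦ i ==F number T (box k c) ⟧))
      ≡⟨ N.∑-swap (allFin n) (allFin (lookup sh k)) _ ⟩
    N.∑ (allFin (lookup sh k)) (λ c → N.∑ (allFin n) (λ i → N.⟦ i ==F number T (box k c) ⟧))
      ≡⟨ N.∑-cong (allFin (lookup sh k)) (λ c → allFin-once (number T (box k c))) ⟩
    N.∑ (allFin (lookup sh k)) (λ _ → 1)
      ≡⟨ ∑ℕ-ones (lookup sh k) ⟩
    lookup sh k ∎
    where
    open ≡-Reasoning
    spread : ∀ i → N.⟦ tabloid T i ==F k ⟧ ≡ N.∑ (allFin (lookup sh k)) (λ c → N.⟦ i ==F number T (box k c) ⟧)
    spread i with tabloid T i FP.≟ k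
    ... | no ne = sym (N.∑-zero (allFin (lookup sh k)) (λ c → cong N.⟦_⟧ (≡false {i ==F number T (box k c)} (λ e →
          ne (cong Box.r (trans (cong (pos T) (==F⇒ e)) (pos-number T (box k c))))))))
    ... | yes refl = sym (trans (N.∑-cong (allFin (lookup sh k)) (λ c → cong N.⟦_⟧ (bool-ext {i ==F number T (box k c)} {c ==F c₀}
          (λ e → ⇒==F (FP.toℕ-injective (cong colOf (trans (sym (pos-number T (box k c))) (cong (pos T) (sym (==F⇒ e)))))))
          (λ e → ⇒==F (pos-injective T (trans (cong (box k) (sym (==F⇒ e))) (sym (pos-number T (box k c)))))))))
          (allFin-once c₀))
      where c₀ = Box.c (pos T i)

  -- The filling with rows prescribed by r, each row being sorted by the given key.
  module Rank (S : Filling n sh) (r : TabFun n (length sh)) (r≗ : r ≗ tabloid S) (key : Fin n → ℕ)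
              (key-injective : ∀ i j → r i ≡ r j → key i ≡ key j → i ≡ j) where

    below : Fin n → Fin n → Bool
    below i j = (r j ==F r i) ∧ (key j ℕ.<ᵇ key i)

    rank : Fin n → ℕ
    rank i = N.∑ (allFin n) (λ j → N.⟦ below i j ⟧)

    below-irrefl : ∀ i → below i i ≡ false
    below-irrefl i = ≡false {below i i} λ e → ℕP.<-irrefl refl (<ᵇ⇒< (key i) (key i) (proj₂ (∧-true (r i ==F r i) e)))

    row-size-r : ∀ k → N.∑ (allFin n) (λ j → N.⟦ r j ==F k ⟧) ≡ lookup sh k
    row-size-r k = trans (N.∑-cong (allFin n) (λ j → cong (λ x → N.⟦ x ==F k ⟧) (r≗ j))) (row-size S k)

    -- The inequality is strict because `i` belongs to its own row but is not below itself.
    rank< : ∀ i → rank i < lookup sh (r i)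
    rank< i = subst (rank i <_) (row-size-r (r i)) (∑ℕ-strict
      (λ j → ⟦⟧-mono (below i j) (λ e → proj₁ (∧-true (r j ==F r i) e))) i
      (⟦⟧-strict (below i i) (r i ==F r i) (below-irrefl i) (⇒==F {i = r i} refl)))

    rank-mono : ∀ i j → r i ≡ r j → key i < key j → rank i < rank j
    rank-mono i j ri≡rj ki<kj = ∑ℕ-strict
      (λ k → ⟦⟧-mono (below i k) (λ e → ∧-intro
        (⇒==F (trans (==F⇒ {i = r k} (proj₁ (∧-true (r k ==F r i) e))) ri≡rj))
        (<⇒<ᵇ (ℕP.<-trans (<ᵇ⇒< (key k) (key i) (proj₂ (∧-true (r k ==F r i) e))) ki<kj))))
      i (⟦⟧-strict (below i i) (below j i) (below-irrefl i) (∧-intro (⇒==F ri≡rj) (<⇒<ᵇ ki<kj)))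

    rank-injective : ∀ i j → r i ≡ r j → rank i ≡ rank j → i ≡ j
    rank-injective i j ri≡rj e with ℕP.<-cmp (key i) (key j)
    ... | tri≈ _ k≡ _ = key-injective i j ri≡rj k≡
    ... | tri< k< _ _ = ⊥-elim (ℕP.<⇒≢ (rank-mono i j ri≡rj k<) e)
    ... | tri> _ _ k> = ⊥-elim (ℕP.<⇒≢ (rank-mono j i (sym ri≡rj) k>) (sym e))

    rankFilling : Filling n sh
    rankFilling = mkFilling S (λ i → box (r i) (F.fromℕ< (rank< i))) (λ {i} {j} e → rank-injective i j
      (cong Box.r e) (trans (sym (FP.toℕ-fromℕ< (rank< i))) (trans (cong colOf e) (FP.toℕ-fromℕ< (rank< j)))))

    col-rankFilling : ∀ i → col rankFilling i ≡ rank i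
    col-rankFilling i = FP.toℕ-fromℕ< (rank< i)

  -- If no two numbers share a row of S and a column of T, rank the rows of S by the columns of T: each rank is at
  -- most the column, and both sum to the total of all columns, so they agree.
  module NoCollision (S T : Filling n sh) (inj : ∀ i j → tabloid S i ≡ tabloid S j → col T i ≡ col T j → i ≡ j) where
    open Rank S (tabloid S) (λ _ → refl) (col T) inj public

    rank≡col : ∀ i → rank i ≡ col T i
    rank≡col i = ∑ℕ-squeeze (allFin n) rank≤ (ℕP.≤-reflexive (trans (∑-filling colOf T rankFilling)
      (N.∑-cong (allFin n) col-rankFilling))) i (∈-allFin i)
      where
      rank≤ : ∀ i → rank i ≤ col T i
      rank≤ i = count-≤ (below i) (col T)
        (λ a b p q → inj a b (trans (==F⇒ (proj₁ (∧-true (tabloid S a ==F tabloid S i) p)))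
                                    (sym (==F⇒ (proj₁ (∧-true (tabloid S b ==F tabloid S i) q))))))
        (λ a p → <ᵇ⇒< _ _ (proj₂ (∧-true (tabloid S a ==F tabloid S i) p)))

  -- The combinatorial lemma behind the submodule theorem. In the second case `rankFilling` has the
  -- rows of `S` and, number by number, the columns of `T`; relabelling it to `T` is then a column
  -- permutation of `T`.
  collision : (S T : Filling n sh) →
    (∃[ a ] ∃[ b ] (¬ (a ≡ b) × tabloid S a ≡ tabloid S b × col T a ≡ col T b))
    ⊎ (Σ (Permutation′ n) λ π → (∀ i → col T (π ⟨$⟩ʳ i) ≡ col T i) × (∀ i → tabloid S i ≡ tabloid T (π ⟨$⟩ʳ i)))
  collision S T with FP.any? (λ a → FP.any? (λ b → ¬? (a FP.≟ b) ×-dec ((tabloid S a FP.≟ tabloid S b) ×-dec (col T a ℕP.≟ col T b))))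
  ... | yes found = inj₁ found
  ... | no none = inj₂ (relabel rankFilling T
      , (λ i → trans (cong colOf (relabel-pos rankFilling T i)) (trans (col-rankFilling i) (rank≡col i)))
      , (λ i → sym (cong Box.r (relabel-pos rankFilling T i))))
    where
    inj : ∀ i j → tabloid S i ≡ tabloid S j → col T i ≡ col T j → i ≡ j
    inj i j p q with i FP.≟ j
    ... | yes e = e
    ... | no ne = ⊥-elim (none (i , j , ne , p , q))
    open NoCollision S T inj

  rowcol-injective : (T : Filling n sh) {i j : Fin n} → tabloid T i ≡ tabloid T j → col T i ≡ col T j → i ≡ j
  rowcol-injective T p q = pos-injective T (box-≡ (cong toℕ p) q)

  -- In a standard tableau the column of `i` is the number of smaller entries in the row of `i`, a
  -- quantity that depends only on the tabloid.
  standard-unique : (T T′ : SYT n sh) → tabloid (proj₁ T) ≗ tabloid (proj₁ T′) → SameT {n} {sh} T T′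
  standard-unique (T , std) (T′ , std′) same i = box-≡ (cong toℕ (same i))
    (trans (col-count T (proj₁ std) i) (trans
      (N.∑-cong (allFin n) (λ j → cong₂ (λ a b → N.⟦ (a ==F b) ∧ (toℕ j ℕ.<ᵇ toℕ i) ⟧) (same j) (same i)))
      (sym (col-count T′ (proj₁ std′) i))))
    where
    col-count : (T : Filling n sh) → (∀ i j → row T i ≡ row T j → col T i < col T j → toℕ i < toℕ j) → ∀ i →
      col T i ≡ N.∑ (allFin n) (λ j → N.⟦ (tabloid T j ==F tabloid T i) ∧ (toℕ j ℕ.<ᵇ toℕ i) ⟧)
    col-count T inc i = trans (sym (rank≡col i)) (N.∑-cong (allFin n) (λ j → cong N.⟦_⟧ (bool-ext
      (λ e → let (a , b) = ∧-true (tabloid T j ==F tabloid T i) e in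
        ∧-intro a (<⇒<ᵇ (inc j i (cong toℕ (==F⇒ a)) (<ᵇ⇒< _ _ b))))
      (λ e → let (a , b) = ∧-true (tabloid T j ==F tabloid T i) e in
        ∧-intro a (<⇒<ᵇ (reflect j (==F⇒ a) (<ᵇ⇒< (toℕ j) (toℕ i) b)))))))
      where
      open NoCollision T T (λ i j p q → rowcol-injective T p q)
      reflect : ∀ j → tabloid T j ≡ tabloid T i → toℕ j < toℕ i → col T j < col T i
      reflect j e j<i with ℕP.<-cmp (col T j) (col T i)
      ... | tri< lt _ _ = lt
      ... | tri≈ _ eq _ = ⊥-elim (ℕP.<⇒≢ j<i (cong toℕ (rowcol-injective T e eq)))
      ... | tri> _ _ gt = ⊥-elim (ℕP.<-asym j<i (inc i j (cong toℕ (sym e)) gt))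

-- Polytabloids

*-cancelʳ-≢0 : {p r q : ℚ} → ¬ (q ≡ 0ℚ) → p ℚ.* q ≡ r ℚ.* q → p ≡ r
*-cancelʳ-≢0 {p} {r} {q} q≢0 e = trans (expand p) (trans (cong (ℚ._* (ℚ.1/ q)) e) (sym (expand r)))
  where
  instance _ = ℚ.≢-nonZero q≢0
  expand : ∀ x → x ≡ x ℚ.* q ℚ.* (ℚ.1/ q)
  expand x = sym (trans (ℚP.*-assoc x q (ℚ.1/ q)) (trans (cong (x ℚ.*_) (ℚP.*-inverseʳ q)) (ℚP.*-identityʳ x)))

≡-negate⇒0 : (q : ℚ) → q ≡ (ℚ.- 1ℚ) ℚ.* q → q ≡ 0ℚ
≡-negate⇒0 q e with q ℚP.≟ 0ℚ
... | yes p = p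
... | no q≢0 = ⊥-elim (absurd (*-cancelʳ-≢0 {1ℚ} {ℚ.- 1ℚ} q≢0 (trans (ℚP.*-identityˡ q) e)))
  where
  absurd : ¬ (1ℚ ≡ ℚ.- 1ℚ)
  absurd ()

*-nonzeroʳ : (p : ℚ) {q : ℚ} → ¬ (p ℚ.* q ≡ 0ℚ) → ¬ (q ≡ 0ℚ)
*-nonzeroʳ p pq≢0 refl = pq≢0 (ℚP.*-zeroʳ p)

*-nonzero : {p q : ℚ} → ¬ (p ≡ 0ℚ) → ¬ (q ≡ 0ℚ) → ¬ (p ℚ.* q ≡ 0ℚ)
*-nonzero {p} {q} p≢0 q≢0 e = p≢0 (*-cancelʳ-≢0 q≢0 (trans e (sym (ℚP.*-zeroˡ q))))

∑-nonzero : {A : Set} (xs : List A) (f : A → ℚ) → ¬ (Q.∑ xs f ≡ 0ℚ) → ∃[ x ] x ∈ xs × ¬ (f x ≡ 0ℚ)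
∑-nonzero [] f h = ⊥-elim (h refl)
∑-nonzero (x ∷ xs) f h with f x ℚP.≟ 0ℚ
... | no fx≢0 = x , here refl , fx≢0
... | yes fx≡0 with ∑-nonzero xs f (λ e → h (cong₂ ℚ._+_ fx≡0 e))
...   | y , y∈ , fy≢0 = y , there y∈ , fy≢0

⟦⟧*-nonzero : (b : Bool) {q : ℚ} → ¬ (Q.⟦ b ⟧ ℚ.* q ≡ 0ℚ) → b ≡ true
⟦⟧*-nonzero true _ = refl
⟦⟧*-nonzero false {q} h = ⊥-elim (h (ℚP.*-zeroˡ q))

0≤square : (q : ℚ) → 0ℚ ℚ.≤ q ℚ.* q
0≤square q with ℚP.≤-total 0ℚ q
... | inj₁ 0≤q = subst (ℚ._≤ q ℚ.* q) (ℚP.*-zeroˡ q) (ℚP.*-monoʳ-≤-nonNeg q 0≤q)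
  where instance _ = ℚ.nonNegative 0≤q
... | inj₂ q≤0 = subst (ℚ._≤ q ℚ.* q) (ℚP.*-zeroˡ q) (ℚP.*-monoʳ-≤-nonPos q q≤0)
  where instance _ = ℚ.nonPositive q≤0

∑ℚ-mono : {A : Set} (xs : List A) {f g : A → ℚ} → (∀ x → f x ℚ.≤ g x) → Q.∑ xs f ℚ.≤ Q.∑ xs g
∑ℚ-mono [] h = ℚP.≤-refl
∑ℚ-mono (x ∷ xs) h = ℚP.+-mono-≤ (h x) (∑ℚ-mono xs h)

-- Positive definiteness over ℚ: all terms are nonnegative, so each square is bounded by the whole
-- sum.
∑-squares⇒0 : {A : Set} (E : Enum A) (f : A → ℚ) → (∀ x y → Enum.eq E x y ≡ true → f x ≡ f y) →
  Q.∑ (Enum.list E) (λ x → f x ℚ.* f x) ≡ 0ℚ → ∀ y → f y ≡ 0ℚ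
∑-squares⇒0 E f resp e y with f y ℚP.≟ 0ℚ
... | yes p = p
... | no fy≢0 = ⊥-elim (*-nonzero fy≢0 fy≢0 (ℚP.≤-antisym le (0≤square (f y))))
  where
  open ℚP.≤-Reasoning
  drop : (b : Bool) (q : ℚ) → Q.⟦ b ⟧ ℚ.* (q ℚ.* q) ℚ.≤ q ℚ.* q
  drop true q = ℚP.≤-reflexive (ℚP.*-identityˡ _)
  drop false q = subst (ℚ._≤ q ℚ.* q) (sym (ℚP.*-zeroˡ (q ℚ.* q))) (0≤square q)
  le : f y ℚ.* f y ℚ.≤ 0ℚ
  le = begin
    f y ℚ.* f y
      ≡⟨ Q.∑-δ E y (λ x → f x ℚ.* f x) (λ x h → cong₂ ℚ._*_ (resp x y h) (resp x y h)) ⟨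
    Q.∑ (Enum.list E) (λ x → Q.⟦ Enum.eq E x y ⟧ ℚ.* (f x ℚ.* f x))
      ≤⟨ ∑ℚ-mono (Enum.list E) (λ x → drop (Enum.eq E x y) (f x)) ⟩
    Q.∑ (Enum.list E) (λ x → f x ℚ.* f x) ≡⟨ e ⟩
    0ℚ ∎

-- Lexicographic order on functions between finite sets, the value at 0 being the most significant.

weight : {n m : ℕ} → (Fin n → Fin m) → ℕ
weight f = toℕ (F.funToFin f)

weight-cong : {n m : ℕ} {f g : Fin n → Fin m} → f ≗ g → weight f ≡ weight g
weight-cong {zero} h = refl
weight-cong {suc n} {m} {f} {g} h = cong toℕ (cong₂ F.combine (h F.zero)
  (FP.toℕ-injective (weight-cong {n} {m} {f ∘ F.suc} {g ∘ F.suc} (h ∘ F.suc))))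

weight-< : {n m : ℕ} (f g : Fin n → Fin m) (k : Fin n) → (∀ j → toℕ j < toℕ k → f j ≡ g j) →
  toℕ (f k) < toℕ (g k) → weight f < weight g
weight-< {suc n} f g F.zero h lt = FP.combine-monoˡ-< (F.funToFin (f ∘ F.suc)) (F.funToFin (g ∘ F.suc)) lt
weight-< {suc n} {m} f g (F.suc k) h lt = subst₂ _<_
  (sym (trans (FP.toℕ-combine (f F.zero) (F.funToFin (f ∘ F.suc))) (cong (λ z → m ℕ.^ n ℕ.* toℕ z ℕ.+ weight (f ∘ F.suc)) (h F.zero (ℕ.s≤s ℕ.z≤n)))))
  (sym (FP.toℕ-combine (g F.zero) (F.funToFin (g ∘ F.suc))))
  (ℕP.+-monoʳ-< (m ℕ.^ n ℕ.* toℕ (g F.zero)) (weight-< (f ∘ F.suc) (g ∘ F.suc) k (λ j j<k → h (F.suc j) (ℕ.s≤s j<k)) lt))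

firstDifference : {n m : ℕ} (f g : Fin n → Fin m) →
  (f ≗ g) ⊎ (∃[ k ] (∀ j → toℕ j < toℕ k → f j ≡ g j) × ¬ (f k ≡ g k))
firstDifference {zero} f g = inj₁ λ ()
firstDifference {suc n} f g with f F.zero FP.≟ g F.zero
... | no ne = inj₂ (F.zero , (λ _ ()) , ne)
... | yes e with firstDifference (f ∘ F.suc) (g ∘ F.suc)
...   | inj₁ h = inj₁ λ { F.zero → e ; (F.suc i) → h i }
...   | inj₂ (k , h , ne) = inj₂ (F.suc k , (λ { F.zero _ → e ; (F.suc j) (ℕ.s≤s lt) → h j lt }) , ne)

transpose-fixes : {n : ℕ} {X : Set} (f : Fin n → X) (a b : Fin n) → f a ≡ f b → f ∘ (transpose a b ⟨$⟩ʳ_) ≗ f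
transpose-fixes f a b e i = go (i FP.≟ a) (i FP.≟ b)
  where
  go : Dec (i ≡ a) → Dec (i ≡ b) → f (transpose a b ⟨$⟩ʳ i) ≡ f i
  go (yes refl) _ = trans (cong f (transpose-left a b)) (sym e)
  go (no _) (yes refl) = trans (cong f (transpose-right a b)) e
  go (no i≢a) (no i≢b) = cong f (transpose-other a b i≢a i≢b)

module _ {n : ℕ} {sh : List ℕ} where

  Tab : Set
  Tab = TabFun n (length sh)

  -- The indicator of the column stabilizer among all functions; it merges the two filters in
  -- `colStab`.
  CS : Filling n sh → (Fin n → Fin n) → Bool
  CS T σ = injB σ ∧ all (λ i → colOf (pos T (σ i)) ≡ᵇ colOf (pos T i)) (allFin n)

  CS⇒ : (T : Filling n sh) (σ : Fin n → Fin n) → CS T σ ≡ true → injB σ ≡ true × (∀ i → col T (σ i) ≡ col T i)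
  CS⇒ T σ e = proj₁ (∧-true (injB σ) e) ,
    λ i → ≡ᵇ⇒ _ _ (allFin⇒ (λ i → col T (σ i) ≡ᵇ col T i) (proj₂ (∧-true (injB σ) e)) i)

  ⇒CS : (T : Filling n sh) {σ : Fin n → Fin n} → injB σ ≡ true → (∀ i → col T (σ i) ≡ col T i) → CS T σ ≡ true
  ⇒CS T {σ} e h = ∧-intro e (⇒allFin (λ i → col T (σ i) ≡ᵇ col T i) (⇒≡ᵇ ∘ h))

  CS-cong : (T : Filling n sh) {σ τ : Fin n → Fin n} → σ ≗ τ → CS T σ ≡ CS T τ
  CS-cong T h = cong₂ _∧_ (injB-cong h) (all-cong (allFin n) (λ i → cong (λ x → col T x ≡ᵇ col T i) (h i)))

  PreservesCol : Filling n sh → Permutation′ n → Set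
  PreservesCol T π = ∀ i → col T (π ⟨$⟩ʳ i) ≡ col T i

  PreservesCol-flip : (T : Filling n sh) (π : Permutation′ n) → PreservesCol T π → PreservesCol T (flip π)
  PreservesCol-flip T π h i = trans (sym (h (π ⟨$⟩ˡ i))) (cong (col T) (inverseʳ π))

  CS-post : (T : Filling n sh) (π : Permutation′ n) → PreservesCol T π → ∀ σ → CS T ((π ⟨$⟩ʳ_) ∘ σ) ≡ CS T σ
  CS-post T π h σ = cong₂ _∧_ (injB-post π σ) (all-cong (allFin n) (λ i → cong (_≡ᵇ col T i) (h (σ i))))

  CS-pre : (T : Filling n sh) (π : Permutation′ n) → PreservesCol T π → ∀ σ → CS T (σ ∘ (π ⟨$⟩ʳ_)) ≡ CS T σ
  CS-pre T π h σ = bool-ext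
    (λ e → let (a , b) = CS⇒ T (σ ∘ (π ⟨$⟩ʳ_)) e in ⇒CS T (trans (sym (injB-pre π σ)) a)
       (λ i → trans (cong (col T ∘ σ) (sym (inverseʳ π))) (trans (b (π ⟨$⟩ˡ i)) (PreservesCol-flip T π h i))))
    (λ e → let (a , b) = CS⇒ T σ e in ⇒CS T (trans (injB-pre π σ) a) (λ i → trans (b (π ⟨$⟩ʳ i)) (h i)))

  -- The coefficient of r in κ_T{r′}, where κ_T is the signed sum over the column stabilizer of T.
  rawA : Filling n sh → Tab → Tab → ℚ
  rawA T r′ r = Q.∑ (allFuns n n) (λ σ → Q.⟦ CS T σ ∧ eqTab r′ (r ∘ σ) ⟧ ℚ.* sgn σ)

  rawA-congˡ : (T : Filling n sh) {r′ s′ : Tab} (r : Tab) → r′ ≗ s′ → rawA T r′ r ≡ rawA T s′ r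
  rawA-congˡ T r h = Q.∑-cong (allFuns n n) (λ σ → cong (λ b → Q.⟦ CS T σ ∧ b ⟧ ℚ.* sgn σ) (eqTab-cong h (λ _ → refl)))

  rawA-congʳ : (T : Filling n sh) (r′ : Tab) {r s : Tab} → r ≗ s → rawA T r′ r ≡ rawA T r′ s
  rawA-congʳ T r′ h = Q.∑-cong (allFuns n n) (λ σ → cong (λ b → Q.⟦ CS T σ ∧ b ⟧ ℚ.* sgn σ) (eqTab-congʳ r′ (λ i → h (σ i))))

  rawA-term-cong : (T : Filling n sh) (r′ r : Tab) (c : ℚ) → ∀ σ τ → eqTab σ τ ≡ true →
    Q.⟦ CS T σ ∧ eqTab r′ (r ∘ σ) ⟧ ℚ.* (c ℚ.* sgn σ) ≡ Q.⟦ CS T τ ∧ eqTab r′ (r ∘ τ) ⟧ ℚ.* (c ℚ.* sgn τ)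
  rawA-term-cong T r′ r c σ τ e = cong₂ (λ b s → Q.⟦ b ⟧ ℚ.* (c ℚ.* s))
    (cong₂ _∧_ (CS-cong T h) (eqTab-congʳ r′ (λ i → cong r (h i)))) (sgn-cong h)
    where h = eqTab⇒ σ τ e

  rawA-scaled : (T : Filling n sh) (c : ℚ) (r′ r : Tab) →
    Q.∑ (allFuns n n) (λ σ → Q.⟦ CS T σ ∧ eqTab r′ (r ∘ σ) ⟧ ℚ.* (c ℚ.* sgn σ)) ≡ c ℚ.* rawA T r′ r
  rawA-scaled T c r′ r = trans (Q.∑-cong (allFuns n n) (λ σ → Q.*-left-comm Q.⟦ CS T σ ∧ eqTab r′ (r ∘ σ) ⟧ c (sgn σ))) (sym (Q.∑-* c (allFuns n n) _))

  -- The identity π κ_T = sgn(π) κ_T on coefficients: σ ↦ πσ permutes the column stabilizer.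
  rawA-post : (T : Filling n sh) (π : Permutation′ n) → PreservesCol T π → (r′ r : Tab) →
    rawA T r′ (r ∘ (π ⟨$⟩ʳ_)) ≡ sgn (π ⟨$⟩ʳ_) ℚ.* rawA T r′ r
  rawA-post T π h r′ r = begin
    rawA T r′ (r ∘ p) ≡⟨ Q.∑-cong (allFuns n n) step ⟩
    Q.∑ (allFuns n n) (λ σ → G (p ∘ σ))
      ≡⟨ Q.∑-reindex (FunE n n) (FunE n n) (p ∘_) ((π ⟨$⟩ˡ_) ∘_) (adjoint-post π) G (rawA-term-cong T r′ r (sgn p)) ⟩
    Q.∑ (allFuns n n) G ≡⟨ rawA-scaled T (sgn p) r′ r ⟩
    sgn p ℚ.* rawA T r′ r ∎
    where
    open ≡-Reasoning
    p = π ⟨$⟩ʳ_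
    G : (Fin n → Fin n) → ℚ
    G σ = Q.⟦ CS T σ ∧ eqTab r′ (r ∘ σ) ⟧ ℚ.* (sgn p ℚ.* sgn σ)
    step : ∀ σ → Q.⟦ CS T σ ∧ eqTab r′ (r ∘ p ∘ σ) ⟧ ℚ.* sgn σ ≡ G (p ∘ σ)
    -- Multiplicativity of the sign needs σ to be injective. The sum runs over all functions, and
    -- the indicator supplies injectivity for the terms that count.
    step σ = trans (Q.⟦⟧-cong (CS T σ ∧ eqTab r′ (r ∘ p ∘ σ)) (λ e → sign (proj₁ (CS⇒ T σ (proj₁ (∧-true (CS T σ) e))))))
                   (cong (λ b → Q.⟦ b ∧ eqTab r′ (r ∘ p ∘ σ) ⟧ ℚ.* (sgn p ℚ.* sgn (p ∘ σ))) (sym (CS-post T π h σ)))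
      where
      sign : injB σ ≡ true → sgn σ ≡ sgn p ℚ.* sgn (p ∘ σ)
      sign inj = begin
        sgn σ ≡⟨ ℚP.*-identityˡ _ ⟨
        1ℚ ℚ.* sgn σ ≡⟨ cong (ℚ._* sgn σ) (sgn-square p) ⟨
        sgn p ℚ.* sgn p ℚ.* sgn σ ≡⟨ ℚP.*-assoc (sgn p) (sgn p) (sgn σ) ⟩
        sgn p ℚ.* (sgn p ℚ.* sgn σ) ≡⟨ cong (sgn p ℚ.*_) (sgn-∘ p (ʳ-injB π) (fromInjB σ inj)) ⟨
        sgn p ℚ.* sgn (p ∘ σ) ∎

  -- The identity κ_T π⁻¹ = sgn(π) κ_T on coefficients: σ ↦ σπ⁻¹ permutes the column stabilizer.
  rawA-pre : (T : Filling n sh) (π : Permutation′ n) → PreservesCol T π → (r′ r : Tab) →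
    rawA T (r′ ∘ (π ⟨$⟩ʳ_)) r ≡ sgn (π ⟨$⟩ʳ_) ℚ.* rawA T r′ r
  rawA-pre T π h r′ r = begin
    rawA T (r′ ∘ p) r ≡⟨ Q.∑-cong (allFuns n n) step ⟩
    Q.∑ (allFuns n n) (λ σ → G (σ ∘ q))
      ≡⟨ Q.∑-reindex (FunE n n) (FunE n n) (_∘ q) (_∘ p) (adjoint-pre (flip π)) G (rawA-term-cong T r′ r (sgn p)) ⟩
    Q.∑ (allFuns n n) G ≡⟨ rawA-scaled T (sgn p) r′ r ⟩
    sgn p ℚ.* rawA T r′ r ∎
    where
    open ≡-Reasoning
    p = π ⟨$⟩ʳ_
    q = π ⟨$⟩ˡ_
    G : (Fin n → Fin n) → ℚ
    G σ = Q.⟦ CS T σ ∧ eqTab r′ (r ∘ σ) ⟧ ℚ.* (sgn p ℚ.* sgn σ)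
    step : ∀ σ → Q.⟦ CS T σ ∧ eqTab (r′ ∘ p) (r ∘ σ) ⟧ ℚ.* sgn σ ≡ G (σ ∘ q)
    step σ = trans (Q.⟦⟧-cong (CS T σ ∧ eqTab (r′ ∘ p) (r ∘ σ)) (λ e → sign (proj₁ (CS⇒ T σ (proj₁ (∧-true (CS T σ) e))))))
                   (cong (λ b → Q.⟦ b ⟧ ℚ.* (sgn p ℚ.* sgn (σ ∘ q)))
                     (cong₂ _∧_ (sym (CS-pre T (flip π) (PreservesCol-flip T π h) σ))
                                (trans (eqTab-sym (r′ ∘ p) (r ∘ σ)) (adjoint-pre π r′ (r ∘ σ)))))
      where
      sign : injB σ ≡ true → sgn σ ≡ sgn p ℚ.* sgn (σ ∘ q)
      sign inj = begin
        sgn σ ≡⟨ ℚP.*-identityˡ _ ⟨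
        1ℚ ℚ.* sgn σ ≡⟨ cong (ℚ._* sgn σ) (sgn-square p) ⟨
        sgn p ℚ.* sgn p ℚ.* sgn σ ≡⟨ ℚP.*-assoc (sgn p) (sgn p) (sgn σ) ⟩
        sgn p ℚ.* (sgn p ℚ.* sgn σ) ≡⟨ cong (sgn p ℚ.*_) (ℚP.*-comm (sgn p) (sgn σ)) ⟩
        sgn p ℚ.* (sgn σ ℚ.* sgn p) ≡⟨ cong (λ z → sgn p ℚ.* (sgn σ ℚ.* z)) (sgn-inverse π) ⟨
        sgn p ℚ.* (sgn σ ℚ.* sgn q) ≡⟨ cong (sgn p ℚ.*_) (sgn-∘ σ inj (flip π)) ⟨
        sgn p ℚ.* sgn (σ ∘ q) ∎

  -- The column stabilizer of π⁻¹T is the conjugate by π of that of `T`, and σ ↦ π⁻¹σπ preserves the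
  -- sign.
  rawA-conjugate : (T : Filling n sh) (π : Permutation′ n) (r′ r : Tab) →
    rawA (T ∘T π) (r′ ∘ (π ⟨$⟩ʳ_)) (r ∘ (π ⟨$⟩ʳ_)) ≡ rawA T r′ r
  rawA-conjugate T π r′ r = sym (trans (Q.∑-cong (allFuns n n) step)
    (Q.∑-reindex (FunE n n) (FunE n n) (λ σ → q ∘ σ ∘ p) (λ σ → p ∘ σ ∘ q) adj G G-cong))
    where
    p = π ⟨$⟩ʳ_
    q = π ⟨$⟩ˡ_
    G : (Fin n → Fin n) → ℚ
    G σ = Q.⟦ CS (T ∘T π) σ ∧ eqTab (r′ ∘ p) (r ∘ p ∘ σ) ⟧ ℚ.* sgn σ
    G-cong : ∀ σ τ → eqTab σ τ ≡ true → G σ ≡ G τ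
    G-cong σ τ e = cong₂ (λ b s → Q.⟦ b ⟧ ℚ.* s)
      (cong₂ _∧_ (CS-cong (T ∘T π) h) (eqTab-congʳ (r′ ∘ p) (λ i → cong (r ∘ p) (h i)))) (sgn-cong h)
      where h = eqTab⇒ σ τ e
    adj : ∀ x y → eqTab y (q ∘ x ∘ p) ≡ eqTab x (p ∘ y ∘ q)
    adj x y = trans (adjoint-post (flip π) (x ∘ p) y) (trans (eqTab-sym (x ∘ p) (p ∘ y)) (adjoint-pre π x (p ∘ y)))
    step : ∀ σ → Q.⟦ CS T σ ∧ eqTab r′ (r ∘ σ) ⟧ ℚ.* sgn σ ≡ G (q ∘ σ ∘ p)
    step σ = trans (Q.⟦⟧-cong (CS T σ ∧ eqTab r′ (r ∘ σ)) (λ e → sign (proj₁ (CS⇒ T σ (proj₁ (∧-true (CS T σ) e))))))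
      (cong (λ b → Q.⟦ b ⟧ ℚ.* sgn (q ∘ σ ∘ p)) (cong₂ _∧_ bits tabs))
      where
      open ≡-Reasoning
      sign : injB σ ≡ true → sgn σ ≡ sgn (q ∘ σ ∘ p)
      sign inj = sym (begin
        sgn (q ∘ σ ∘ p) ≡⟨ sgn-∘ (q ∘ σ) (trans (injB-post (flip π) σ) inj) π ⟩
        sgn (q ∘ σ) ℚ.* sgn p ≡⟨ cong (ℚ._* sgn p) (sgn-∘ q (ʳ-injB (flip π)) (fromInjB σ inj)) ⟩
        sgn q ℚ.* sgn σ ℚ.* sgn p ≡⟨ cong (λ z → z ℚ.* sgn σ ℚ.* sgn p) (sgn-inverse π) ⟩
        sgn p ℚ.* sgn σ ℚ.* sgn p ≡⟨ cong (ℚ._* sgn p) (ℚP.*-comm (sgn p) (sgn σ)) ⟩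
        sgn σ ℚ.* sgn p ℚ.* sgn p ≡⟨ ℚP.*-assoc (sgn σ) _ _ ⟩
        sgn σ ℚ.* (sgn p ℚ.* sgn p) ≡⟨ cong (sgn σ ℚ.*_) (sgn-square p) ⟩
        sgn σ ℚ.* 1ℚ ≡⟨ ℚP.*-identityʳ _ ⟩
        sgn σ ∎)
      injs : injB (q ∘ σ ∘ p) ≡ injB σ
      injs = trans (injB-pre π (q ∘ σ)) (injB-post (flip π) σ)
      bits : CS T σ ≡ CS (T ∘T π) (q ∘ σ ∘ p)
      bits = bool-ext
        (λ e → let (a , b) = CS⇒ T σ e in ⇒CS (T ∘T π) (trans injs a)
          (λ i → trans (cong (col T) (inverseʳ π)) (b (p i))))
        (λ e → let (a , b) = CS⇒ (T ∘T π) (q ∘ σ ∘ p) e in ⇒CS T (trans (sym injs) a)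
          (λ i → trans (cong (col T) (trans (cong σ (sym (inverseʳ π))) (sym (inverseʳ π)))) (trans (b (q i)) (cong (col T) (inverseʳ π)))))
      tabs : eqTab r′ (r ∘ σ) ≡ eqTab (r′ ∘ p) (r ∘ p ∘ q ∘ σ ∘ p)
      tabs = bool-ext
        (λ e → ⇒eqTab (λ i → trans (eqTab⇒ r′ (r ∘ σ) e (p i)) (cong r (sym (inverseʳ π)))))
        (λ e → ⇒eqTab (λ i → trans (cong r′ (sym (inverseʳ π))) (trans (eqTab⇒ (r′ ∘ p) (r ∘ p ∘ q ∘ σ ∘ p) e (q i))
           (cong r (trans (inverseʳ π) (cong σ (inverseʳ π)))))))

  transpose-preservesCol : (T : Filling n sh) (a b : Fin n) → col T a ≡ col T b → PreservesCol T (transpose a b)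
  transpose-preservesCol T = transpose-fixes (col T)

  -- A column permutation that fixes {T} keeps every number in its row and column, so it is the
  -- identity.
  rawA-tabloid : (T : Filling n sh) → rawA T (tabloid T) (tabloid T) ≡ 1ℚ
  rawA-tabloid T = begin
    rawA T t t ≡⟨ Q.∑-cong (allFuns n n) (λ σ → cong (λ b → Q.⟦ b ⟧ ℚ.* sgn σ) (bits σ)) ⟩
    Q.∑ (allFuns n n) (λ σ → Q.⟦ eqTab σ id ⟧ ℚ.* sgn σ) ≡⟨ Q.∑-δ (FunE n n) id sgn (λ σ e → sgn-cong (eqTab⇒ σ id e)) ⟩
    sgn {n} id ≡⟨ sgn-id n ⟩
    1ℚ ∎
    where
    open ≡-Reasoning
    t = tabloid T
    bits : ∀ σ → CS T σ ∧ eqTab t (t ∘ σ) ≡ eqTab σ id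
    bits σ = bool-ext
      (λ e → let (a , b) = ∧-true (CS T σ) e in ⇒eqTab (λ i → rowcol-injective T (sym (eqTab⇒ t (t ∘ σ) b i)) (proj₂ (CS⇒ T σ a) i)))
      (λ e → let h = eqTab⇒ σ id e in ∧-intro
        (trans (CS-cong T {σ} {id} h) (⇒CS T (⇒injB {n} {id} id) (λ _ → refl)))
        (⇒eqTab (λ i → cong t (sym (h i)))))

  -- This is κ_T{S} = ⟨{S} , e_T⟩ e_T. If two numbers share a row of `S` and a column of `T`, their
  -- transposition fixes {S} and reverses the sign, so both sides vanish. Otherwise {S} = π⁻¹{T}
  -- with π a column permutation, and sgn(π) is both the factor by which κ_T{S} differs from e_T and
  -- the coefficient of {S} in e_T.
  rawA-factor : (S T : Filling n sh) (r : Tab) →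
    rawA T (tabloid S) r ≡ rawA T (tabloid T) (tabloid S) ℚ.* rawA T (tabloid T) r
  rawA-factor S T r with collision S T
  ... | inj₁ (a , b , a≢b , same-row , same-col) = begin
    rawA T s r ≡⟨ vanish r ⟩
    0ℚ ≡⟨ ℚP.*-zeroˡ (rawA T t r) ⟨
    0ℚ ℚ.* rawA T t r ≡⟨ cong (ℚ._* rawA T t r) vanish′ ⟨
    rawA T t s ℚ.* rawA T t r ∎
    where
    open ≡-Reasoning
    s = tabloid S
    t = tabloid T
    τ = transpose a b
    fix : s ∘ (τ ⟨$⟩ʳ_) ≗ s
    fix = transpose-fixes s a b same-row
    pres = transpose-preservesCol T a b same-col
    vanish : ∀ r → rawA T s r ≡ 0ℚ
    vanish r = ≡-negate⇒0 _ (trans (sym (rawA-congˡ T r fix)) (trans (rawA-pre T τ pres s r) (cong (ℚ._* rawA T s r) (sgn-transpose a b a≢b))))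
    vanish′ : rawA T t s ≡ 0ℚ
    vanish′ = ≡-negate⇒0 _ (trans (sym (rawA-congʳ T t fix)) (trans (rawA-post T τ pres t s) (cong (ℚ._* rawA T t s) (sgn-transpose a b a≢b))))
  ... | inj₂ (π , pres , s≗) = begin
    rawA T s r ≡⟨ rawA-congˡ T r s≗ ⟩
    rawA T (t ∘ (π ⟨$⟩ʳ_)) r ≡⟨ rawA-pre T π pres t r ⟩
    sgn (π ⟨$⟩ʳ_) ℚ.* rawA T t r ≡⟨ cong (ℚ._* rawA T t r) sign ⟨
    rawA T t s ℚ.* rawA T t r ∎
    where
    open ≡-Reasoning
    s = tabloid S
    t = tabloid T
    sign : rawA T t s ≡ sgn (π ⟨$⟩ʳ_)
    sign = begin
      rawA T t s ≡⟨ rawA-congʳ T t s≗ ⟩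
      rawA T t (t ∘ (π ⟨$⟩ʳ_)) ≡⟨ rawA-post T π pres t t ⟩
      sgn (π ⟨$⟩ʳ_) ℚ.* rawA T t t ≡⟨ cong (sgn (π ⟨$⟩ʳ_) ℚ.*_) (rawA-tabloid T) ⟩
      sgn (π ⟨$⟩ʳ_) ℚ.* 1ℚ ≡⟨ ℚP.*-identityʳ _ ⟩
      sgn (π ⟨$⟩ʳ_) ∎

  -- A nonzero coefficient exhibits some σ in the column stabilizer, and σT is the required filling.
  rawA-support : (T : Filling n sh) (r : Tab) → ¬ (rawA T (tabloid T) r ≡ 0ℚ) →
    Σ (Filling n sh) λ S → tabloid S ≗ r × (∀ i → col S i ≡ col T i)
  rawA-support T r ne with ∑-nonzero (allFuns n n) _ ne
  ... | σ , _ , term with ∧-true (CS T σ) (⟦⟧*-nonzero (CS T σ ∧ eqTab (tabloid T) (r ∘ σ)) term)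
  ...   | cs , eq with CS⇒ T σ cs
  ...     | inj , pres = T ∘T flip π ,
            (λ i → trans (eqTab⇒ (tabloid T) (r ∘ σ) eq (π ⟨$⟩ˡ i)) (cong r (inverseʳ π))) ,
            PreservesCol-flip T π pres
    where π = fromInjB σ inj

  ColumnIncreasing : Filling n sh → Set
  ColumnIncreasing T = ∀ i j → col T i ≡ col T j → row T i < row T j → toℕ i < toℕ j

  -- Let `k` be the least number moved by σ and `m` its preimage. Smaller numbers are fixed, so `m`
  -- is not smaller than `k`; as it stands in the same column of `T`, it stands in a lower row. That
  -- row is r(k), while r and {T} agree before `k`.
  lex-minimal : (T : Filling n sh) → ColumnIncreasing T → (r : Tab) (σ : Fin n → Fin n) → CS T σ ≡ true →
    tabloid T ≗ r ∘ σ → (σ ≗ id) ⊎ (weight (tabloid T) < weight r)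
  lex-minimal T inc r σ cs t≗ with firstDifference σ id
  ... | inj₁ h = inj₁ h
  ... | inj₂ (k , fixed , σk≢k) = inj₂ (weight-< t r k (λ j j<k → trans (t≗ j) (cong r (fixed j j<k))) up)
    where
    t = tabloid T
    π = fromInjB σ (proj₁ (CS⇒ T σ cs))
    m = π ⟨$⟩ˡ k
    σm≡k : σ m ≡ k
    σm≡k = inverseʳ π
    m≮k : ¬ (toℕ m < toℕ k)
    m≮k m<k = σk≢k (trans (cong σ (trans (sym σm≡k) (fixed m m<k))) σm≡k)
    m-col : col T m ≡ col T k
    m-col = trans (sym (proj₂ (CS⇒ T σ cs) m)) (cong (col T) σm≡k)
    up : toℕ (t k) < toℕ (r k)
    up with ℕP.<-cmp (toℕ (t k)) (toℕ (t m))
    ... | tri< lt _ _ = subst (toℕ (t k) <_) (cong toℕ (trans (t≗ m) (cong r σm≡k))) lt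
    ... | tri≈ _ eq _ = ⊥-elim (σk≢k (trans (cong σ (sym (rowcol-injective T (sym (FP.toℕ-injective eq)) m-col))) σm≡k))
    ... | tri> _ _ gt = ⊥-elim (m≮k (inc m k m-col gt))

  -- By `lex-minimal`, at a tabloid not above {T} only the identity can contribute.
  rawA-leading : (T : Filling n sh) → ColumnIncreasing T → (r : Tab) → ¬ (weight (tabloid T) < weight r) →
    rawA T (tabloid T) r ≡ Q.⟦ eqTab (tabloid T) r ⟧
  rawA-leading T inc r ≮ = begin
    rawA T (tabloid T) r ≡⟨ Q.∑-cong (allFuns n n) (λ σ → trans (cong (λ b → Q.⟦ b ⟧ ℚ.* sgn σ) (bits σ)) (Q.⟦∧⟧* (eqTab σ id) (eqTab t r) (sgn σ))) ⟩
    Q.∑ (allFuns n n) (λ σ → Q.⟦ eqTab σ id ⟧ ℚ.* (Q.⟦ eqTab t r ⟧ ℚ.* sgn σ))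
      ≡⟨ Q.∑-δ (FunE n n) id (λ σ → Q.⟦ eqTab t r ⟧ ℚ.* sgn σ) (λ σ e → cong (Q.⟦ eqTab t r ⟧ ℚ.*_) (sgn-cong (eqTab⇒ σ id e))) ⟩
    Q.⟦ eqTab t r ⟧ ℚ.* sgn {n} id ≡⟨ cong (Q.⟦ eqTab t r ⟧ ℚ.*_) (sgn-id n) ⟩
    Q.⟦ eqTab t r ⟧ ℚ.* 1ℚ ≡⟨ ℚP.*-identityʳ _ ⟩
    Q.⟦ eqTab t r ⟧ ∎
    where
    open ≡-Reasoning
    t = tabloid T
    bits : ∀ σ → CS T σ ∧ eqTab t (r ∘ σ) ≡ eqTab σ id ∧ eqTab t r
    bits σ = bool-ext fwd bwd
      where
      fwd : CS T σ ∧ eqTab t (r ∘ σ) ≡ true → eqTab σ id ∧ eqTab t r ≡ true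
      fwd x with ∧-true (CS T σ) x
      ... | cs , eq with lex-minimal T inc r σ cs (eqTab⇒ t (r ∘ σ) eq)
      ...   | inj₁ h = ∧-intro (⇒eqTab h) (⇒eqTab (λ i → trans (eqTab⇒ t (r ∘ σ) eq i) (cong r (h i))))
      ...   | inj₂ lt = ⊥-elim (≮ lt)
      bwd : eqTab σ id ∧ eqTab t r ≡ true → CS T σ ∧ eqTab t (r ∘ σ) ≡ true
      bwd x with ∧-true (eqTab σ id) x
      ... | p , q = let h = eqTab⇒ σ id p in ∧-intro
        (trans (CS-cong T {σ} {id} h) (⇒CS T (⇒injB {n} {id} id) (λ _ → refl)))
        (⇒eqTab (λ i → trans (eqTab⇒ t r q i) (cong r (sym (h i)))))

  -- Opaque because with-abstractions would otherwise normalise the defining sum.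
  opaque

    A : Filling n sh → Tab → Tab → ℚ
    A = rawA

    A-def : (T : Filling n sh) (r′ r : Tab) →
      A T r′ r ≡ Q.∑ (allFuns n n) (λ σ → Q.⟦ CS T σ ∧ eqTab r′ (r ∘ σ) ⟧ ℚ.* sgn σ)
    A-def T r′ r = refl

    A-congˡ : (T : Filling n sh) {r′ s′ : Tab} (r : Tab) → r′ ≗ s′ → A T r′ r ≡ A T s′ r
    A-congˡ = rawA-congˡ

    A-congʳ : (T : Filling n sh) (r′ : Tab) {r s : Tab} → r ≗ s → A T r′ r ≡ A T r′ s
    A-congʳ = rawA-congʳ

    A-post : (T : Filling n sh) (π : Permutation′ n) → PreservesCol T π → (r′ r : Tab) →
      A T r′ (r ∘ (π ⟨$⟩ʳ_)) ≡ sgn (π ⟨$⟩ʳ_) ℚ.* A T r′ r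
    A-post = rawA-post

    A-conjugate : (T : Filling n sh) (π : Permutation′ n) (r′ r : Tab) →
      A (T ∘T π) (r′ ∘ (π ⟨$⟩ʳ_)) (r ∘ (π ⟨$⟩ʳ_)) ≡ A T r′ r
    A-conjugate = rawA-conjugate

    A-factor : (S T : Filling n sh) (r : Tab) →
      A T (tabloid S) r ≡ A T (tabloid T) (tabloid S) ℚ.* A T (tabloid T) r
    A-factor = rawA-factor

  -- The coefficient of r in the polytabloid of T.
  e : Filling n sh → Tab → ℚ
  e T = A T (tabloid T)

  e-cong : (T : Filling n sh) {r s : Tab} → r ≗ s → e T r ≡ e T s
  e-cong T h = A-congʳ T (tabloid T) h

  opaque
    unfolding A

    e-support : (T : Filling n sh) (r : Tab) → ¬ (e T r ≡ 0ℚ) →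
      Σ (Filling n sh) λ S → tabloid S ≗ r × (∀ i → col S i ≡ col T i)
    e-support = rawA-support

    e-leading : (T : Filling n sh) → ColumnIncreasing T → (r : Tab) → ¬ (weight (tabloid T) < weight r) →
      e T r ≡ Q.⟦ eqTab (tabloid T) r ⟧
    e-leading = rawA-leading

-- The Specht module and the Garnir relations

∨-true : (a : Bool) {b : Bool} → a ∨ b ≡ true → a ≡ true ⊎ b ≡ true
∨-true true _ = inj₁ refl
∨-true false e = inj₂ e

∨-introˡ : {a b : Bool} → a ≡ true → a ∨ b ≡ true
∨-introˡ refl = refl

∨-introʳ : (a : Bool) {b : Bool} → b ≡ true → a ∨ b ≡ true
∨-introʳ true _ = refl
∨-introʳ false e = e

not-true⇒ : {b : Bool} → not b ≡ true → ¬ (b ≡ true)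
not-true⇒ {false} _ ()

module _ {n : ℕ} {sh : List ℕ} where

  -- The coefficient function of a vector of the Specht module, given by a combination of
  -- polytabloids.
  vec : List (ℚ × Filling n sh) → Tab {n} {sh} → ℚ
  vec xs r = Q.∑ xs (λ cT → proj₁ cT ℚ.* e (proj₂ cT) r)

  vec-cong : (xs : List (ℚ × Filling n sh)) {r s : Tab {n} {sh}} → r ≗ s → vec xs r ≡ vec xs s
  vec-cong xs h = Q.∑-cong xs (λ cT → cong (proj₁ cT ℚ.*_) (e-cong (proj₂ cT) h))

  -- Functions to the rows with the wrong row sizes are not tabloids of shape λ. This provides the
  -- filling that `A-factor` and the conservation of row totals require.
  vec-support : (xs : List (ℚ × Filling n sh)) (r : Tab {n} {sh}) → ¬ (vec xs r ≡ 0ℚ) → Σ (Filling n sh) λ S → tabloid S ≗ r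
  vec-support xs r ne with ∑-nonzero xs _ ne
  ... | (c , T) , _ , term with e-support T r (*-nonzeroʳ c term)
  ...   | S , h , _ = S , h

  tabs : List (Tab {n} {sh})
  tabs = allFuns n (length sh)

  ⟨_,e_⟩ : List (ℚ × Filling n sh) → Filling n sh → ℚ
  ⟨ xs ,e T ⟩ = Q.∑ tabs (λ r → vec xs r ℚ.* e T r)

  -- The left side is the coefficient of `r` in κ_T v. Expanding v into tabloids and exchanging sums
  -- reduces the claim to `A-factor` at the tabloids where v is nonzero.
  antisymmetrize-vec : (xs : List (ℚ × Filling n sh)) (T : Filling n sh) (r : Tab {n} {sh}) →
    Q.∑ (allFuns n n) (λ σ → Q.⟦ CS T σ ⟧ ℚ.* (sgn σ ℚ.* vec xs (r ∘ σ))) ≡ ⟨ xs ,e T ⟩ ℚ.* e T r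
  antisymmetrize-vec xs T r = begin
    Q.∑ (allFuns n n) (λ σ → Q.⟦ CS T σ ⟧ ℚ.* (sgn σ ℚ.* v (r ∘ σ)))
      ≡⟨ Q.∑-cong (allFuns n n) expand ⟩
    Q.∑ (allFuns n n) (λ σ → Q.∑ tabs (λ r′ → Q.⟦ CS T σ ∧ eqTab r′ (r ∘ σ) ⟧ ℚ.* sgn σ ℚ.* v r′))
      ≡⟨ Q.∑-swap (allFuns n n) tabs _ ⟩
    Q.∑ tabs (λ r′ → Q.∑ (allFuns n n) (λ σ → Q.⟦ CS T σ ∧ eqTab r′ (r ∘ σ) ⟧ ℚ.* sgn σ ℚ.* v r′))
      ≡⟨ Q.∑-cong tabs (λ r′ → trans (sym (Q.∑-*ʳ (allFuns n n) (λ σ → Q.⟦ CS T σ ∧ eqTab r′ (r ∘ σ) ⟧ ℚ.* sgn σ) (v r′)))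
                                         (cong (ℚ._* v r′) (sym (A-def T r′ r)))) ⟩
    Q.∑ tabs (λ r′ → A T r′ r ℚ.* v r′)
      ≡⟨ Q.∑-cong tabs factor ⟩
    Q.∑ tabs (λ r′ → v r′ ℚ.* e T r′ ℚ.* e T r)
      ≡⟨ Q.∑-*ʳ tabs (λ r′ → v r′ ℚ.* e T r′) (e T r) ⟨
    ⟨ xs ,e T ⟩ ℚ.* e T r ∎
    where
    open ≡-Reasoning
    v = vec xs
    expand : ∀ σ → Q.⟦ CS T σ ⟧ ℚ.* (sgn σ ℚ.* v (r ∘ σ)) ≡ Q.∑ tabs (λ r′ → Q.⟦ CS T σ ∧ eqTab r′ (r ∘ σ) ⟧ ℚ.* sgn σ ℚ.* v r′)
    expand σ = begin
      Q.⟦ CS T σ ⟧ ℚ.* (sgn σ ℚ.* v (r ∘ σ))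
        ≡⟨ ℚP.*-assoc Q.⟦ CS T σ ⟧ (sgn σ) _ ⟨
      Q.⟦ CS T σ ⟧ ℚ.* sgn σ ℚ.* v (r ∘ σ)
        ≡⟨ cong (Q.⟦ CS T σ ⟧ ℚ.* sgn σ ℚ.*_) (Q.∑-δ (FunE n (length sh)) (r ∘ σ) v (λ r′ h → vec-cong xs (eqTab⇒ r′ (r ∘ σ) h))) ⟨
      Q.⟦ CS T σ ⟧ ℚ.* sgn σ ℚ.* Q.∑ tabs (λ r′ → Q.⟦ eqTab r′ (r ∘ σ) ⟧ ℚ.* v r′)
        ≡⟨ Q.∑-* (Q.⟦ CS T σ ⟧ ℚ.* sgn σ) tabs _ ⟩
      Q.∑ tabs (λ r′ → Q.⟦ CS T σ ⟧ ℚ.* sgn σ ℚ.* (Q.⟦ eqTab r′ (r ∘ σ) ⟧ ℚ.* v r′))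
        ≡⟨ Q.∑-cong tabs (λ r′ → collect (CS T σ) (eqTab r′ (r ∘ σ)) (sgn σ) (v r′)) ⟩
      Q.∑ tabs (λ r′ → Q.⟦ CS T σ ∧ eqTab r′ (r ∘ σ) ⟧ ℚ.* sgn σ ℚ.* v r′) ∎
      where
      collect : (a b : Bool) (x y : ℚ) → Q.⟦ a ⟧ ℚ.* x ℚ.* (Q.⟦ b ⟧ ℚ.* y) ≡ Q.⟦ a ∧ b ⟧ ℚ.* x ℚ.* y
      collect a b x y = begin
        Q.⟦ a ⟧ ℚ.* x ℚ.* (Q.⟦ b ⟧ ℚ.* y) ≡⟨ Q.*-left-comm (Q.⟦ a ⟧ ℚ.* x) Q.⟦ b ⟧ y ⟩
        Q.⟦ b ⟧ ℚ.* (Q.⟦ a ⟧ ℚ.* x ℚ.* y) ≡⟨ ℚP.*-assoc Q.⟦ b ⟧ (Q.⟦ a ⟧ ℚ.* x) y ⟨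
        Q.⟦ b ⟧ ℚ.* (Q.⟦ a ⟧ ℚ.* x) ℚ.* y ≡⟨ cong (ℚ._* y) (Q.*-left-comm Q.⟦ b ⟧ Q.⟦ a ⟧ x) ⟩
        Q.⟦ a ⟧ ℚ.* (Q.⟦ b ⟧ ℚ.* x) ℚ.* y ≡⟨ cong (ℚ._* y) (Q.⟦∧⟧* a b x) ⟨
        Q.⟦ a ∧ b ⟧ ℚ.* x ℚ.* y ∎
    factor : ∀ r′ → A T r′ r ℚ.* v r′ ≡ v r′ ℚ.* e T r′ ℚ.* e T r
    factor r′ with v r′ ℚP.≟ 0ℚ
    ... | yes z = begin
      A T r′ r ℚ.* v r′ ≡⟨ cong (A T r′ r ℚ.*_) z ⟩
      A T r′ r ℚ.* 0ℚ ≡⟨ ℚP.*-zeroʳ (A T r′ r) ⟩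
      0ℚ ≡⟨ ℚP.*-zeroˡ (e T r) ⟨
      0ℚ ℚ.* e T r ≡⟨ cong (ℚ._* e T r) (ℚP.*-zeroˡ (e T r′)) ⟨
      0ℚ ℚ.* e T r′ ℚ.* e T r ≡⟨ cong (λ z → z ℚ.* e T r′ ℚ.* e T r) z ⟨
      v r′ ℚ.* e T r′ ℚ.* e T r ∎
    ... | no nz with vec-support xs r′ nz
    ...   | S , h = begin
      A T r′ r ℚ.* v r′ ≡⟨ cong (ℚ._* v r′) (A-congˡ T r (λ i → sym (h i))) ⟩
      A T (tabloid S) r ℚ.* v r′ ≡⟨ cong (ℚ._* v r′) (A-factor S T r) ⟩
      e T (tabloid S) ℚ.* e T r ℚ.* v r′ ≡⟨ cong (λ z → z ℚ.* e T r ℚ.* v r′) (e-cong T h) ⟩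
      e T r′ ℚ.* e T r ℚ.* v r′ ≡⟨ ℚP.*-comm _ (v r′) ⟩
      v r′ ℚ.* (e T r′ ℚ.* e T r) ≡⟨ ℚP.*-assoc (v r′) _ _ ⟨
      v r′ ℚ.* e T r′ ℚ.* e T r ∎

  -- ⟨v , v⟩ is a combination of the pairings of v with the polytabloids in its own list. Only these
  -- finitely many pairings enter, so it can be decided whether one of them is nonzero.
  nondegenerate : (xs : List (ℚ × Filling n sh)) → (∀ cT → cT ∈ xs → ⟨ xs ,e proj₂ cT ⟩ ≡ 0ℚ) → ∀ r → vec xs r ≡ 0ℚ
  nondegenerate xs h = ∑-squares⇒0 (FunE n (length sh)) v (λ r s eq → vec-cong xs (eqTab⇒ r s eq)) (begin
    Q.∑ tabs (λ r → v r ℚ.* v r)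
      ≡⟨ Q.∑-cong tabs (λ r → trans (Q.∑-* (v r) xs _) (Q.∑-cong xs (λ cT → Q.*-left-comm (v r) (proj₁ cT) _))) ⟩
    Q.∑ tabs (λ r → Q.∑ xs (λ cT → proj₁ cT ℚ.* (v r ℚ.* e (proj₂ cT) r)))
      ≡⟨ Q.∑-swap tabs xs _ ⟩
    Q.∑ xs (λ cT → Q.∑ tabs (λ r → proj₁ cT ℚ.* (v r ℚ.* e (proj₂ cT) r)))
      ≡⟨ Q.∑-cong∈ xs (λ cT cT∈ → trans (sym (Q.∑-* (proj₁ cT) tabs _)) (trans (cong (proj₁ cT ℚ.*_) (h cT cT∈)) (ℚP.*-zeroʳ (proj₁ cT)))) ⟩
    Q.∑ xs (λ _ → 0ℚ) ≡⟨ Q.∑-0 xs ⟩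
    0ℚ ∎)
    where
    open ≡-Reasoning
    v = vec xs

  -- The Garnir relation: sum over all ways of distributing the numbers in X over the rows p and q.
  module Garnir (p q : Fin (length sh)) (q≤p : lookup sh q ≤ lookup sh p) (X : Fin n → Bool) (r : Tab {n} {sh})
                (big : lookup sh p < N.∑ (allFin n) (λ a → N.⟦ X a ⟧)) where

    choice : Tab {n} {sh} → Fin n → Bool
    choice r′ a = if X a then (r′ a ==F p) ∨ (r′ a ==F q) else (r′ a ==F r a)

    family : Tab {n} {sh} → Bool
    family r′ = all (choice r′) (allFin n)

    InFamily : Tab {n} {sh} → Set
    InFamily r′ = (∀ a → X a ≡ true → r′ a ≡ p ⊎ r′ a ≡ q) × (∀ a → X a ≡ false → r′ a ≡ r a)

    family⇒ : ∀ r′ → family r′ ≡ true → InFamily r′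
    family⇒ r′ h = inside , outside
      where
      inside : ∀ a → X a ≡ true → r′ a ≡ p ⊎ r′ a ≡ q
      inside a x with X a | allFin⇒ (choice r′) h a
      ... | true | c with ∨-true (r′ a ==F p) c
      ...   | inj₁ l = inj₁ (==F⇒ l)
      ...   | inj₂ l = inj₂ (==F⇒ l)
      outside : ∀ a → X a ≡ false → r′ a ≡ r a
      outside a x with X a | allFin⇒ (choice r′) h a
      ... | false | c = ==F⇒ c

    ⇒family : ∀ r′ → InFamily r′ → family r′ ≡ true
    ⇒family r′ (inside , outside) = ⇒allFin (choice r′) go
      where
      go : ∀ a → choice r′ a ≡ true
      go a with X a in x
      ... | false = ⇒==F (outside a x)
      ... | true with inside a x
      ...   | inj₁ l = ∨-introˡ (⇒==F l)
      ...   | inj₂ l = ∨-introʳ (r′ a ==F p) (⇒==F l)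

    family-cong : ∀ {r′ s′} → r′ ≗ s′ → family r′ ≡ family s′
    family-cong {r′} {s′} h = all-cong (allFin n) (λ a → cong (λ z → if X a then (z ==F p) ∨ (z ==F q) else (z ==F r a)) (h a))

    family-transpose : ∀ a b → X a ≡ true → X b ≡ true → ∀ r′ → family (r′ ∘ (transpose a b ⟨$⟩ʳ_)) ≡ family r′
    family-transpose a b Xa Xb r′ = bool-ext fwd bwd
      where
      τ = transpose a b
      fixed : ∀ i → X i ≡ false → τ ⟨$⟩ʳ i ≡ i
      fixed i x = transpose-other a b (λ { refl → clash Xa x }) (λ { refl → clash Xb x })
        where
        clash : {b : Bool} → b ≡ true → b ≡ false → ⊥
        clash refl ()
      fwd : family (r′ ∘ (τ ⟨$⟩ʳ_)) ≡ true → family r′ ≡ true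
      fwd h with family⇒ (r′ ∘ (τ ⟨$⟩ʳ_)) h
      ... | inside , outside = ⇒family r′
        ( (λ i x → subst (λ z → r′ z ≡ p ⊎ r′ z ≡ q) (inverseʳ τ) (inside (τ ⟨$⟩ˡ i) (trans (transpose-fixes X b a (trans Xb (sym Xa)) i) x)))
        , (λ i x → trans (cong r′ (sym (fixed i x))) (outside i x)))
      bwd : family r′ ≡ true → family (r′ ∘ (τ ⟨$⟩ʳ_)) ≡ true
      bwd h with family⇒ r′ h
      ... | inside , outside = ⇒family (r′ ∘ (τ ⟨$⟩ʳ_))
        ( (λ i x → inside (τ ⟨$⟩ʳ i) (trans (transpose-fixes X a b (trans Xa (sym Xb)) i) x))
        , (λ i x → trans (cong r′ (fixed i x)) (outside i x)))

    -- Two members of X in one column of S give a sign-reversing symmetry of the sum; if there are none, the rows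
    -- p and q of any column rearrangement of S are too short to contain X.
    garnir-e : (S : Filling n sh) → Q.∑ tabs (λ r′ → Q.⟦ family r′ ⟧ ℚ.* e S r′) ≡ 0ℚ
    garnir-e S with FP.any? (λ a → FP.any? (λ b → ¬? (a FP.≟ b) ×-dec ((X a BP.≟ true) ×-dec ((X b BP.≟ true) ×-dec (col S a ℕP.≟ col S b)))))
    ... | yes (a , b , a≢b , Xa , Xb , same) = ≡-negate⇒0 _ (begin
      Q.∑ tabs f
        ≡⟨ Q.∑-reindex (FunE n (length sh)) (FunE n (length sh)) (_∘ (τ ⟨$⟩ʳ_)) (_∘ (τ ⟨$⟩ˡ_)) (adjoint-pre τ) f
             (λ x y h → let h′ = eqTab⇒ x y h in cong₂ (λ b z → Q.⟦ b ⟧ ℚ.* z) (family-cong h′) (e-cong S h′)) ⟨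
      Q.∑ tabs (λ r′ → f (r′ ∘ (τ ⟨$⟩ʳ_)))
        ≡⟨ Q.∑-cong tabs (λ r′ → trans (cong₂ (λ b z → Q.⟦ b ⟧ ℚ.* z) (family-transpose a b Xa Xb r′)
             (trans (A-post S τ (transpose-preservesCol S a b same) (tabloid S) r′) (cong (ℚ._* e S r′) (sgn-transpose a b a≢b))))
             (Q.*-left-comm Q.⟦ family r′ ⟧ (ℚ.- 1ℚ) (e S r′))) ⟩
      Q.∑ tabs (λ r′ → (ℚ.- 1ℚ) ℚ.* f r′)
        ≡⟨ Q.∑-* (ℚ.- 1ℚ) tabs f ⟨
      (ℚ.- 1ℚ) ℚ.* Q.∑ tabs f ∎)
      where
      open ≡-Reasoning
      τ = transpose a b
      f : Tab {n} {sh} → ℚ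
      f r′ = Q.⟦ family r′ ⟧ ℚ.* e S r′
    ... | no none = Q.∑-zero tabs zero-term
      where
      inj : ∀ i j → X i ≡ true → X j ≡ true → col S i ≡ col S j → i ≡ j
      inj i j Xi Xj same with i FP.≟ j
      ... | yes eq = eq
      ... | no ne = ⊥-elim (none (i , j , ne , Xi , Xj , same))
      zero-term : ∀ r′ → Q.⟦ family r′ ⟧ ℚ.* e S r′ ≡ 0ℚ
      zero-term r′ with Q.⟦ family r′ ⟧ ℚ.* e S r′ ℚP.≟ 0ℚ
      ... | yes z = z
      ... | no nz with e-support S r′ (*-nonzeroʳ Q.⟦ family r′ ⟧ nz)
      ...   | S′ , tab , cols = ⊥-elim (ℕP.<⇒≱ big (count-≤ X (col S) inj bound))
        where
        fam = family⇒ r′ (⟦⟧*-nonzero (family r′) nz)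
        bound : ∀ a → X a ≡ true → col S a < lookup sh p
        bound a Xa with proj₁ fam a Xa
        ... | inj₁ at-p = subst₂ (λ c k → c < lookup sh k) (cols a) (trans (tab a) at-p) (FP.toℕ<n (Box.c (pos S′ a)))
        ... | inj₂ at-q = ℕP.<-≤-trans (subst₂ (λ c k → c < lookup sh k) (cols a) (trans (tab a) at-q) (FP.toℕ<n (Box.c (pos S′ a)))) q≤p

    garnir : (xs : List (ℚ × Filling n sh)) → Q.∑ tabs (λ r′ → Q.⟦ family r′ ⟧ ℚ.* vec xs r′) ≡ 0ℚ
    garnir xs = begin
      Q.∑ tabs (λ r′ → Q.⟦ family r′ ⟧ ℚ.* vec xs r′)
        ≡⟨ Q.∑-cong tabs (λ r′ → trans (Q.∑-* Q.⟦ family r′ ⟧ xs _) (Q.∑-cong xs (λ cT → Q.*-left-comm Q.⟦ family r′ ⟧ (proj₁ cT) _))) ⟩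
      Q.∑ tabs (λ r′ → Q.∑ xs (λ cT → proj₁ cT ℚ.* (Q.⟦ family r′ ⟧ ℚ.* e (proj₂ cT) r′)))
        ≡⟨ Q.∑-swap tabs xs _ ⟩
      Q.∑ xs (λ cT → Q.∑ tabs (λ r′ → proj₁ cT ℚ.* (Q.⟦ family r′ ⟧ ℚ.* e (proj₂ cT) r′)))
        ≡⟨ Q.∑-zero xs (λ cT → trans (sym (Q.∑-* (proj₁ cT) tabs _)) (trans (cong (proj₁ cT ℚ.*_) (garnir-e (proj₂ cT))) (ℚP.*-zeroʳ (proj₁ cT)))) ⟩
      0ℚ ∎
      where open ≡-Reasoning

-- Straightening and independence

Antitone : List ℕ → Set
Antitone sh = ∀ (p q : Fin (length sh)) → toℕ p < toℕ q → lookup sh q ≤ lookup sh p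

weight-injective : {n m : ℕ} {f g : Fin n → Fin m} → weight f ≡ weight g → f ≗ g
weight-injective {f = f} {g} eq i = trans (sym (FP.finToFun-funToFin f i))
  (trans (cong (λ k → F.finToFun k i) (FP.toℕ-injective eq)) (FP.finToFun-funToFin g i))

+-negate : (q : ℚ) → q ℚ.+ (ℚ.- 1ℚ) ℚ.* q ≡ 0ℚ
+-negate q = trans (cong (ℚ._+ (ℚ.- 1ℚ) ℚ.* q) (sym (ℚP.*-identityˡ q)))
  (trans (sym (ℚP.*-distribʳ-+ q 1ℚ (ℚ.- 1ℚ))) (ℚP.*-zeroˡ q))

cancel-negate : (p q : ℚ) → p ℚ.+ (ℚ.- 1ℚ) ℚ.* q ≡ 0ℚ → p ≡ q
cancel-negate p q eq = begin
  p ≡⟨ ℚP.+-identityʳ p ⟨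
  p ℚ.+ 0ℚ ≡⟨ cong (p ℚ.+_) (trans (ℚP.+-comm ((ℚ.- 1ℚ) ℚ.* q) q) (+-negate q)) ⟨
  p ℚ.+ ((ℚ.- 1ℚ) ℚ.* q ℚ.+ q) ≡⟨ ℚP.+-assoc p _ q ⟨
  p ℚ.+ (ℚ.- 1ℚ) ℚ.* q ℚ.+ q ≡⟨ cong (ℚ._+ q) eq ⟩
  0ℚ ℚ.+ q ≡⟨ ℚP.+-identityˡ q ⟩
  q ∎
  where open ≡-Reasoning

module _ {n : ℕ} {sh : List ℕ} where

  forget : List (ℚ × SYT n sh) → List (ℚ × Filling n sh)
  forget = map (λ cT → proj₁ cT , proj₁ (proj₂ cT))

  e-smaller : (T : SYT n sh) (r : Tab {n} {sh}) → weight r < weight (tabloid (proj₁ T)) → e (proj₁ T) r ≡ 0ℚ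
  e-smaller (T , _ , inc) r lt = trans (e-leading T inc r (ℕP.<-asym lt))
    (cong Q.⟦_⟧ (≡false {eqTab (tabloid T) r} (λ h → ℕP.<⇒≢ lt (sym (weight-cong (eqTab⇒ (tabloid T) r h))))))

  negate : List (ℚ × Filling n sh) → List (ℚ × Filling n sh)
  negate = map (λ cT → (ℚ.- 1ℚ) ℚ.* proj₁ cT , proj₂ cT)

  vec-++ : (xs ys : List (ℚ × Filling n sh)) (r : Tab {n} {sh}) → vec (xs ++ ys) r ≡ vec xs r ℚ.+ vec ys r
  vec-++ xs ys r = Q.∑-++ xs ys _

  vec-negate : (xs : List (ℚ × Filling n sh)) (r : Tab {n} {sh}) → vec (negate xs) r ≡ (ℚ.- 1ℚ) ℚ.* vec xs r
  vec-negate xs r = trans (Q.∑-map _ xs _)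
    (trans (Q.∑-cong xs (λ cT → ℚP.*-assoc (ℚ.- 1ℚ) (proj₁ cT) _)) (sym (Q.∑-* (ℚ.- 1ℚ) xs _)))

  -- Different standard tableaux have different tabloids, so the indicator leaves a single entry of
  -- the list.
  select : (xs : List (ℚ × SYT n sh)) → AllPairs (λ a b → ¬ SameT {n} {sh} (proj₂ a) (proj₂ b)) xs →
    ∀ cT → cT ∈ xs → Q.∑ xs (λ dU → proj₁ dU ℚ.* Q.⟦ eqTab (tabloid (proj₁ (proj₂ dU))) (tabloid (proj₁ (proj₂ cT))) ⟧) ≡ proj₁ cT
  select ((c , T) ∷ xs) (distinct ∷ _) _ (here refl) = begin
    c ℚ.* Q.⟦ eqTab t t ⟧ ℚ.+ Q.∑ xs (λ dU → proj₁ dU ℚ.* Q.⟦ eqTab (tabloid (proj₁ (proj₂ dU))) t ⟧)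
      ≡⟨ cong₂ ℚ._+_ (trans (cong (λ b → c ℚ.* Q.⟦ b ⟧) (⇒eqTab {f = t} (λ _ → refl))) (ℚP.*-identityʳ c))
           (trans (Q.∑-cong∈ xs (λ dU dU∈ → trans (cong (λ b → proj₁ dU ℚ.* Q.⟦ b ⟧)
              (≡false {eqTab (tabloid (proj₁ (proj₂ dU))) t} (λ h → All.lookup distinct dU∈
                (standard-unique T (proj₂ dU) (λ i → sym (eqTab⇒ (tabloid (proj₁ (proj₂ dU))) t h i))))))
              (ℚP.*-zeroʳ (proj₁ dU)))) (Q.∑-0 xs)) ⟩
    c ℚ.+ 0ℚ ≡⟨ ℚP.+-identityʳ c ⟩
    c ∎
    where
    open ≡-Reasoning
    t = tabloid (proj₁ T)
  select ((c , T) ∷ xs) (distinct ∷ pairs) dU (there dU∈) = begin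
    c ℚ.* Q.⟦ eqTab (tabloid (proj₁ T)) u ⟧ ℚ.+ Q.∑ xs _
      ≡⟨ cong₂ ℚ._+_ (trans (cong (λ b → c ℚ.* Q.⟦ b ⟧) (≡false {eqTab (tabloid (proj₁ T)) u} (λ h → All.lookup distinct dU∈
           (standard-unique T (proj₂ dU) (eqTab⇒ (tabloid (proj₁ T)) u h))))) (ℚP.*-zeroʳ c)) (select xs pairs dU dU∈) ⟩
    0ℚ ℚ.+ proj₁ dU ≡⟨ ℚP.+-identityˡ _ ⟩
    proj₁ dU ∎
    where
    open ≡-Reasoning
    u = tabloid (proj₁ (proj₂ dU))

  -- Triangularity. In the evaluation at the tabloid t of a listed tableau, polytabloids with a
  -- least term above t contribute nothing, and those with a least term below t have coefficient 0
  -- by induction on the weight.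
  independent : (xs : List (ℚ × SYT n sh)) → AllPairs (λ a b → ¬ SameT {n} {sh} (proj₂ a) (proj₂ b)) xs →
    (∀ r → vec (forget xs) r ≡ 0ℚ) → ∀ cT → cT ∈ xs → proj₁ cT ≡ 0ℚ
  independent xs distinct zero-vec cT cT∈ = go (suc (weight (tabloid (proj₁ (proj₂ cT))))) cT cT∈ ℕP.≤-refl
    where
    open ≡-Reasoning
    go : ∀ w cT → cT ∈ xs → weight (tabloid (proj₁ (proj₂ cT))) < w → proj₁ cT ≡ 0ℚ
    go (suc w) cT cT∈ (ℕ.s≤s t≤w) = begin
      proj₁ cT ≡⟨ select xs distinct cT cT∈ ⟨
      Q.∑ xs (λ dU → proj₁ dU ℚ.* Q.⟦ eqTab (tabloid (proj₁ (proj₂ dU))) t ⟧)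
        ≡⟨ Q.∑-cong∈ xs term ⟩
      Q.∑ xs (λ dU → proj₁ dU ℚ.* e (proj₁ (proj₂ dU)) t) ≡⟨ Q.∑-map _ xs _ ⟨
      vec (forget xs) t ≡⟨ zero-vec t ⟩
      0ℚ ∎
      where
      t = tabloid (proj₁ (proj₂ cT))
      term : ∀ dU → dU ∈ xs → proj₁ dU ℚ.* Q.⟦ eqTab (tabloid (proj₁ (proj₂ dU))) t ⟧ ≡ proj₁ dU ℚ.* e (proj₁ (proj₂ dU)) t
      term dU dU∈ with weight (tabloid (proj₁ (proj₂ dU))) ℕP.<? weight t
      ... | no ≮ = cong (proj₁ dU ℚ.*_) (sym (e-leading (proj₁ (proj₂ dU)) (proj₂ (proj₂ (proj₂ dU))) t ≮))
      ... | yes u<t with go w dU dU∈ (ℕP.<-≤-trans u<t t≤w)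
      ...   | z = trans (cong (ℚ._* Q.⟦ eqTab (tabloid (proj₁ (proj₂ dU))) t ⟧) z) (trans (ℚP.*-zeroˡ Q.⟦ eqTab (tabloid (proj₁ (proj₂ dU))) t ⟧)
                (sym (trans (cong (ℚ._* e (proj₁ (proj₂ dU)) t) z) (ℚP.*-zeroˡ (e (proj₁ (proj₂ dU)) t)))))

-- Leading tabloids and straightening

module _ {n : ℕ} {sh : List ℕ} (antitone : Antitone sh) where

  -- Here `r` is the least term of v. Each of its rows is sorted by the numbers themselves, so the
  -- rows increase by construction; a column descent is excluded by a Garnir relation.
  module Leading (xs : List (ℚ × Filling n sh)) (r : Tab {n} {sh}) (vr≢0 : ¬ (vec xs r ≡ 0ℚ))
                 (least : ∀ r′ → weight r′ < weight r → vec xs r′ ≡ 0ℚ) where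

    v : Tab {n} {sh} → ℚ
    v = vec xs

    S : Filling n sh
    S = proj₁ (vec-support xs r vr≢0)

    tab-S : tabloid S ≗ r
    tab-S = proj₂ (vec-support xs r vr≢0)

    open Rank S r (λ i → sym (tab-S i)) toℕ (λ i j _ eq → FP.toℕ-injective eq)

    rows-increase : ∀ i j → row rankFilling i ≡ row rankFilling j → col rankFilling i < col rankFilling j → toℕ i < toℕ j
    rows-increase i j same c< with ℕP.<-cmp (toℕ i) (toℕ j)
    ... | tri< lt _ _ = lt
    ... | tri≈ _ eq _ = ⊥-elim (ℕP.<⇒≢ c< (cong (col rankFilling) (FP.toℕ-injective eq)))
    ... | tri> _ _ gt = ⊥-elim (ℕP.<-asym c< (subst₂ _<_ (sym (col-rankFilling j)) (sym (col-rankFilling i))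
            (rank-mono j i (sym (FP.toℕ-injective same)) gt)))

    -- All tabloids of v have the row sizes of λ. Hence a tabloid of v cannot arise from `r` by only
    -- moving numbers to lower rows.
    row-total : (r′ : Tab {n} {sh}) → ¬ (v r′ ≡ 0ℚ) → N.∑ (allFin n) (toℕ ∘ r′) ≡ N.∑ (allFin n) (toℕ ∘ r)
    row-total r′ nz = let (S′ , tab-S′) = vec-support xs r′ nz in begin
      N.∑ (allFin n) (toℕ ∘ r′) ≡⟨ N.∑-cong (allFin n) (λ i → cong toℕ (sym (tab-S′ i))) ⟩
      N.∑ (allFin n) (rowOf ∘ pos S′) ≡⟨ ∑-filling rowOf S′ S ⟩
      N.∑ (allFin n) (rowOf ∘ pos S) ≡⟨ N.∑-cong (allFin n) (λ i → cong toℕ (tab-S i)) ⟩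
      N.∑ (allFin n) (toℕ ∘ r) ∎
      where open ≡-Reasoning

    -- A column descent j < i with i above j: X consists of the numbers from i on in the row of i and of those up to j
    -- in the row of j. Among the redistributions of X, r is the lexicographically largest one.
    module Descent (i j : Fin n) (same-rank : rank i ≡ rank j) (above : toℕ (r i) < toℕ (r j)) (j<i : toℕ j < toℕ i) where

      p q : Fin (length sh)
      p = r i
      q = r j

      p≢q : ¬ (p ≡ q)
      p≢q eq = ℕP.<⇒≢ above (cong toℕ eq)

      X : Fin n → Bool
      X a = ((r a ==F p) ∧ not (toℕ a ℕ.<ᵇ toℕ i)) ∨ ((r a ==F q) ∧ not (toℕ j ℕ.<ᵇ toℕ a))

      X⇒ : ∀ a → X a ≡ true → (r a ≡ p × ¬ (toℕ a < toℕ i)) ⊎ (r a ≡ q × ¬ (toℕ j < toℕ a))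
      X⇒ a x with ∨-true ((r a ==F p) ∧ not (toℕ a ℕ.<ᵇ toℕ i)) x
      ... | inj₁ l = let (s , t) = ∧-true (r a ==F p) l in inj₁ (==F⇒ s , λ lt → not-true⇒ t (<⇒<ᵇ lt))
      ... | inj₂ l = let (s , t) = ∧-true (r a ==F q) l in inj₂ (==F⇒ s , λ lt → not-true⇒ t (<⇒<ᵇ lt))

      -- Summed over `a`, this gives `X` exactly one element more than row `p` has boxes: the part
      -- of row `p` from `i` on lacks the rank of `i`, and the part of row `q` up to `j` has the
      -- rank of `j` plus one.
      count : ∀ a → N.⟦ X a ⟧ ℕ.+ N.⟦ below i a ⟧ ≡ N.⟦ r a ==F p ⟧ ℕ.+ (N.⟦ below j a ⟧ ℕ.+ N.⟦ a ==F j ⟧)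
      count a with r a FP.≟ p | r a FP.≟ q | a FP.≟ j
      ... | yes ep | yes eq | _ = ⊥-elim (p≢q (trans (sym ep) eq))
      ... | yes ep | no _ | yes refl = ⊥-elim (p≢q (sym ep))
      ... | no _ | no nq | yes refl = ⊥-elim (nq refl)
      ... | no _ | no _ | no _ = refl
      ... | no _ | yes _ | yes refl rewrite <ᵇ-irrefl (toℕ j) = refl
      ... | yes _ | no _ | no _ with toℕ a ℕ.<ᵇ toℕ i
      ...   | true = refl
      ...   | false = refl
      count a | no _ | yes _ | no a≢j with ℕP.<-cmp (toℕ a) (toℕ j)
      ...   | tri< lt _ _ rewrite proj₁ (<ᵇ-asym (toℕ a) (toℕ j) lt) | proj₂ (<ᵇ-asym (toℕ a) (toℕ j) lt) = refl
      ...   | tri≈ _ eq _ = ⊥-elim (a≢j (FP.toℕ-injective eq))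
      ...   | tri> _ _ gt rewrite proj₁ (<ᵇ-asym (toℕ j) (toℕ a) gt) | proj₂ (<ᵇ-asym (toℕ j) (toℕ a) gt) = refl

      big : lookup sh p < N.∑ (allFin n) (λ a → N.⟦ X a ⟧)
      big = ℕP.≤-reflexive (sym (ℕP.+-cancelʳ-≡ (rank i) _ _ (begin
        N.∑ (allFin n) (λ a → N.⟦ X a ⟧) ℕ.+ rank i
          ≡⟨ N.∑-+ (allFin n) (λ a → N.⟦ X a ⟧) (λ a → N.⟦ below i a ⟧) ⟨
        N.∑ (allFin n) (λ a → N.⟦ X a ⟧ ℕ.+ N.⟦ below i a ⟧)
          ≡⟨ N.∑-cong (allFin n) count ⟩
        N.∑ (allFin n) (λ a → N.⟦ r a ==F p ⟧ ℕ.+ (N.⟦ below j a ⟧ ℕ.+ N.⟦ a ==F j ⟧))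
          ≡⟨ N.∑-+ (allFin n) (λ a → N.⟦ r a ==F p ⟧) _ ⟩
        N.∑ (allFin n) (λ a → N.⟦ r a ==F p ⟧) ℕ.+ N.∑ (allFin n) (λ a → N.⟦ below j a ⟧ ℕ.+ N.⟦ a ==F j ⟧)
          ≡⟨ cong₂ ℕ._+_ (row-size-r p) (N.∑-+ (allFin n) (λ a → N.⟦ below j a ⟧) (λ a → N.⟦ a ==F j ⟧)) ⟩
        lookup sh p ℕ.+ (rank j ℕ.+ N.∑ (allFin n) (λ a → N.⟦ a ==F j ⟧))
          ≡⟨ cong₂ (λ x y → lookup sh p ℕ.+ (x ℕ.+ y)) (sym same-rank) (allFin-once j) ⟩
        lookup sh p ℕ.+ (rank i ℕ.+ 1)
          ≡⟨ cong (lookup sh p ℕ.+_) (ℕP.+-comm (rank i) 1) ⟩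
        lookup sh p ℕ.+ (1 ℕ.+ rank i)
          ≡⟨ ℕP.+-suc (lookup sh p) (rank i) ⟩
        suc (lookup sh p) ℕ.+ rank i ∎)))
        where open ≡-Reasoning

      open Garnir {n} {sh} p q (antitone p q above) X r big

      r-in-family : InFamily r
      r-in-family = (λ a x → inside (X⇒ a x)) , λ _ _ → refl
        where
        inside : ∀ {a} → (r a ≡ p × ¬ (toℕ a < toℕ i)) ⊎ (r a ≡ q × ¬ (toℕ j < toℕ a)) → r a ≡ p ⊎ r a ≡ q
        inside (inj₁ (l , _)) = inj₁ l
        inside (inj₂ (l , _)) = inj₂ l

      -- Consider the first difference `k`. If `r′` is smaller there, it lies below the least term.
      -- If it is larger, `k` was moved from row `p` to row `q`, so `k` is at least `i`. The members
      -- of `X` in row `q` are at most `j` < `i`, hence before `k` and unmoved; so no number moves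
      -- up and `k` moves down, against `row-total`.
      only-r : ∀ r′ → ¬ (v r′ ≡ 0ℚ) → family r′ ≡ true → r′ ≗ r
      only-r r′ nz fam with firstDifference r′ r
      ... | inj₁ h = h
      ... | inj₂ (k , agree , differ) = ⊥-elim contradiction
        where
        inside = proj₁ (family⇒ r′ fam)
        outside = proj₂ (family⇒ r′ fam)
        p≤ : ∀ {x} → x ≡ p ⊎ x ≡ q → toℕ p ≤ toℕ x
        p≤ (inj₁ refl) = ℕP.≤-refl
        p≤ (inj₂ refl) = ℕP.<⇒≤ above
        contradiction : ⊥
        contradiction with ℕP.<-cmp (toℕ (r′ k)) (toℕ (r k))
        ... | tri< lt _ _ = nz (least r′ (weight-< r′ r k agree lt))
        ... | tri≈ _ eq _ = differ (FP.toℕ-injective eq)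
        ... | tri> _ _ gt = ℕP.<⇒≢ (∑ℕ-strict pointwise k gt) (sym (row-total r′ nz))
          where
          i≤k : toℕ i ≤ toℕ k
          i≤k with X k in x
          ... | false = ⊥-elim (differ (outside k x))
          ... | true with X⇒ k x
          ...   | inj₁ (_ , k≮i) = ℕP.≮⇒≥ k≮i
          ...   | inj₂ (rk≡q , _) with inside k x
          ...     | inj₁ l = ⊥-elim (ℕP.<-asym gt (subst₂ (λ a b → toℕ a < toℕ b) (sym l) (sym rk≡q) above))
          ...     | inj₂ l = ⊥-elim (differ (trans l (sym rk≡q)))
          pointwise : ∀ a → toℕ (r a) ≤ toℕ (r′ a)
          pointwise a with X a in x
          ... | false = ℕP.≤-reflexive (cong toℕ (sym (outside a x)))
          ... | true with X⇒ a x
          ...   | inj₁ (ra≡p , _) = subst (λ z → toℕ z ≤ toℕ (r′ a)) (sym ra≡p) (p≤ (inside a x))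
          ...   | inj₂ (_ , j≮a) = ℕP.≤-reflexive (cong toℕ (sym (agree a (ℕP.<-≤-trans (ℕP.≤-<-trans (ℕP.≮⇒≥ j≮a) j<i) i≤k))))

      -- The Garnir sum collapses to its term at `r`, which would therefore vanish.
      impossible : ⊥
      impossible = vr≢0 (begin
        v r ≡⟨ Q.∑-δ (FunE n (length sh)) r v (λ r′ h → vec-cong xs (eqTab⇒ r′ r h)) ⟨
        Q.∑ (tabs {n} {sh}) (λ r′ → Q.⟦ eqTab r′ r ⟧ ℚ.* v r′) ≡⟨ Q.∑-cong (tabs {n} {sh}) term ⟩
        Q.∑ (tabs {n} {sh}) (λ r′ → Q.⟦ family r′ ⟧ ℚ.* v r′) ≡⟨ garnir xs ⟩
        0ℚ ∎)
        where
        open ≡-Reasoning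
        term : ∀ r′ → Q.⟦ eqTab r′ r ⟧ ℚ.* v r′ ≡ Q.⟦ family r′ ⟧ ℚ.* v r′
        term r′ with v r′ ℚP.≟ 0ℚ
        ... | yes z = trans (cong (Q.⟦ eqTab r′ r ⟧ ℚ.*_) z) (trans (ℚP.*-zeroʳ Q.⟦ eqTab r′ r ⟧)
                      (sym (trans (cong (Q.⟦ family r′ ⟧ ℚ.*_) z) (ℚP.*-zeroʳ Q.⟦ family r′ ⟧))))
        ... | no nz = cong (λ b → Q.⟦ b ⟧ ℚ.* v r′) (bool-ext
          (λ h → trans (family-cong (eqTab⇒ r′ r h)) (⇒family r r-in-family))
          (λ h → ⇒eqTab (only-r r′ nz h)))

    columns-increase : ColumnIncreasing rankFilling
    columns-increase i j same above with ℕP.<-cmp (toℕ i) (toℕ j)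
    ... | tri< lt _ _ = lt
    ... | tri≈ _ eq _ = ⊥-elim (ℕP.<⇒≢ above (cong (row rankFilling) (FP.toℕ-injective eq)))
    ... | tri> _ _ gt = ⊥-elim (Descent.impossible i j
            (trans (sym (col-rankFilling i)) (trans same (col-rankFilling j))) above gt)

    leading : SYT n sh
    leading = rankFilling , rows-increase , columns-increase

  -- Induction on the weight: only one function, r₀, has weight `w`. If the combination found so far
  -- is wrong at r₀, the difference has r₀ as its least term, so r₀ is the tabloid of a standard T.
  -- Adding a multiple of e_T corrects the value at r₀ and changes nothing below.
  straighten-below : (xs : List (ℚ × Filling n sh)) (w : ℕ) →
    ∃[ ys ] (∀ r → weight r < w → vec xs r ≡ vec (forget ys) r)
  straighten-below xs zero = [] , λ _ ()
  straighten-below xs (suc w) with straighten-below xs w | w ℕP.<? length sh ℕ.^ n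
  -- All weights are below `length sh ℕ.^ n`, so nothing is left to correct.
  ... | ys , agree | no w≮ = ys , λ r _ → agree r (ℕP.<-≤-trans (FP.toℕ<n (F.funToFin r)) (ℕP.≮⇒≥ w≮))
  ... | ys , agree | yes w< with vec xs (F.finToFun (F.fromℕ< w<)) ℚP.≟ vec (forget ys) (F.finToFun (F.fromℕ< w<))
  ...   | yes z = ys , λ r lt → case r (ℕP.m<1+n⇒m<n∨m≡n lt)
    where
    r₀ = F.finToFun (F.fromℕ< w<)
    weight-r₀ : weight r₀ ≡ w
    weight-r₀ = trans (cong toℕ (FP.funToFin-finToFin {n} (F.fromℕ< w<))) (FP.toℕ-fromℕ< w<)
    case : ∀ r → weight r < w ⊎ weight r ≡ w → vec xs r ≡ vec (forget ys) r
    case r (inj₁ lt) = agree r lt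
    case r (inj₂ eq) = let h = weight-injective {f = r} {r₀} (trans eq (sym weight-r₀)) in
      trans (vec-cong xs h) (trans z (sym (vec-cong (forget ys) h)))
  ...   | no nz = (vec zs r₀ , T) ∷ ys , λ r lt → case r (ℕP.m<1+n⇒m<n∨m≡n lt)
    where
    open ≡-Reasoning
    r₀ = F.finToFun (F.fromℕ< w<)
    weight-r₀ : weight r₀ ≡ w
    weight-r₀ = trans (cong toℕ (FP.funToFin-finToFin {n} (F.fromℕ< w<))) (FP.toℕ-fromℕ< w<)
    zs = xs ++ negate (forget ys)
    vec-zs : ∀ r → vec zs r ≡ vec xs r ℚ.+ (ℚ.- 1ℚ) ℚ.* vec (forget ys) r
    vec-zs r = trans (vec-++ xs _ r) (cong (vec xs r ℚ.+_) (vec-negate (forget ys) r))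
    least : ∀ r → weight r < weight r₀ → vec zs r ≡ 0ℚ
    least r lt = trans (vec-zs r) (trans
      (cong (λ z → z ℚ.+ (ℚ.- 1ℚ) ℚ.* vec (forget ys) r) (agree r (subst (weight r <_) weight-r₀ lt)))
      (+-negate (vec (forget ys) r)))
    open Leading zs r₀ (λ eq → nz (cancel-negate _ _ (trans (sym (vec-zs r₀)) eq))) least using (leading)
    T = leading
    one : e (proj₁ T) r₀ ≡ 1ℚ
    -- The rows of `leading` are r₀ by definition. The coefficient being 1, the multiple to be added
    -- is the value of the difference at r₀.
    one = trans (e-leading (proj₁ T) (proj₂ (proj₂ T)) r₀ (ℕP.<-irrefl refl)) (cong Q.⟦_⟧ (⇒eqTab {f = r₀} (λ _ → refl)))
    case : ∀ r → weight r < w ⊎ weight r ≡ w → vec xs r ≡ vec (forget ((vec zs r₀ , T) ∷ ys)) r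
    case r (inj₁ lt) = begin
      vec xs r ≡⟨ agree r lt ⟩
      vec (forget ys) r ≡⟨ ℚP.+-identityˡ _ ⟨
      0ℚ ℚ.+ vec (forget ys) r ≡⟨ cong (ℚ._+ vec (forget ys) r) (trans (cong (vec zs r₀ ℚ.*_) (e-smaller T r (subst (weight r <_) (sym weight-r₀) lt))) (ℚP.*-zeroʳ (vec zs r₀))) ⟨
      vec zs r₀ ℚ.* e (proj₁ T) r ℚ.+ vec (forget ys) r ∎
    case r (inj₂ eq) = let h = weight-injective {f = r} {r₀} (trans eq (sym weight-r₀)) in begin
      vec xs r ≡⟨ vec-cong xs h ⟩
      vec xs r₀ ≡⟨ ℚP.+-identityʳ _ ⟨
      vec xs r₀ ℚ.+ 0ℚ ≡⟨ cong (vec xs r₀ ℚ.+_) (trans (ℚP.+-comm ((ℚ.- 1ℚ) ℚ.* vec (forget ys) r₀) (vec (forget ys) r₀)) (+-negate (vec (forget ys) r₀))) ⟨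
      vec xs r₀ ℚ.+ ((ℚ.- 1ℚ) ℚ.* vec (forget ys) r₀ ℚ.+ vec (forget ys) r₀) ≡⟨ ℚP.+-assoc (vec xs r₀) _ _ ⟨
      vec xs r₀ ℚ.+ (ℚ.- 1ℚ) ℚ.* vec (forget ys) r₀ ℚ.+ vec (forget ys) r₀
        ≡⟨ cong₂ ℚ._+_ (trans (sym (vec-zs r₀)) (sym (trans (cong (vec zs r₀ ℚ.*_) (trans (e-cong (proj₁ T) h) one)) (ℚP.*-identityʳ (vec zs r₀))))) (sym (vec-cong (forget ys) h)) ⟩
      vec zs r₀ ℚ.* e (proj₁ T) r ℚ.+ vec (forget ys) r ∎

  straighten : (xs : List (ℚ × Filling n sh)) → ∃[ ys ] (∀ r → vec xs r ≡ vec (forget ys) r)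
  straighten xs with straighten-below xs (length sh ℕ.^ n)
  ... | ys , agree = ys , λ r → agree r (FP.toℕ<n (F.funToFin r))

-- Coefficients of formal linear combinations

sum-map : {A : Set} (f : A → ℕ) (xs : List A) → sum (map f xs) ≡ N.∑ xs f
sum-map f [] = refl
sum-map f (x ∷ xs) = cong (f x ℕ.+_) (sum-map f xs)

coeffFV-∑ : {X : Set} (eq : X → X → Bool) (v : FV X) (x : X) →
  coeffFV eq v x ≡ Q.∑ v (λ cy → proj₁ cy ℚ.* Q.⟦ eq (proj₂ cy) x ⟧)
coeffFV-∑ eq [] x = refl
coeffFV-∑ eq ((c , y) ∷ v) x with eq y x
... | true = cong₂ ℚ._+_ (sym (ℚP.*-identityʳ c)) (coeffFV-∑ eq v x)
... | false = trans (coeffFV-∑ eq v x) (sym (trans (cong (ℚ._+ rest) (ℚP.*-zeroʳ c)) (ℚP.+-identityˡ rest)))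
  where rest = Q.∑ v (λ cy → proj₁ cy ℚ.* Q.⟦ eq (proj₂ cy) x ⟧)

coeffFV-++ : {X : Set} (eq : X → X → Bool) (u v : FV X) (x : X) → coeffFV eq (u ++ v) x ≡ coeffFV eq u x ℚ.+ coeffFV eq v x
coeffFV-++ eq u v x = trans (coeffFV-∑ eq (u ++ v) x) (trans (Q.∑-++ u v _)
  (sym (cong₂ ℚ._+_ (coeffFV-∑ eq u x) (coeffFV-∑ eq v x))))

coeffFV-scale : {X : Set} (eq : X → X → Bool) (c : ℚ) (v : FV X) (x : X) → coeffFV eq (scaleFV c v) x ≡ c ℚ.* coeffFV eq v x
coeffFV-scale eq c v x = trans (coeffFV-∑ eq (scaleFV c v) x) (trans (Q.∑-map _ v _)
  (trans (Q.∑-cong v (λ dy → ℚP.*-assoc c (proj₁ dy) _))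
    (trans (sym (Q.∑-* c v _)) (cong (c ℚ.*_) (sym (coeffFV-∑ eq v x))))))

coeffFV-concatMap : {X I : Set} (eq : X → X → Bool) (g : I → FV X) (is : List I) (x : X) →
  coeffFV eq (concatMap g is) x ≡ Q.∑ is (λ i → coeffFV eq (g i) x)
coeffFV-concatMap eq g is x = trans (coeffFV-∑ eq (concatMap g is) x) (trans (Q.∑-concatMap g is _)
  (Q.∑-cong is (λ i → sym (coeffFV-∑ eq (g i) x))))

coeffFV-lincomb : {X I : Set} (eq : X → X → Bool) (g : I → FV X) (is : List (ℚ × I)) (x : X) →
  coeffFV eq (concatMap (λ ci → scaleFV (proj₁ ci) (g (proj₂ ci))) is) x ≡ Q.∑ is (λ ci → proj₁ ci ℚ.* coeffFV eq (g (proj₂ ci)) x)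
coeffFV-lincomb eq g is x = trans (coeffFV-concatMap eq _ is x) (Q.∑-cong is (λ ci → coeffFV-scale eq (proj₁ ci) (g (proj₂ ci)) x))

actExp-perm : {n : ℕ} (σ : Fin n → Fin n) → injB σ ≡ true → (a : Exp n) (i : Fin n) → actExp σ a (σ i) ≡ a i
actExp-perm {n} σ inj a i = begin
  actExp σ a (σ i) ≡⟨ sum-map _ (allFin n) ⟩
  N.∑ (allFin n) (λ j → if σ j ==F σ i then a j else 0) ≡⟨ N.∑-cong (allFin n) term ⟩
  N.∑ (allFin n) (λ j → N.⟦ j ==F i ⟧ ℕ.* a j) ≡⟨ N.∑-δ (FinE n) i a (λ j h → cong a (==F⇒ h)) ⟩
  a i ∎
  where
  open ≡-Reasoning
  select-if : (b : Bool) (x : ℕ) → (if b then x else 0) ≡ N.⟦ b ⟧ ℕ.* x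
  select-if true x = sym (ℕP.*-identityˡ x)
  select-if false x = refl
  term : ∀ j → (if σ j ==F σ i then a j else 0) ≡ N.⟦ j ==F i ⟧ ℕ.* a j
  term j = trans (select-if (σ j ==F σ i) (a j)) (cong (λ b → N.⟦ b ⟧ ℕ.* a j)
    (bool-ext (λ h → ⇒==F (injB⇒ σ inj (==F⇒ h))) (λ h → ⇒==F (cong σ (==F⇒ h)))))

-- For a permutation, `actExp σ a` is a ∘ σ⁻¹; the inverse is moved to the other side of the
-- comparison.
eqExp-actExp : {n : ℕ} (σ : Fin n → Fin n) → injB σ ≡ true → (a b : Exp n) → eqExp (actExp σ a) b ≡ eqExp a (b ∘ σ)
eqExp-actExp σ inj a b = bool-ext
  (λ h → ⇒eqExp (λ i → trans (sym (actExp-perm σ inj a i)) (eqExp⇒ (actExp σ a) b h (σ i))))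
  (λ h → ⇒eqExp (λ j → trans (cong (actExp σ a) (sym (inverseʳ π)))
     (trans (actExp-perm σ inj a (π ⟨$⟩ˡ j)) (trans (eqExp⇒ a (b ∘ σ) h (π ⟨$⟩ˡ j)) (cong b (inverseʳ π))))))
  where π = fromInjB σ inj

coeff-actP : {n : ℕ} (σ : Fin n → Fin n) → injB σ ≡ true → (p : Poly n) (a : Exp n) → coeff (actP σ p) a ≡ coeff p (a ∘ σ)
coeff-actP σ inj p a = trans (coeffFV-∑ eqExp (actP σ p) a) (trans (Q.∑-map _ p _)
  (trans (Q.∑-cong p (λ cy → cong (λ b → proj₁ cy ℚ.* Q.⟦ b ⟧) (eqExp-actExp σ inj (proj₂ cy) a)))
    (sym (coeffFV-∑ eqExp p (a ∘ σ)))))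

-- The default value of the fold survives only if no test succeeds, which the given preimage rules
-- out.
preimage-section : {n : ℕ} (σ : Fin n → Fin n) (j : Fin n) → (∃[ i ] σ i ≡ j) → σ (preimage σ j) ≡ j
preimage-section {n} σ j (i , σi≡j) = go (allFin n) (∈-allFin i)
  where
  go : ∀ is → i ∈ is → σ (foldr (λ i acc → if σ i ==F j then i else acc) j is) ≡ j
  go (x ∷ is) i∈ with σ x ==F j in h
  ... | true = ==F⇒ h
  go (x ∷ is) (here refl) | false with () ← trans (sym (⇒==F σi≡j)) h
  go (x ∷ is) (there i∈) | false = go is i∈

eqTab-preimage : {n m : ℕ} (σ : Fin n → Fin n) → injB σ ≡ true → (t r : Fin n → Fin m) →
  eqTab (t ∘ preimage σ) r ≡ eqTab t (r ∘ σ)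
eqTab-preimage σ inj t r = bool-ext
  (λ h → ⇒eqTab (λ i → trans (cong t (sym (injB⇒ σ inj (section (σ i))))) (eqTab⇒ (t ∘ preimage σ) r h (σ i))))
  (λ h → ⇒eqTab (λ j → trans (eqTab⇒ t (r ∘ σ) h (preimage σ j)) (cong r (section j))))
  where
  section : ∀ j → σ (preimage σ j) ≡ j
  section j = preimage-section σ j (injective⇒surjective (injB⇒ σ inj) j)

coeff-actM : {n : ℕ} {sh : List ℕ} (σ : Fin n → Fin n) → injB σ ≡ true → (v : ML n sh) (r : TabFun n (length sh)) →
  coeffFV eqTab (actM {n} {sh} σ v) r ≡ coeffFV eqTab v (r ∘ σ)
coeff-actM {n} {sh} σ inj v r = trans (coeffFV-∑ eqTab (actM {n} {sh} σ v) r) (trans (Q.∑-map _ v _)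
  (trans (Q.∑-cong v (λ cy → cong (λ b → proj₁ cy ℚ.* Q.⟦ b ⟧) (eqTab-preimage σ inj (proj₂ cy) r)))
    (sym (coeffFV-∑ eqTab v (r ∘ σ)))))

ι : ℕ → ℚ
ι zero = 0ℚ
ι (suc k) = 1ℚ ℚ.+ ι k

ι-∑ : {A : Set} (p : A → Bool) (xs : List A) → ι (N.∑ xs (λ x → N.⟦ p x ⟧)) ≡ Q.∑ xs (λ x → Q.⟦ p x ⟧)
ι-∑ p [] = refl
ι-∑ p (x ∷ xs) with p x
... | true = cong (1ℚ ℚ.+_) (ι-∑ p xs)
... | false = trans (ι-∑ p xs) (sym (ℚP.+-identityˡ _))

0≤ι : ∀ k → 0ℚ ℚ.≤ ι k
0≤ι zero = ℚP.≤-refl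
0≤ι (suc k) = ℚP.+-mono-≤ (ℚP.<⇒≤ (ℚP.positive⁻¹ 1ℚ)) (0≤ι k)

ι-nonzero : ∀ {k} → 0 < k → ¬ (ι k ≡ 0ℚ)
ι-nonzero {suc k} _ eq = ℚP.<⇒≢ (ℚP.+-mono-<-≤ (ℚP.positive⁻¹ 1ℚ) (0≤ι k)) (sym eq)

invℕ-nonzero : ∀ {k} → 0 < k → ¬ (invℕ k ≡ 0ℚ)
invℕ-nonzero {suc k} _ eq = ℚP.<⇒≢ (ℚP.positive⁻¹ ((ℤ.+ 1) ℚ./ suc k) {{ℚP.normalize-pos 1 (suc k)}}) (sym eq)

∑ℕ-nonzero : {A : Set} (p : A → Bool) (xs : List A) → ¬ (N.∑ xs (λ x → N.⟦ p x ⟧) ≡ 0) → ∃[ x ] p x ≡ true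
∑ℕ-nonzero p xs ne with search p xs
... | inj₁ found = found
... | inj₂ none = ⊥-elim (ne (trans (N.∑-cong∈ xs (λ x x∈ → cong N.⟦_⟧ (none x x∈))) (N.∑-0 xs)))

-- Column indices of boxes in different rows have different types, so they are compared as numbers.
boxEq : {sh : List ℕ} → Box sh → Box sh → Bool
boxEq b b′ = (Box.r b ==F Box.r b′) ∧ (colOf b ≡ᵇ colOf b′)

boxEq⇒ : {sh : List ℕ} (b b′ : Box sh) → boxEq b b′ ≡ true → b ≡ b′
boxEq⇒ b b′ h = let (p , q) = ∧-true (Box.r b ==F Box.r b′) h in box-≡ (cong toℕ (==F⇒ p)) (≡ᵇ⇒ _ _ q)

⇒boxEq : {sh : List ℕ} {b b′ : Box sh} → b ≡ b′ → boxEq b b′ ≡ true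
⇒boxEq {b = b} refl = ∧-intro (⇒==F {i = Box.r b} refl) (⇒≡ᵇ {colOf b} refl)

BoxE : (sh : List ℕ) → Enum (Box sh)
BoxE sh = record { list = boxes sh ; eq = boxEq ; once = λ y → trans (length-filterB _ (boxes sh)) (once y) }
  where
  open ≡-Reasoning
  once : ∀ y → N.∑ (boxes sh) (λ b → N.⟦ boxEq b y ⟧) ≡ 1
  once y = begin
    N.∑ (boxes sh) (λ b → N.⟦ boxEq b y ⟧)
      ≡⟨ N.∑-concatMap (λ r → map (λ c → box {sh} r c) (allFin (lookup sh r))) (allFin (length sh)) (λ b → N.⟦ boxEq b y ⟧) ⟩
    N.∑ (allFin (length sh)) (λ r → N.∑ (map (λ c → box r c) (allFin (lookup sh r))) (λ b → N.⟦ boxEq b y ⟧))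
      ≡⟨ N.∑-cong (allFin (length sh)) (λ r → trans (N.∑-map (λ c → box r c) (allFin (lookup sh r)) _)
           (trans (N.∑-cong (allFin (lookup sh r)) (λ c → N.⟦∧⟧ (r ==F Box.r y) (toℕ c ≡ᵇ colOf y)))
             (sym (N.∑-* N.⟦ r ==F Box.r y ⟧ (allFin (lookup sh r)) _)))) ⟩
    N.∑ (allFin (length sh)) (λ r → N.⟦ r ==F Box.r y ⟧ ℕ.* inRow r)
      ≡⟨ N.∑-δ (FinE (length sh)) (Box.r y) inRow (λ r h → cong inRow (==F⇒ h)) ⟩
    inRow (Box.r y)
      ≡⟨ N.∑-cong (allFin (lookup sh (Box.r y))) (λ c → cong N.⟦_⟧ (bool-ext {toℕ c ≡ᵇ colOf y} {c ==F Box.c y}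
           (λ h → ⇒==F (FP.toℕ-injective (≡ᵇ⇒ (toℕ c) (colOf y) h))) (λ h → ⇒≡ᵇ (cong toℕ (==F⇒ {i = c} h))))) ⟩
    N.∑ (allFin (lookup sh (Box.r y))) (λ c → N.⟦ c ==F Box.c y ⟧)
      ≡⟨ allFin-once (Box.c y) ⟩
    1 ∎
    where
    inRow : Fin (length sh) → ℕ
    inRow r = N.∑ (allFin (lookup sh r)) (λ c → N.⟦ toℕ c ≡ᵇ colOf y ⟧)

entrySum-filling : {n : ℕ} {sh : List ℕ} (M : Box sh → ℕ) (T : Filling n sh) → N.∑ (allFin n) (hMT M T) ≡ entrySum sh M
entrySum-filling {n} {sh} M T = trans
  (N.∑-reindex (FinE n) (BoxE sh) (pos T) (number T) adj M (λ x y h → cong M (boxEq⇒ x y h)))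
  (sym (sum-map M (boxes sh)))
  where
  adj : ∀ i b → boxEq b (pos T i) ≡ (i ==F number T b)
  adj i b = bool-ext
    (λ h → ⇒==F (pos-injective T (trans (sym (boxEq⇒ b (pos T i) h)) (sym (pos-number T b)))))
    (λ h → ⇒boxEq (trans (sym (pos-number T b)) (cong (pos T) (sym (==F⇒ {i = i} h)))))

∑-perm : {n : ℕ} (π : Permutation′ n) (f : Fin n → ℕ) → N.∑ (allFin n) (f ∘ (π ⟨$⟩ʳ_)) ≡ N.∑ (allFin n) f
∑-perm {n} π f = N.∑-reindex (FinE n) (FinE n) (π ⟨$⟩ʳ_) (π ⟨$⟩ˡ_) (adjoint-Fin π) f (λ x y h → cong f (==F⇒ h))

module _ {n : ℕ} {sh : List ℕ} where

  ∑-colStab : (T : Filling n sh) (f : (Fin n → Fin n) → ℚ) →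
    Q.∑ (colStab T) f ≡ Q.∑ (allFuns n n) (λ σ → Q.⟦ CS T σ ⟧ ℚ.* f σ)
  ∑-colStab T f = trans (Q.∑-filter inC (Sn n) f) (trans (Q.∑-filter injB (allFuns n n) _)
    (Q.∑-cong (allFuns n n) (λ σ → sym (Q.⟦∧⟧* (injB σ) (inC σ) (f σ)))))
    where
    inC : (Fin n → Fin n) → Bool
    inC σ = all (λ i → colOf (pos T (σ i)) ≡ᵇ colOf (pos T i)) (allFin n)

  polytabloid-coeff : (T : Filling n sh) (r : Tab {n} {sh}) → coeffFV eqTab (polytabloid T) r ≡ e T r
  polytabloid-coeff T r = begin
    coeffFV eqTab (polytabloid T) r ≡⟨ coeffFV-∑ eqTab (polytabloid T) r ⟩
    Q.∑ (polytabloid T) (λ cy → proj₁ cy ℚ.* Q.⟦ eqTab (proj₂ cy) r ⟧) ≡⟨ Q.∑-map _ (colStab T) _ ⟩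
    Q.∑ (colStab T) (λ σ → sgn σ ℚ.* Q.⟦ eqTab (tabloid T ∘ preimage σ) r ⟧) ≡⟨ ∑-colStab T _ ⟩
    Q.∑ (allFuns n n) (λ σ → Q.⟦ CS T σ ⟧ ℚ.* (sgn σ ℚ.* Q.⟦ eqTab (tabloid T ∘ preimage σ) r ⟧))
      ≡⟨ Q.∑-cong (allFuns n n) (λ σ → trans
           (Q.⟦⟧-cong (CS T σ) (λ cs → trans (cong (λ b → sgn σ ℚ.* Q.⟦ b ⟧) (eqTab-preimage σ (proj₁ (CS⇒ T σ cs)) (tabloid T) r))
              (ℚP.*-comm (sgn σ) Q.⟦ eqTab (tabloid T) (r ∘ σ) ⟧)))
           (sym (Q.⟦∧⟧* (CS T σ) (eqTab (tabloid T) (r ∘ σ)) (sgn σ)))) ⟩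
    Q.∑ (allFuns n n) (λ σ → Q.⟦ CS T σ ∧ eqTab (tabloid T) (r ∘ σ) ⟧ ℚ.* sgn σ) ≡⟨ A-def T (tabloid T) r ⟨
    e T r ∎
    where open ≡-Reasoning

  spechtVector : List (ℚ × Filling n sh) → ML n sh
  spechtVector = concatMap (λ ci → scaleFV (proj₁ ci) (polytabloid {n} {sh} (proj₂ ci)))

  spechtVector-coeff : (xs : List (ℚ × Filling n sh)) (r : Tab {n} {sh}) → coeffFV eqTab (spechtVector xs) r ≡ vec xs r
  spechtVector-coeff xs r = trans (coeffFV-lincomb eqTab polytabloid xs r)
    (Q.∑-cong xs (λ cT → cong (proj₁ cT ℚ.*_) (polytabloid-coeff (proj₂ cT) r)))

  -- This is π e_T = e_{πT}: the left side is the coefficient of `r` in π e_T.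
  e-act : (T : Filling n sh) (π : Permutation′ n) (r : Tab {n} {sh}) → e T (r ∘ (π ⟨$⟩ʳ_)) ≡ e (T ∘T flip π) r
  e-act T π r = trans (sym (A-conjugate T (flip π) (tabloid T) (r ∘ (π ⟨$⟩ʳ_))))
    (A-congʳ (T ∘T flip π) (tabloid (T ∘T flip π)) (λ i → cong r (inverseʳ π)))

-- The coefficients of F_{M,T}

module _ {n : ℕ} {sh : List ℕ} (M : Box sh → ℕ) where

  private
    h : Filling n sh → Exp n
    h = hMT M

  -- Says that τT has tabloid `r` and that p_{M,τT} is x^a. Here τ is any permutation, so that `r`
  -- need not be the tabloid of `T`.
  matches : Filling n sh → Tab {n} {sh} → Exp n → (Fin n → Fin n) → Bool
  matches T r a τ = injB τ ∧ (eqTab (tabloid T) (r ∘ τ) ∧ eqExp (h T) (a ∘ τ))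

  -- Up to the constant factor s, the coefficient of x^a in the sum of the row rearrangements of M placed on the tabloid r.
  K : Filling n sh → Tab {n} {sh} → Exp n → ℕ
  K T r a = N.∑ (allFuns n n) (λ τ → N.⟦ matches T r a τ ⟧)

  matches-cong : (T : Filling n sh) {r s : Tab {n} {sh}} {a b : Exp n} {σ τ : Fin n → Fin n} →
    r ≗ s → a ≗ b → σ ≗ τ → matches T r a σ ≡ matches T s b τ
  matches-cong T {r} {s} {a} {b} {σ} {τ} p q t = cong₂ _∧_ (injB-cong t) (cong₂ _∧_
    (eqTab-congʳ (tabloid T) (λ i → trans (p (σ i)) (cong s (t i))))
    (eqExp-cong {f = h T} (λ _ → refl) (λ i → trans (q (σ i)) (cong b (t i)))))

  K-cong : (T : Filling n sh) {r s : Tab {n} {sh}} {a b : Exp n} → r ≗ s → a ≗ b → K T r a ≡ K T s b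
  K-cong T p q = N.∑-cong (allFuns n n) (λ τ → cong N.⟦_⟧ (matches-cong T {σ = τ} p q (λ _ → refl)))

  K-act : (T : Filling n sh) (π : Permutation′ n) (r : Tab {n} {sh}) (a : Exp n) →
    K T (r ∘ (π ⟨$⟩ʳ_)) (a ∘ (π ⟨$⟩ʳ_)) ≡ K T r a
  K-act T π r a = trans
    (N.∑-cong (allFuns n n) (λ τ → cong (λ b → N.⟦ b ∧ (eqTab (tabloid T) (r ∘ p ∘ τ) ∧ eqExp (h T) (a ∘ p ∘ τ)) ⟧) (sym (injB-post π τ))))
    (N.∑-reindex (FunE n n) (FunE n n) (p ∘_) ((π ⟨$⟩ˡ_) ∘_) (adjoint-post π) (λ τ → N.⟦ matches T r a τ ⟧)
      (λ x y eq → cong N.⟦_⟧ (matches-cong T {r} {a = a} (λ _ → refl) (λ _ → refl) (eqTab⇒ x y eq))))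
    where p = π ⟨$⟩ʳ_

  -- As τ runs over all permutations, τT runs over all fillings. Thus `K` counts the fillings with
  -- tabloid `r` and monomial x^a, whatever the base filling.
  K-base : (T₀ T : Filling n sh) (r : Tab {n} {sh}) (a : Exp n) → K T₀ r a ≡ K T r a
  K-base T₀ T r a = sym (trans (N.∑-cong (allFuns n n) (λ τ → cong N.⟦_⟧ (bits τ)))
    (N.∑-reindex (FunE n n) (FunE n n) (_∘ q) (_∘ p) (adjoint-pre (flip ρ)) (λ τ → N.⟦ matches T₀ r a τ ⟧)
      (λ x y eq → cong N.⟦_⟧ (matches-cong T₀ {r} {a = a} (λ _ → refl) (λ _ → refl) (eqTab⇒ x y eq)))))
    where
    ρ = relabel T T₀
    p = ρ ⟨$⟩ʳ_
    q = ρ ⟨$⟩ˡ_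
    base : ∀ i → pos T (q i) ≡ pos T₀ i
    base i = trans (sym (relabel-pos T T₀ (q i))) (cong (pos T₀) (inverseʳ ρ))
    bits : ∀ τ → matches T r a τ ≡ matches T₀ r a (τ ∘ q)
    bits τ = cong₂ _∧_ (sym (injB-pre (flip ρ) τ)) (cong₂ _∧_
      (bool-ext
        (λ eq → ⇒eqTab (λ i → trans (cong Box.r (sym (base i))) (eqTab⇒ (tabloid T) (r ∘ τ) eq (q i))))
        (λ eq → ⇒eqTab (λ i → trans (cong Box.r (sym (relabel-pos T T₀ i)))
           (trans (eqTab⇒ (tabloid T₀) (r ∘ τ ∘ q) eq (p i)) (cong (r ∘ τ) (inverseˡ ρ))))))
      (bool-ext
        (λ eq → ⇒eqExp (λ i → trans (cong M (sym (base i))) (eqExp⇒ (h T) (a ∘ τ) eq (q i))))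
        (λ eq → ⇒eqExp (λ i → trans (cong M (sym (relabel-pos T T₀ i)))
           (trans (eqExp⇒ (h T₀) (a ∘ τ ∘ q) eq (p i)) (cong (a ∘ τ) (inverseˡ ρ)))))))

  row-preserving : (T : Filling n sh) (τ : Fin n → Fin n) →
    all (λ i → rowOf (pos T (τ i)) ≡ᵇ rowOf (pos T i)) (allFin n) ≡ eqTab (tabloid T) (tabloid T ∘ τ)
  row-preserving T τ = all-cong (allFin n) (λ i → bool-ext {row T (τ i) ≡ᵇ row T i} {tabloid T i ==F tabloid T (τ i)}
    (λ eq → ⇒==F (FP.toℕ-injective (sym (≡ᵇ⇒ (row T (τ i)) (row T i) eq))))
    (λ eq → ⇒≡ᵇ (cong toℕ (sym (==F⇒ {i = tabloid T i} eq)))))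

  -- At the tabloid and monomial of `T` itself, the matching τ are the row permutations that fix
  -- p_{M,T}.
  sMT-K : (T : Filling n sh) → sMT M T ≡ K T (tabloid T) (h T)
  sMT-K T = begin
    sMT M T
      ≡⟨ length-filterB _ (rowStab T) ⟩
    N.∑ (rowStab T) (λ τ → N.⟦ eqExp (actExp τ (h T)) (h T) ⟧)
      ≡⟨ N.∑-filter _ (Sn n) _ ⟩
    N.∑ (Sn n) (λ τ → N.⟦ inR τ ⟧ ℕ.* N.⟦ eqExp (actExp τ (h T)) (h T) ⟧)
      ≡⟨ N.∑-filter injB (allFuns n n) _ ⟩
    N.∑ (allFuns n n) (λ τ → N.⟦ injB τ ⟧ ℕ.* (N.⟦ inR τ ⟧ ℕ.* N.⟦ eqExp (actExp τ (h T)) (h T) ⟧))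
      ≡⟨ N.∑-cong (allFuns n n) (λ τ → trans
           (N.⟦⟧-cong (injB τ) (λ inj → trans (cong₂ (λ b c → N.⟦ b ⟧ ℕ.* N.⟦ c ⟧) (row-preserving T τ) (eqExp-actExp τ inj (h T) (h T)))
                                      (sym (N.⟦∧⟧ (eqTab (tabloid T) (tabloid T ∘ τ)) _))))
           (sym (N.⟦∧⟧ (injB τ) _))) ⟩
    K T (tabloid T) (h T) ∎
    where
    open ≡-Reasoning
    inR : (Fin n → Fin n) → Bool
    inR τ = all (λ i → rowOf (pos T (τ i)) ≡ᵇ rowOf (pos T i)) (allFin n)

  -- Because s is the same for all fillings, a single linear map θ, normalised at `T₀`, serves every
  -- F_{M,T}.
  sMT-constant : (T₀ T : Filling n sh) → sMT M T ≡ sMT M T₀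
  sMT-constant T₀ T = begin
    sMT M T ≡⟨ sMT-K T ⟩
    K T (tabloid T) (h T) ≡⟨ K-base T₀ T (tabloid T) (h T) ⟨
    K T₀ (tabloid T) (h T) ≡⟨ K-cong T₀ (λ i → cong Box.r (relabel-pos T T₀ i)) (λ i → cong M (relabel-pos T T₀ i)) ⟨
    K T₀ (tabloid T₀ ∘ (ρ ⟨$⟩ʳ_)) (h T₀ ∘ (ρ ⟨$⟩ʳ_)) ≡⟨ K-act T₀ ρ (tabloid T₀) (h T₀) ⟩
    K T₀ (tabloid T₀) (h T₀) ≡⟨ sMT-K T₀ ⟨
    sMT M T₀ ∎
    where
    open ≡-Reasoning
    ρ = relabel T T₀

  sMT-positive : (T : Filling n sh) → 0 < sMT M T
  sMT-positive T = subst (0 <_) (sym (sMT-K T)) (begin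
    1 ≡⟨ allFuns-once {n} id ⟨
    N.∑ (allFuns n n) (λ τ → N.⟦ eqTab τ id ⟧)
      ≤⟨ ∑ℕ-mono (allFuns n n) (λ τ → ⟦⟧-mono (eqTab τ id) (λ eq → let eq′ = eqTab⇒ τ id eq in
           ∧-intro (trans (injB-cong {f = τ} {id} eq′) (⇒injB {n} {id} id))
             (∧-intro (⇒eqTab (λ i → cong (tabloid T) (sym (eq′ i)))) (⇒eqExp (λ i → cong (h T) (sym (eq′ i))))))) ⟩
    K T (tabloid T) (h T) ∎)
    where open ℕP.≤-Reasoning

  -- The sum over R(T) inside ε_T is a count of matches on the tabloid of `T`; the signed column sum
  -- remains.
  F-coeff : (T : Filling n sh) (a : Exp n) → coeff (FMT M T) a ≡
    invℕ (sMT M T) ℚ.* Q.∑ (allFuns n n) (λ σ → Q.⟦ CS T σ ⟧ ℚ.* (sgn σ ℚ.* ι (K T (tabloid T) (a ∘ σ))))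
  F-coeff T a = begin
    coeff (FMT M T) a
      ≡⟨ coeffFV-scale eqExp (invℕ (sMT M T)) (epsT T (pMT M T)) a ⟩
    invℕ (sMT M T) ℚ.* coeff (epsT T (pMT M T)) a
      ≡⟨ cong (invℕ (sMT M T) ℚ.*_) (begin
        coeff (epsT T (pMT M T)) a
          ≡⟨ coeffFV-concatMap eqExp _ (colStab T) a ⟩
        Q.∑ (colStab T) (λ σ → coeff (concatMap (term σ) (rowStab T)) a)
          ≡⟨ ∑-colStab T _ ⟩
        Q.∑ (allFuns n n) (λ σ → Q.⟦ CS T σ ⟧ ℚ.* coeff (concatMap (term σ) (rowStab T)) a)
          ≡⟨ Q.∑-cong (allFuns n n) (λ σ → Q.⟦⟧-cong (CS T σ) (λ cs → inner σ (proj₁ (CS⇒ T σ cs)))) ⟩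
        Q.∑ (allFuns n n) (λ σ → Q.⟦ CS T σ ⟧ ℚ.* (sgn σ ℚ.* ι (K T (tabloid T) (a ∘ σ)))) ∎) ⟩
    invℕ (sMT M T) ℚ.* Q.∑ (allFuns n n) (λ σ → Q.⟦ CS T σ ⟧ ℚ.* (sgn σ ℚ.* ι (K T (tabloid T) (a ∘ σ)))) ∎
    where
    open ≡-Reasoning
    inR : (Fin n → Fin n) → Bool
    inR τ = all (λ i → rowOf (pos T (τ i)) ≡ᵇ rowOf (pos T i)) (allFin n)
    term : (σ τ : Fin n → Fin n) → Poly n
    term σ τ = scaleFV (sgn σ) (actP (σ ∘ τ) (pMT M T))
    single : ∀ σ τ → injB σ ≡ true → injB τ ≡ true → coeff (term σ τ) a ≡ sgn σ ℚ.* Q.⟦ eqExp (h T) (a ∘ σ ∘ τ) ⟧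
    single σ τ injσ injτ = begin
      coeff (term σ τ) a ≡⟨ coeffFV-scale eqExp (sgn σ) (actP (σ ∘ τ) (pMT M T)) a ⟩
      sgn σ ℚ.* coeff (actP (σ ∘ τ) (pMT M T)) a
        ≡⟨ cong (sgn σ ℚ.*_) (coeff-actP (σ ∘ τ) (trans (injB-post (fromInjB σ injσ) τ) injτ) (pMT M T) a) ⟩
      sgn σ ℚ.* coeff (pMT M T) (a ∘ σ ∘ τ)
        ≡⟨ cong (sgn σ ℚ.*_) (trans (coeffFV-∑ eqExp (pMT M T) (a ∘ σ ∘ τ)) (trans (ℚP.+-identityʳ _) (ℚP.*-identityˡ _))) ⟩
      sgn σ ℚ.* Q.⟦ eqExp (h T) (a ∘ σ ∘ τ) ⟧ ∎
    inner : ∀ σ → injB σ ≡ true → coeff (concatMap (term σ) (rowStab T)) a ≡ sgn σ ℚ.* ι (K T (tabloid T) (a ∘ σ))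
    inner σ injσ = begin
      coeff (concatMap (term σ) (rowStab T)) a
        ≡⟨ coeffFV-concatMap eqExp (term σ) (rowStab T) a ⟩
      Q.∑ (rowStab T) (λ τ → coeff (term σ τ) a)
        ≡⟨ Q.∑-filter inR (Sn n) _ ⟩
      Q.∑ (Sn n) (λ τ → Q.⟦ inR τ ⟧ ℚ.* coeff (term σ τ) a)
        ≡⟨ Q.∑-filter injB (allFuns n n) _ ⟩
      Q.∑ (allFuns n n) (λ τ → Q.⟦ injB τ ⟧ ℚ.* (Q.⟦ inR τ ⟧ ℚ.* coeff (term σ τ) a))
        ≡⟨ Q.∑-cong (allFuns n n) (λ τ → collect τ) ⟩
      Q.∑ (allFuns n n) (λ τ → sgn σ ℚ.* Q.⟦ matches T (tabloid T) (a ∘ σ) τ ⟧)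
        ≡⟨ Q.∑-* (sgn σ) (allFuns n n) _ ⟨
      sgn σ ℚ.* Q.∑ (allFuns n n) (λ τ → Q.⟦ matches T (tabloid T) (a ∘ σ) τ ⟧)
        ≡⟨ cong (sgn σ ℚ.*_) (ι-∑ (matches T (tabloid T) (a ∘ σ)) (allFuns n n)) ⟨
      sgn σ ℚ.* ι (K T (tabloid T) (a ∘ σ)) ∎
      where
      collect : ∀ τ → Q.⟦ injB τ ⟧ ℚ.* (Q.⟦ inR τ ⟧ ℚ.* coeff (term σ τ) a) ≡ sgn σ ℚ.* Q.⟦ matches T (tabloid T) (a ∘ σ) τ ⟧
      collect τ = begin
        Q.⟦ injB τ ⟧ ℚ.* (Q.⟦ inR τ ⟧ ℚ.* coeff (term σ τ) a)
          ≡⟨ Q.⟦⟧-cong (injB τ) (λ injτ → cong₂ (λ b x → Q.⟦ b ⟧ ℚ.* x) (row-preserving T τ) (single σ τ injσ injτ)) ⟩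
        Q.⟦ injB τ ⟧ ℚ.* (Q.⟦ B ⟧ ℚ.* (sgn σ ℚ.* Q.⟦ D ⟧))
          ≡⟨ cong (Q.⟦ injB τ ⟧ ℚ.*_) (Q.*-left-comm Q.⟦ B ⟧ (sgn σ) Q.⟦ D ⟧) ⟩
        Q.⟦ injB τ ⟧ ℚ.* (sgn σ ℚ.* (Q.⟦ B ⟧ ℚ.* Q.⟦ D ⟧))
          ≡⟨ Q.*-left-comm Q.⟦ injB τ ⟧ (sgn σ) _ ⟩
        sgn σ ℚ.* (Q.⟦ injB τ ⟧ ℚ.* (Q.⟦ B ⟧ ℚ.* Q.⟦ D ⟧))
          ≡⟨ cong (sgn σ ℚ.*_) (trans (Q.⟦∧⟧ (injB τ) (B ∧ D)) (cong (Q.⟦ injB τ ⟧ ℚ.*_) (Q.⟦∧⟧ B D))) ⟨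
        sgn σ ℚ.* Q.⟦ matches T (tabloid T) (a ∘ σ) τ ⟧ ∎
        where
        B = eqTab (tabloid T) (tabloid T ∘ τ)
        D = eqExp (h T) (a ∘ σ ∘ τ)

  F-support : (T : Filling n sh) (a : Exp n) → ¬ (coeff (FMT M T) a ≡ 0ℚ) →
    ∃[ σ ] (injB σ ≡ true × h T ≗ a ∘ σ)
  F-support T a ne = go (∑-nonzero (allFuns n n) _ (*-nonzeroʳ (invℕ (sMT M T)) (λ z → ne (trans (F-coeff T a) z))))
    where
    f : (Fin n → Fin n) → ℚ
    f σ = Q.⟦ CS T σ ⟧ ℚ.* (sgn σ ℚ.* ι (K T (tabloid T) (a ∘ σ)))
    go : ∃[ σ ] σ ∈ allFuns n n × ¬ (f σ ≡ 0ℚ) → ∃[ σ ] (injB σ ≡ true × h T ≗ a ∘ σ)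
    go (σ , _ , nz) = σ ∘ τ , trans (injB-post (fromInjB σ injσ) τ) (proj₁ parts) ,
        eqExp⇒ (h T) (a ∘ σ ∘ τ) (proj₂ (∧-true (eqTab (tabloid T) (tabloid T ∘ τ)) (proj₂ parts)))
      where
      injσ = proj₁ (CS⇒ T σ (⟦⟧*-nonzero (CS T σ) {sgn σ ℚ.* ι (K T (tabloid T) (a ∘ σ))} nz))
      K≢0 : ¬ (K T (tabloid T) (a ∘ σ) ≡ 0)
      K≢0 z = nz (trans (cong (λ k → Q.⟦ CS T σ ⟧ ℚ.* (sgn σ ℚ.* ι k)) z)
        (trans (cong (Q.⟦ CS T σ ⟧ ℚ.*_) (ℚP.*-zeroʳ (sgn σ))) (ℚP.*-zeroʳ Q.⟦ CS T σ ⟧)))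
      found = ∑ℕ-nonzero (matches T (tabloid T) (a ∘ σ)) (allFuns n n) K≢0
      τ = proj₁ found
      parts = ∧-true (injB τ) (proj₂ found)

  degree-F : (T : Filling n sh) (a : Exp n) → ¬ (coeff (FMT M T) a ≡ 0ℚ) → degree a ≡ entrySum sh M
  degree-F T a ne = go (F-support T a ne)
    where
    open ≡-Reasoning
    go : ∃[ σ ] (injB σ ≡ true × h T ≗ a ∘ σ) → degree a ≡ entrySum sh M
    go (σ , inj , eq) = begin
      degree a ≡⟨ sum-map a (allFin n) ⟩
      N.∑ (allFin n) a ≡⟨ ∑-perm (fromInjB σ inj) a ⟨
      N.∑ (allFin n) (a ∘ σ) ≡⟨ N.∑-cong (allFin n) (λ i → sym (eq i)) ⟩
      N.∑ (allFin n) (h T) ≡⟨ entrySum-filling M T ⟩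
      entrySum sh M ∎

  module _ (column-strict : ∀ (b b′ : Box sh) → colOf b ≡ colOf b′ → rowOf b < rowOf b′ → M b < M b′) where

    -- Row by row from the top: σ moves the entries of row k weakly down, hence to larger values of M, but leaves
    -- their sum unchanged.
    column-row-rigid : (T : Filling n sh) (σ : Fin n → Fin n) → CS T σ ≡ true → (τ : Permutation′ n) →
      (∀ i → tabloid T i ≡ tabloid T (τ ⟨$⟩ʳ i)) → (∀ i → h T i ≡ h T (σ (τ ⟨$⟩ʳ i))) → σ ≗ id
    column-row-rigid T σ cs τ rows fixed i = go (suc (row T i)) i ℕP.≤-refl
      where
      inj = injB⇒ σ (proj₁ (CS⇒ T σ cs))
      cols = proj₂ (CS⇒ T σ cs)
      go : ∀ k i → row T i < k → σ i ≡ i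
      go (suc k) i (ℕ.s≤s i≤k) with ℕP.m≤n⇒m<n∨m≡n i≤k
      ... | inj₁ i<k = go k i i<k
      ... | inj₂ ri≡k = conclude (move i ri≡k)
        where
        f g : Fin n → ℕ
        f j = N.⟦ row T j ≡ᵇ k ⟧ ℕ.* h T j
        g j = N.⟦ row T j ≡ᵇ k ⟧ ℕ.* h T (σ j)
        move : ∀ j → row T j ≡ k → σ j ≡ j ⊎ h T j < h T (σ j)
        move j rj with ℕP.<-cmp (row T j) (row T (σ j))
        ... | tri< lt _ _ = inj₂ (column-strict (pos T j) (pos T (σ j)) (sym (cols j)) lt)
        ... | tri≈ _ eq _ = inj₁ (pos-injective T (box-≡ (sym eq) (cols j)))
        -- σ j lies in a row already treated and is therefore fixed by σ; injectivity gives σ j = j.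
        ... | tri> _ _ gt = inj₁ (inj (go k (σ j) (subst (row T (σ j) <_) rj gt)))
        f≤g : ∀ j → f j ≤ g j
        f≤g j with row T j ≡ᵇ k in eq
        ... | false = ℕ.z≤n
        ... | true with move j (≡ᵇ⇒ (row T j) k eq)
        ...   | inj₁ same = ℕP.≤-reflexive (cong (λ z → 1 ℕ.* h T z) (sym same))
        ...   | inj₂ lt = ℕP.*-monoʳ-≤ 1 (ℕP.<⇒≤ lt)
        sums : N.∑ (allFin n) g ≡ N.∑ (allFin n) f
        sums = trans (sym (∑-perm τ g)) (N.∑-cong (allFin n) (λ j →
          cong₂ (λ x y → N.⟦ x ≡ᵇ k ⟧ ℕ.* y) (cong toℕ (sym (rows j))) (sym (fixed j))))
        fi≡gi : f i ≡ g i
        fi≡gi = ∑ℕ-squeeze (allFin n) f≤g (ℕP.≤-reflexive sums) i (∈-allFin i)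
        equal : h T i ≡ h T (σ i)
        equal = trans (sym (ℕP.*-identityˡ _)) (trans
          (subst (λ b → N.⟦ b ⟧ ℕ.* h T i ≡ N.⟦ b ⟧ ℕ.* h T (σ i)) (⇒≡ᵇ {row T i} ri≡k) fi≡gi) (ℕP.*-identityˡ _))
        conclude : σ i ≡ i ⊎ h T i < h T (σ i) → σ i ≡ i
        conclude (inj₁ same) = same
        conclude (inj₂ lt) = ⊥-elim (ℕP.<⇒≢ lt equal)

    -- A contribution of σ to the coefficient of p_{M,T} comes with a row permutation τ such that στ
    -- fixes p_{M,T}; by `column-row-rigid` this forces σ to be the identity. What remains is 1/s
    -- times the count s.
    F-nonzero : (T : Filling n sh) → ¬ (coeff (FMT M T) (h T) ≡ 0ℚ)
    F-nonzero T = subst (λ q → ¬ (q ≡ 0ℚ)) (sym (trans (F-coeff T (h T)) (cong (invℕ (sMT M T) ℚ.*_) total)))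
      (*-nonzero (invℕ-nonzero (sMT-positive T)) (ι-nonzero (subst (0 <_) (sMT-K T) (sMT-positive T))))
      where
      open ≡-Reasoning
      t = tabloid T
      only-id : ∀ σ → CS T σ ≡ true → ¬ (K T t (h T ∘ σ) ≡ 0) → σ ≗ id
      only-id σ cs nz = column-row-rigid T σ cs (fromInjB τ (proj₁ parts))
          (eqTab⇒ t (t ∘ τ) (proj₁ (∧-true (eqTab t (t ∘ τ)) (proj₂ parts))))
          (eqExp⇒ (h T) (h T ∘ σ ∘ τ) (proj₂ (∧-true (eqTab t (t ∘ τ)) (proj₂ parts))))
        where
        found = ∑ℕ-nonzero (matches T t (h T ∘ σ)) (allFuns n n) nz
        τ = proj₁ found
        parts = ∧-true (injB τ) (proj₂ found)
      value : (Fin n → Fin n) → ℚ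
      value σ = sgn σ ℚ.* ι (K T t (h T ∘ σ))
      term : ∀ σ → Dec (K T t (h T ∘ σ) ≡ 0) → Q.⟦ CS T σ ⟧ ℚ.* value σ ≡ Q.⟦ eqTab σ id ⟧ ℚ.* value σ
      term σ (yes z) = trans (vanish (CS T σ)) (sym (vanish (eqTab σ id)))
        where
        vanish : ∀ b → Q.⟦ b ⟧ ℚ.* value σ ≡ 0ℚ
        vanish b = trans (cong (λ k → Q.⟦ b ⟧ ℚ.* (sgn σ ℚ.* ι k)) z)
          (trans (cong (Q.⟦ b ⟧ ℚ.*_) (ℚP.*-zeroʳ (sgn σ))) (ℚP.*-zeroʳ Q.⟦ b ⟧))
      term σ (no nz) = cong (λ b → Q.⟦ b ⟧ ℚ.* value σ) (bool-ext
        (λ cs → ⇒eqTab (only-id σ cs nz))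
        (λ eq → trans (CS-cong T {σ} {id} (eqTab⇒ σ id eq)) (⇒CS T (⇒injB {n} {id} id) (λ _ → refl))))
      total : Q.∑ (allFuns n n) (λ σ → Q.⟦ CS T σ ⟧ ℚ.* value σ) ≡ ι (K T t (h T))
      total = begin
        Q.∑ (allFuns n n) (λ σ → Q.⟦ CS T σ ⟧ ℚ.* value σ)
          ≡⟨ Q.∑-cong (allFuns n n) (λ σ → term σ (K T t (h T ∘ σ) ℕP.≟ 0)) ⟩
        Q.∑ (allFuns n n) (λ σ → Q.⟦ eqTab σ id ⟧ ℚ.* value σ)
          ≡⟨ Q.∑-δ (FunE n n) id value (λ σ eq → let eq′ = eqTab⇒ σ id eq in
               cong₂ (λ s k → s ℚ.* ι k) (sgn-cong {σ = σ} {id} eq′) (K-cong T {t} (λ _ → refl) (λ i → cong (h T) (eq′ i)))) ⟩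
        sgn {n} id ℚ.* ι (K T t (h T)) ≡⟨ cong (ℚ._* ι (K T t (h T))) (sgn-id n) ⟩
        1ℚ ℚ.* ι (K T t (h T)) ≡⟨ ℚP.*-identityˡ _ ⟩
        ι (K T t (h T)) ∎

-- Transfer from polytabloids to the polynomials F_{M,T}

antitone : {sh : List ℕ} → Linked ℕ._≥_ sh → Antitone sh
antitone linked = go (Linked⇒AllPairs (λ a b → ℕP.≤-trans b a) linked)
  where
  go : ∀ {sh} → AllPairs ℕ._≥_ sh → Antitone sh
  go {k ∷ sh} (all≤ ∷ _) F.zero (F.suc q) _ = All.lookup all≤ (∈-lookup q)
  go (_ ∷ pairs) (F.suc p) (F.suc q) (ℕ.s≤s lt) = go pairs p q lt

lowerBox : {k : ℕ} {sh : List ℕ} → Box sh → Box (k ∷ sh)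
lowerBox (box r c) = box (F.suc r) c

toBox : (sh : List ℕ) → Fin (sum sh) → Box sh
toBox (k ∷ sh) i = [ box F.zero , lowerBox ∘ toBox sh ]′ (F.splitAt k i)

fromBox : (sh : List ℕ) → Box sh → Fin (sum sh)
fromBox (k ∷ sh) (box F.zero c) = c F.↑ˡ sum sh
fromBox (k ∷ sh) (box (F.suc r) c) = k F.↑ʳ fromBox sh (box r c)

toBox-fromBox : (sh : List ℕ) (b : Box sh) → toBox sh (fromBox sh b) ≡ b
toBox-fromBox (k ∷ sh) (box F.zero c) = cong [ box F.zero , lowerBox ∘ toBox sh ]′ (FP.splitAt-↑ˡ k c (sum sh))
toBox-fromBox (k ∷ sh) (box (F.suc r) c) = trans
  (cong [ box F.zero , lowerBox ∘ toBox sh ]′ (FP.splitAt-↑ʳ k (sum sh) (fromBox sh (box r c))))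
  (cong lowerBox (toBox-fromBox sh (box r c)))

fromBox-toBox : (sh : List ℕ) (i : Fin (sum sh)) → fromBox sh (toBox sh i) ≡ i
fromBox-toBox (k ∷ sh) i with F.splitAt k i in eq
... | inj₁ c = FP.splitAt⁻¹-↑ˡ eq
... | inj₂ j = trans (lowered (toBox sh j)) (trans (cong (k F.↑ʳ_) (fromBox-toBox sh j)) (FP.splitAt⁻¹-↑ʳ eq))
  where
  lowered : (b : Box sh) → fromBox (k ∷ sh) (lowerBox b) ≡ k F.↑ʳ fromBox sh b
  lowered (box r c) = refl

-- The row-by-row numbering of the boxes. It serves as base filling for θ and as witness that V_M is
-- not zero.
someFilling : {n : ℕ} {sh : List ℕ} → sum sh ≡ n → Filling n sh
someFilling {sh = sh} refl = toBox sh
  , (λ {i} {j} eq → trans (sym (fromBox-toBox sh i)) (trans (cong (fromBox sh) eq) (fromBox-toBox sh j)))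
  , λ b → fromBox sh b , λ { refl → toBox-fromBox sh b }

zero-or-witness : {A : Set} (f : A → ℚ) (xs : List A) → (∃[ x ] ¬ (f x ≡ 0ℚ)) ⊎ (∀ x → x ∈ xs → f x ≡ 0ℚ)
zero-or-witness f [] = inj₂ λ _ ()
zero-or-witness f (x ∷ xs) with f x ℚP.≟ 0ℚ
... | no ne = inj₁ (x , ne)
... | yes z with zero-or-witness f xs
...   | inj₁ found = inj₁ found
...   | inj₂ zeros = inj₂ λ { _ (here refl) → z ; y (there y∈) → zeros y y∈ }

module _ {n : ℕ} {sh : List ℕ} where

  CS-pos : {T U : Filling n sh} → pos T ≗ pos U → ∀ σ → CS T σ ≡ CS U σ
  CS-pos p σ = cong (injB σ ∧_) (all-cong (allFin n) (λ i → cong₂ (λ b b′ → colOf b ≡ᵇ colOf b′) (p (σ i)) (p i)))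

  -- Fillings with the same positions may still differ in their proofs of bijectivity.
  e-pos : (T U : Filling n sh) → pos T ≗ pos U → ∀ r → e T r ≡ e U r
  e-pos T U p r = trans (A-def T (tabloid T) r) (trans
    (Q.∑-cong (allFuns n n) (λ σ → cong (λ b → Q.⟦ b ⟧ ℚ.* sgn σ)
      (cong₂ _∧_ (CS-pos {T} {U} p σ) (eqTab-cong {f = tabloid T} {tabloid U} (λ i → cong Box.r (p i)) (λ _ → refl)))))
    (sym (A-def U (tabloid U) r)))

  act : Permutation′ n → List (ℚ × Filling n sh) → List (ℚ × Filling n sh)
  act π = map (λ cT → proj₁ cT , proj₂ cT ∘T flip π)

  vec-act : (π : Permutation′ n) (xs : List (ℚ × Filling n sh)) (r : Tab {n} {sh}) → vec (act π xs) r ≡ vec xs (r ∘ (π ⟨$⟩ʳ_))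
  vec-act π xs r = trans (Q.∑-map _ xs _) (Q.∑-cong xs (λ cT → cong (proj₁ cT ℚ.*_) (sym (e-act (proj₂ cT) π r))))

  scale : ℚ → List (ℚ × Filling n sh) → List (ℚ × Filling n sh)
  scale c = map (λ dT → c ℚ.* proj₁ dT , proj₂ dT)

  vec-scale : (c : ℚ) (xs : List (ℚ × Filling n sh)) (r : Tab {n} {sh}) → vec (scale c xs) r ≡ c ℚ.* vec xs r
  vec-scale c xs r = trans (Q.∑-map _ xs _)
    (trans (Q.∑-cong xs (λ cT → ℚP.*-assoc c (proj₁ cT) _)) (sym (Q.∑-* c xs _)))

-- The linear map θ from tabloids to polynomials sending {T} to the sum of the distinct row rearrangements of p_{M,T}.
module Theta {n : ℕ} {sh : List ℕ} (M : Box sh → ℕ)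
             (column-strict : ∀ (b b′ : Box sh) → colOf b ≡ colOf b′ → rowOf b < rowOf b′ → M b < M b′)
             (T₀ : Filling n sh) where

  opaque

    -- The coefficient of x^a in θ{r}: every distinct row rearrangement is counted s times by `K`.
    G : Tab {n} {sh} → Exp n → ℚ
    G r a = invℕ (sMT M T₀) ℚ.* ι (K M T₀ r a)

    G-cong : ∀ {r s a b} → r ≗ s → a ≗ b → G r a ≡ G s b
    G-cong {r} p q = cong (λ k → invℕ (sMT M T₀) ℚ.* ι k) (K-cong M T₀ {r} p q)

    G-act : (π : Permutation′ n) (r : Tab {n} {sh}) (a : Exp n) → G (r ∘ (π ⟨$⟩ʳ_)) (a ∘ (π ⟨$⟩ʳ_)) ≡ G r a
    G-act π r a = cong (λ k → invℕ (sMT M T₀) ℚ.* ι k) (K-act M T₀ π r a)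

    F-G : (T : Filling n sh) (a : Exp n) →
      coeff (FMT M T) a ≡ Q.∑ (allFuns n n) (λ σ → Q.⟦ CS T σ ⟧ ℚ.* (sgn σ ℚ.* G (tabloid T) (a ∘ σ)))
    F-G T a = begin
      coeff (FMT M T) a ≡⟨ F-coeff M T a ⟩
      invℕ (sMT M T) ℚ.* Q.∑ (allFuns n n) (λ σ → Q.⟦ CS T σ ⟧ ℚ.* (sgn σ ℚ.* ι (K M T (tabloid T) (a ∘ σ))))
        ≡⟨ cong₂ ℚ._*_ (cong invℕ (sMT-constant M T₀ T)) (Q.∑-cong (allFuns n n) (λ σ →
             cong (λ k → Q.⟦ CS T σ ⟧ ℚ.* (sgn σ ℚ.* ι k)) (sym (K-base M T₀ T (tabloid T) (a ∘ σ))))) ⟩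
      s ℚ.* Q.∑ (allFuns n n) (λ σ → Q.⟦ CS T σ ⟧ ℚ.* (sgn σ ℚ.* ι (K M T₀ (tabloid T) (a ∘ σ))))
        ≡⟨ Q.∑-* s (allFuns n n) _ ⟩
      Q.∑ (allFuns n n) (λ σ → s ℚ.* (Q.⟦ CS T σ ⟧ ℚ.* (sgn σ ℚ.* ι (K M T₀ (tabloid T) (a ∘ σ)))))
        ≡⟨ Q.∑-cong (allFuns n n) (λ σ → trans (Q.*-left-comm s Q.⟦ CS T σ ⟧ (sgn σ ℚ.* ι (K M T₀ (tabloid T) (a ∘ σ))))
             (cong (Q.⟦ CS T σ ⟧ ℚ.*_) (Q.*-left-comm s (sgn σ) (ι (K M T₀ (tabloid T) (a ∘ σ)))))) ⟩
      Q.∑ (allFuns n n) (λ σ → Q.⟦ CS T σ ⟧ ℚ.* (sgn σ ℚ.* (s ℚ.* ι (K M T₀ (tabloid T) (a ∘ σ))))) ∎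
      where
      open ≡-Reasoning
      s : ℚ
      s = invℕ (sMT M T₀)

  rs : List (Tab {n} {sh})
  rs = tabs {n} {sh}

  θ : (Tab {n} {sh} → ℚ) → Exp n → ℚ
  θ v a = Q.∑ rs (λ r → v r ℚ.* G r a)

  θ-cong : {v w : Tab {n} {sh} → ℚ} → (∀ r → v r ≡ w r) → ∀ a → θ v a ≡ θ w a
  θ-cong p a = Q.∑-cong rs (λ r → cong (ℚ._* G r a) (p r))

  θ-+ : (v w : Tab {n} {sh} → ℚ) (a : Exp n) → θ (λ r → v r ℚ.+ w r) a ≡ θ v a ℚ.+ θ w a
  θ-+ v w a = trans (Q.∑-cong rs (λ r → ℚP.*-distribʳ-+ (G r a) (v r) (w r))) (Q.∑-+ rs _ _)

  θ-* : (c : ℚ) (v : Tab {n} {sh} → ℚ) (a : Exp n) → θ (λ r → c ℚ.* v r) a ≡ c ℚ.* θ v a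
  θ-* c v a = trans (Q.∑-cong rs (λ r → ℚP.*-assoc c (v r) (G r a))) (sym (Q.∑-* c rs _))

  θ-act : (π : Permutation′ n) (v : Tab {n} {sh} → ℚ) → (∀ {r s} → r ≗ s → v r ≡ v s) → (a : Exp n) →
    θ v (a ∘ (π ⟨$⟩ʳ_)) ≡ θ (λ r → v (r ∘ (π ⟨$⟩ʳ_))) a
  θ-act π v resp a = sym (trans
    (Q.∑-cong rs (λ r → cong (v (r ∘ p) ℚ.*_) (sym (G-act π r a))))
    (Q.∑-reindex (FunE n (length sh)) (FunE n (length sh)) (_∘ p) (_∘ (π ⟨$⟩ˡ_)) (adjoint-pre π)
      (λ r → v r ℚ.* G r (a ∘ p)) (λ x y eq → let eq′ = eqTab⇒ x y eq in cong₂ ℚ._*_ (resp eq′) (G-cong eq′ (λ _ → refl)))))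
    where p = π ⟨$⟩ʳ_

  -- Equivariance moves σ from the exponent to the tabloid; collecting the signs at each tabloid
  -- gives the coefficients of e_T.
  F-θ : (T : Filling n sh) (a : Exp n) → coeff (FMT M T) a ≡ θ (e T) a
  F-θ T a = begin
    coeff (FMT M T) a
      ≡⟨ F-G T a ⟩
    Q.∑ (allFuns n n) (λ σ → Q.⟦ CS T σ ⟧ ℚ.* (sgn σ ℚ.* G t (a ∘ σ)))
      ≡⟨ Q.∑-cong (allFuns n n) (λ σ → Q.⟦⟧-cong (CS T σ) (λ cs → trans
           (cong (sgn σ ℚ.*_) (spread σ (proj₁ (CS⇒ T σ cs)))) (Q.∑-* (sgn σ) rs _))) ⟩
    Q.∑ (allFuns n n) (λ σ → Q.⟦ CS T σ ⟧ ℚ.* Q.∑ rs (λ r → sgn σ ℚ.* (Q.⟦ eqTab t (r ∘ σ) ⟧ ℚ.* G r a)))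
      ≡⟨ Q.∑-cong (allFuns n n) (λ σ → trans (Q.∑-* Q.⟦ CS T σ ⟧ rs _)
           (Q.∑-cong rs (λ r → collect (CS T σ) (eqTab t (r ∘ σ)) (sgn σ) (G r a)))) ⟩
    Q.∑ (allFuns n n) (λ σ → Q.∑ rs (λ r → Q.⟦ CS T σ ∧ eqTab t (r ∘ σ) ⟧ ℚ.* sgn σ ℚ.* G r a))
      ≡⟨ Q.∑-swap (allFuns n n) rs _ ⟩
    Q.∑ rs (λ r → Q.∑ (allFuns n n) (λ σ → Q.⟦ CS T σ ∧ eqTab t (r ∘ σ) ⟧ ℚ.* sgn σ ℚ.* G r a))
      ≡⟨ Q.∑-cong rs (λ r → trans (sym (Q.∑-*ʳ (allFuns n n) (λ σ → Q.⟦ CS T σ ∧ eqTab t (r ∘ σ) ⟧ ℚ.* sgn σ) (G r a)))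
           (cong (ℚ._* G r a) (sym (A-def T t r)))) ⟩
    θ (e T) a ∎
    where
    open ≡-Reasoning
    t = tabloid T
    collect : (x y : Bool) (s g : ℚ) → Q.⟦ x ⟧ ℚ.* (s ℚ.* (Q.⟦ y ⟧ ℚ.* g)) ≡ Q.⟦ x ∧ y ⟧ ℚ.* s ℚ.* g
    collect x y s g = begin
      Q.⟦ x ⟧ ℚ.* (s ℚ.* (Q.⟦ y ⟧ ℚ.* g)) ≡⟨ cong (Q.⟦ x ⟧ ℚ.*_) (Q.*-left-comm s Q.⟦ y ⟧ g) ⟩
      Q.⟦ x ⟧ ℚ.* (Q.⟦ y ⟧ ℚ.* (s ℚ.* g)) ≡⟨ Q.⟦∧⟧* x y (s ℚ.* g) ⟨
      Q.⟦ x ∧ y ⟧ ℚ.* (s ℚ.* g) ≡⟨ ℚP.*-assoc Q.⟦ x ∧ y ⟧ s g ⟨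
      Q.⟦ x ∧ y ⟧ ℚ.* s ℚ.* g ∎
    spread : ∀ σ → injB σ ≡ true → G t (a ∘ σ) ≡ Q.∑ rs (λ r → Q.⟦ eqTab t (r ∘ σ) ⟧ ℚ.* G r a)
    spread σ inj = begin
      G t (a ∘ σ)
        ≡⟨ Q.∑-δ (FunE n (length sh)) t (λ r → G r (a ∘ σ)) (λ r eq → G-cong (eqTab⇒ r t eq) (λ _ → refl)) ⟨
      Q.∑ rs (λ r → Q.⟦ eqTab r t ⟧ ℚ.* G r (a ∘ σ))
        ≡⟨ Q.∑-cong rs (λ r → cong (λ b → Q.⟦ b ⟧ ℚ.* G r (a ∘ σ)) (eqTab-sym r t)) ⟩
      Q.∑ rs (λ r → Q.⟦ eqTab t r ⟧ ℚ.* G r (a ∘ σ))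
        -- Equivariance of θ, applied to the indicator vector of {T}.
        ≡⟨ θ-act (fromInjB σ inj) (λ r → Q.⟦ eqTab t r ⟧) (λ eq → cong Q.⟦_⟧ (eqTab-congʳ t eq)) a ⟩
      Q.∑ rs (λ r → Q.⟦ eqTab t (r ∘ σ) ⟧ ℚ.* G r a) ∎

  θ-vec : (xs : List (ℚ × Filling n sh)) (a : Exp n) → θ (vec xs) a ≡ Q.∑ xs (λ cT → proj₁ cT ℚ.* coeff (FMT M (proj₂ cT)) a)
  θ-vec xs a = begin
    Q.∑ rs (λ r → vec xs r ℚ.* G r a)
      ≡⟨ Q.∑-cong rs (λ r → trans (Q.∑-*ʳ xs _ (G r a)) (Q.∑-cong xs (λ cT → ℚP.*-assoc (proj₁ cT) _ (G r a)))) ⟩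
    Q.∑ rs (λ r → Q.∑ xs (λ cT → proj₁ cT ℚ.* (e (proj₂ cT) r ℚ.* G r a)))
      ≡⟨ Q.∑-swap rs xs _ ⟩
    Q.∑ xs (λ cT → Q.∑ rs (λ r → proj₁ cT ℚ.* (e (proj₂ cT) r ℚ.* G r a)))
      ≡⟨ Q.∑-cong xs (λ cT → trans (sym (Q.∑-* (proj₁ cT) rs _)) (cong (proj₁ cT ℚ.*_) (sym (F-θ (proj₂ cT) a)))) ⟩
    Q.∑ xs (λ cT → proj₁ cT ℚ.* coeff (FMT M (proj₂ cT)) a) ∎
    where open ≡-Reasoning

  lincomb-θ : (xs : List (ℚ × Filling n sh)) (a : Exp n) → coeff (lincomb (FMT M) xs) a ≡ θ (vec xs) a
  lincomb-θ xs a = trans (coeffFV-lincomb eqExp (FMT M) xs a) (sym (θ-vec xs a))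

  lincomb-SYT-θ : (ys : List (ℚ × SYT n sh)) (a : Exp n) → coeff (lincomb (λ T → FMT M (proj₁ T)) ys) a ≡ θ (vec (forget ys)) a
  lincomb-SYT-θ ys a = trans (coeffFV-lincomb eqExp (λ T → FMT M (proj₁ T)) ys a)
    (sym (trans (θ-vec (forget ys) a) (Q.∑-map _ ys _)))

  antisymmetrize-θ : (xs : List (ℚ × Filling n sh)) (T : Filling n sh) (a : Exp n) →
    Q.∑ (allFuns n n) (λ σ → Q.⟦ CS T σ ⟧ ℚ.* (sgn σ ℚ.* θ (vec xs) (a ∘ σ))) ≡ ⟨ xs ,e T ⟩ ℚ.* coeff (FMT M T) a
  antisymmetrize-θ xs T a = begin
    Q.∑ (allFuns n n) (λ σ → Q.⟦ CS T σ ⟧ ℚ.* (sgn σ ℚ.* θ v (a ∘ σ)))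
      ≡⟨ Q.∑-cong (allFuns n n) (λ σ → Q.⟦⟧-cong (CS T σ) (λ cs →
           cong (sgn σ ℚ.*_) (θ-act (fromInjB σ (proj₁ (CS⇒ T σ cs))) v (vec-cong xs) a))) ⟩
    Q.∑ (allFuns n n) (λ σ → Q.⟦ CS T σ ⟧ ℚ.* (sgn σ ℚ.* θ (λ r → v (r ∘ σ)) a))
      ≡⟨ Q.∑-cong (allFuns n n) (λ σ → trans (cong (Q.⟦ CS T σ ⟧ ℚ.*_) (sym (θ-* (sgn σ) (λ r → v (r ∘ σ)) a)))
           (sym (θ-* Q.⟦ CS T σ ⟧ (λ r → sgn σ ℚ.* v (r ∘ σ)) a))) ⟩
    Q.∑ (allFuns n n) (λ σ → Q.∑ rs (λ r → Q.⟦ CS T σ ⟧ ℚ.* (sgn σ ℚ.* v (r ∘ σ)) ℚ.* G r a))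
      ≡⟨ Q.∑-swap (allFuns n n) rs _ ⟩
    Q.∑ rs (λ r → Q.∑ (allFuns n n) (λ σ → Q.⟦ CS T σ ⟧ ℚ.* (sgn σ ℚ.* v (r ∘ σ)) ℚ.* G r a))
      ≡⟨ Q.∑-cong rs (λ r → trans (sym (Q.∑-*ʳ (allFuns n n) (λ σ → Q.⟦ CS T σ ⟧ ℚ.* (sgn σ ℚ.* v (r ∘ σ))) (G r a)))
           (cong (ℚ._* G r a) (antisymmetrize-vec xs T r))) ⟩
    θ (λ r → ⟨ xs ,e T ⟩ ℚ.* e T r) a
      ≡⟨ θ-* ⟨ xs ,e T ⟩ (e T) a ⟩
    ⟨ xs ,e T ⟩ ℚ.* θ (e T) a
      ≡⟨ cong (⟨ xs ,e T ⟩ ℚ.*_) (F-θ T a) ⟨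
    ⟨ xs ,e T ⟩ ℚ.* coeff (FMT M T) a ∎
    where
    open ≡-Reasoning
    v = vec xs

  θ-kernel : (xs : List (ℚ × Filling n sh)) → (∀ a → θ (vec xs) a ≡ 0ℚ) → ∀ r → vec xs r ≡ 0ℚ
  θ-kernel xs z = nondegenerate xs (λ cT _ → pairing (proj₂ cT))
    where
    pairing : ∀ T → ⟨ xs ,e T ⟩ ≡ 0ℚ
    -- Both sides are compared at the exponent of p_{M,T}, where F_{M,T} is known to be nonzero.
    pairing T = *-cancelʳ-≢0 (F-nonzero M column-strict T) (trans (sym (antisymmetrize-θ xs T (hMT M T)))
      (trans (Q.∑-zero (allFuns n n) (λ σ → trans (cong (Q.⟦ CS T σ ⟧ ℚ.*_) (trans (cong (sgn σ ℚ.*_) (z (hMT M T ∘ σ))) (ℚP.*-zeroʳ (sgn σ))))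
        (ℚP.*-zeroʳ Q.⟦ CS T σ ⟧))) (sym (ℚP.*-zeroˡ (coeff (FMT M T) (hMT M T))))))

  -- A polynomial in V_M may be spanned by many lists. That all of them give the same vector makes a
  -- map defined on lists well defined and linear.
  θ-injective : (xs ys : List (ℚ × Filling n sh)) → (∀ a → θ (vec xs) a ≡ θ (vec ys) a) → ∀ r → vec xs r ≡ vec ys r
  θ-injective xs ys same r = cancel-negate _ _ (trans (sym (difference r)) (θ-kernel (xs ++ negate ys) kernel r))
    where
    open ≡-Reasoning
    difference : ∀ r → vec (xs ++ negate ys) r ≡ vec xs r ℚ.+ (ℚ.- 1ℚ) ℚ.* vec ys r
    difference r = trans (vec-++ xs (negate ys) r) (cong (vec xs r ℚ.+_) (vec-negate ys r))
    kernel : ∀ a → θ (vec (xs ++ negate ys)) a ≡ 0ℚ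
    kernel a = begin
      θ (vec (xs ++ negate ys)) a ≡⟨ θ-cong difference a ⟩
      θ (λ r → vec xs r ℚ.+ (ℚ.- 1ℚ) ℚ.* vec ys r) a ≡⟨ θ-+ (vec xs) _ a ⟩
      θ (vec xs) a ℚ.+ θ (λ r → (ℚ.- 1ℚ) ℚ.* vec ys r) a ≡⟨ cong₂ ℚ._+_ (same a) (θ-* (ℚ.- 1ℚ) (vec ys) a) ⟩
      θ (vec ys) a ℚ.+ (ℚ.- 1ℚ) ℚ.* θ (vec ys) a ≡⟨ +-negate (θ (vec ys) a) ⟩
      0ℚ ∎

-- Basis, irreducibility and the isomorphism with the Specht module

module Main {n : ℕ} {sh : List ℕ} (partition : IsPartition n sh) (M : Box sh → ℕ) (ssyt : IsSSYT sh M) where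

  T₀ : Filling n sh
  T₀ = someFilling (proj₂ (proj₂ partition))

  open Theta M (proj₂ ssyt) T₀

  V : Poly n → Set
  V = InVM n sh M

  isPerm⇒injB : (σ : Fin n → Fin n) → IsPerm σ → injB σ ≡ true
  isPerm⇒injB σ perm = ⇒injB {n} {σ} (proj₁ perm)

  V-coeff : (p : Poly n) (hp : V p) (a : Exp n) → coeff p a ≡ θ (vec (proj₁ hp)) a
  V-coeff p (xs , p≈) a = trans (p≈ a) (lincomb-θ xs a)

  F∈V : (T : Filling n sh) → V (FMT M T)
  F∈V T = (1ℚ , T) ∷ [] , λ a → sym (trans (coeffFV-lincomb eqExp (FMT M) ((1ℚ , T) ∷ []) a)
    (trans (ℚP.+-identityʳ _) (ℚP.*-identityˡ (coeff (FMT M T) a))))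

  basis : IsBasisOf (SameT {n} {sh}) (λ T → FMT M (proj₁ T)) V
  basis = (λ T → F∈V (proj₁ T)) , independence , spanning
    where
    independence : LinIndep (SameT {n} {sh}) (λ T → FMT M (proj₁ T))
    independence ys distinct eq = All.tabulate (λ {cT} cT∈ → independent ys distinct
      (θ-kernel (forget ys) (λ a → trans (sym (lincomb-SYT-θ ys a)) (eq a))) cT cT∈)
    spanning : ∀ p → V p → InSpan (λ T → FMT M (proj₁ T)) p
    spanning p hp = proj₁ ys , λ a → trans (V-coeff p hp a)
      (trans (θ-cong (proj₂ ys) a) (sym (lincomb-SYT-θ (proj₁ ys) a)))
      where ys = straighten (antitone (proj₁ partition)) (proj₁ hp)

  act-coeff : (σ : Fin n → Fin n) (inj : injB σ ≡ true) (p : Poly n) (hp : V p) (a : Exp n) →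
    coeff (actP σ p) a ≡ θ (vec (act (fromInjB σ inj) (proj₁ hp))) a
  act-coeff σ inj p hp a = begin
    coeff (actP σ p) a ≡⟨ coeff-actP σ inj p a ⟩
    coeff p (a ∘ σ) ≡⟨ V-coeff p hp (a ∘ σ) ⟩
    θ (vec (proj₁ hp)) (a ∘ σ) ≡⟨ θ-act π (vec (proj₁ hp)) (vec-cong (proj₁ hp)) a ⟩
    θ (λ r → vec (proj₁ hp) (r ∘ σ)) a ≡⟨ θ-cong (vec-act π (proj₁ hp)) a ⟨
    θ (vec (act π (proj₁ hp))) a ∎
    where
    open ≡-Reasoning
    π = fromInjB σ inj

  invariant : Invariant V
  invariant σ perm p hp = act (fromInjB σ inj) (proj₁ hp) , λ a →
      trans (act-coeff σ inj p hp a) (sym (lincomb-θ (act (fromInjB σ inj) (proj₁ hp)) a))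
    where inj = isPerm⇒injB σ perm

  homogeneous : HomogeneousOfDegree (entrySum sh M) V
  homogeneous p hp a ne = go (∑-nonzero (proj₁ hp) _ (λ z → ne (trans (V-coeff p hp a) (trans (θ-vec (proj₁ hp) a) z))))
    where
    go : ∃[ cT ] cT ∈ proj₁ hp × ¬ (proj₁ cT ℚ.* coeff (FMT M (proj₂ cT)) a ≡ 0ℚ) → degree a ≡ entrySum sh M
    go ((c , T) , _ , nz) = degree-F M T a (*-nonzeroʳ c nz)

  antisymmetrizer : Filling n sh → Poly n → Poly n
  antisymmetrizer T p = concatMap (λ σ → scaleFV (sgn σ) (actP σ p)) (colStab T)

  antisymmetrizer-coeff : (T : Filling n sh) (p : Poly n) (hp : V p) (a : Exp n) →
    coeff (antisymmetrizer T p) a ≡ ⟨ proj₁ hp ,e T ⟩ ℚ.* coeff (FMT M T) a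
  antisymmetrizer-coeff T p hp a = begin
    coeff (antisymmetrizer T p) a
      ≡⟨ coeffFV-concatMap eqExp (λ σ → scaleFV (sgn σ) (actP σ p)) (colStab T) a ⟩
    Q.∑ (colStab T) (λ σ → coeff (scaleFV (sgn σ) (actP σ p)) a)
      ≡⟨ ∑-colStab T _ ⟩
    Q.∑ (allFuns n n) (λ σ → Q.⟦ CS T σ ⟧ ℚ.* coeff (scaleFV (sgn σ) (actP σ p)) a)
      ≡⟨ Q.∑-cong (allFuns n n) (λ σ → Q.⟦⟧-cong (CS T σ) (λ cs → trans (coeffFV-scale eqExp (sgn σ) (actP σ p) a)
           (cong (sgn σ ℚ.*_) (trans (coeff-actP σ (proj₁ (CS⇒ T σ cs)) p a) (V-coeff p hp (a ∘ σ)))))) ⟩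
    Q.∑ (allFuns n n) (λ σ → Q.⟦ CS T σ ⟧ ℚ.* (sgn σ ℚ.* θ (vec (proj₁ hp)) (a ∘ σ)))
      ≡⟨ antisymmetrize-θ (proj₁ hp) T a ⟩
    ⟨ proj₁ hp ,e T ⟩ ℚ.* coeff (FMT M T) a ∎
    where open ≡-Reasoning

  -- This is ρ F_{M,T} = F_{M,ρT}, inherited from the polytabloids through θ.
  relabel-F : (T U : Filling n sh) → actP (relabel T U ⟨$⟩ʳ_) (FMT M T) ≈P FMT M U
  relabel-F T U a = begin
    coeff (actP p (FMT M T)) a ≡⟨ coeff-actP p (ʳ-injB ρ) (FMT M T) a ⟩
    coeff (FMT M T) (a ∘ p) ≡⟨ F-θ T (a ∘ p) ⟩
    θ (e T) (a ∘ p) ≡⟨ θ-act ρ (e T) (e-cong T) a ⟩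
    θ (λ r → e T (r ∘ p)) a ≡⟨ θ-cong (λ r → trans (e-act T ρ r) (e-pos (T ∘T flip ρ) U same r)) a ⟩
    θ (e U) a ≡⟨ F-θ U a ⟨
    coeff (FMT M U) a ∎
    where
    open ≡-Reasoning
    ρ = relabel T U
    p = ρ ⟨$⟩ʳ_
    same : pos (T ∘T flip ρ) ≗ pos U
    same i = trans (sym (relabel-pos T U (ρ ⟨$⟩ˡ i))) (cong (pos U) (inverseʳ ρ))

  module _ (W : Poly n → Set) (W-sub : IsSubspace W) (W-inv : Invariant W) where
    open IsSubspace W-sub

    -- The recursion follows the unfiltered list of functions: invariance of `W` applies to
    -- permutations only, and the outcome of the filter test is what proves σ to be one.
    antisymmetrizer-closed : (T : Filling n sh) (p : Poly n) → W p → W (antisymmetrizer T p)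
    antisymmetrizer-closed T p wp = go (allFuns n n)
      where
      inC : (Fin n → Fin n) → Bool
      inC σ = all (λ i → colOf (pos T (σ i)) ≡ᵇ colOf (pos T i)) (allFin n)
      go : (σs : List (Fin n → Fin n)) →
        W (concatMap (λ σ → scaleFV (sgn σ) (actP σ p)) (filterB inC (filterB injB σs)))
      go [] = has0
      go (σ ∷ σs) = step (injB σ) refl
        where
        rest = filterB inC (filterB injB σs)
        step : (b : Bool) → injB σ ≡ b →
          W (concatMap (λ σ → scaleFV (sgn σ) (actP σ p)) (filterB inC (if b then σ ∷ filterB injB σs else filterB injB σs)))
        step false _ = go σs
        step true inj = kept (inC σ)
          where
          kept : (b : Bool) → W (concatMap (λ σ → scaleFV (sgn σ) (actP σ p)) (if b then σ ∷ rest else rest))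
          kept false = go σs
          kept true = closed+ (closed* (sgn σ) (W-inv σ (ʳ-isPerm (fromInjB σ inj)) p wp)) (go σs)

    lincomb-closed : (∀ T → W (FMT M T)) → (xs : List (ℚ × Filling n sh)) → W (lincomb (FMT M) xs)
    lincomb-closed wF [] = has0
    lincomb-closed wF ((c , T) ∷ xs) = closed+ (closed* c (wF T)) (lincomb-closed wF xs)

    -- The antisymmetrizer of T maps p to ⟨p , e_T⟩ F_T, so one nonzero pairing puts F_T, hence every F_U, into W.
    everything : (p : Poly n) (hp : V p) → W p → ¬ (p ≈P 0P) → ∀ q → V q → W q
    everything p hp wp p≉0 q (ys , q≈) = respects (λ a → sym (q≈ a)) (lincomb-closed (wF (zero-or-witness (λ cT → ⟨ proj₁ hp ,e proj₂ cT ⟩) (proj₁ hp))) ys)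
      where
      wF : (∃[ cT ] ¬ (⟨ proj₁ hp ,e proj₂ cT ⟩ ≡ 0ℚ)) ⊎ (∀ cT → cT ∈ proj₁ hp → ⟨ proj₁ hp ,e proj₂ cT ⟩ ≡ 0ℚ) → ∀ U → W (FMT M U)
      -- If v is orthogonal to every polytabloid in its list, then v = 0, and so p = θ v = 0.
      wF (inj₂ zeros) U = ⊥-elim (p≉0 (λ a → trans (V-coeff p hp a)
        (Q.∑-zero rs (λ r → trans (cong (ℚ._* G r a) (nondegenerate (proj₁ hp) zeros r)) (ℚP.*-zeroˡ (G r a))))))
      wF (inj₁ ((_ , T) , nz)) U = respects (relabel-F T U) (W-inv _ (ʳ-isPerm (relabel T U)) (FMT M T) wT)
        where
        instance _ = ℚ.≢-nonZero nz
        d : ℚ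
        d = ⟨ proj₁ hp ,e T ⟩
        wT : W (FMT M T)
        wT = respects (λ a → trans (coeffFV-scale eqExp (ℚ.1/ d) (antisymmetrizer T p) a)
            (trans (cong ((ℚ.1/ d) ℚ.*_) (antisymmetrizer-coeff T p hp a))
              (trans (sym (ℚP.*-assoc (ℚ.1/ d) d (coeff (FMT M T) a)))
                (trans (cong (ℚ._* coeff (FMT M T) a) (ℚP.*-inverseˡ d)) (ℚP.*-identityˡ (coeff (FMT M T) a))))))
          (closed* (ℚ.1/ d) (antisymmetrizer-closed T p wp))

  irreducible : Irreducible V
  irreducible = (FMT M T₀ , F∈V T₀ , λ z → F-nonzero M (proj₂ ssyt) T₀ (z (hMT M T₀)))
    , λ W W-sub W-inv W⊆V (p , wp , p≉0) → everything W W-sub W-inv p (W⊆V p wp) wp p≉0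

  -- The inverse of θ on V_M: the list that witnesses membership is read with polytabloids in place
  -- of the F_{M,T}.
  φ : (p : Poly n) → V p → ML n sh
  φ p hp = spechtVector (proj₁ hp)

  φ-EqM : (xs : List (ℚ × Filling n sh)) (v : ML n sh) → (∀ r → vec xs r ≡ coeffFV eqTab v r) → EqM n sh (spechtVector xs) v
  φ-EqM xs v eq r = trans (spechtVector-coeff xs r) (eq r)

  isomorphism : RepIso n sh V (InSpecht n sh)
  isomorphism = record
    { φ = φ
    ; into = λ p hp → proj₁ hp , λ r → refl
    ; respects = λ p q hp hq eq → φ-EqM (proj₁ hp) (φ q hq) (λ r → trans
        (θ-injective (proj₁ hp) (proj₁ hq) (λ a → trans (sym (V-coeff p hp a)) (trans (eq a) (V-coeff q hq a))) r)
        (sym (spechtVector-coeff (proj₁ hq) r)))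
    ; additive = λ p q hp hq hpq → φ-EqM (proj₁ hpq) (φ p hp ++ φ q hq) (λ r → begin
        vec (proj₁ hpq) r
          ≡⟨ θ-injective (proj₁ hpq) (proj₁ hp ++ proj₁ hq) (λ a → begin
               θ (vec (proj₁ hpq)) a ≡⟨ V-coeff (p +P q) hpq a ⟨
               coeff (p +P q) a ≡⟨ coeffFV-++ eqExp p q a ⟩
               coeff p a ℚ.+ coeff q a ≡⟨ cong₂ ℚ._+_ (V-coeff p hp a) (V-coeff q hq a) ⟩
               θ (vec (proj₁ hp)) a ℚ.+ θ (vec (proj₁ hq)) a ≡⟨ θ-+ (vec (proj₁ hp)) (vec (proj₁ hq)) a ⟨
               θ (λ r → vec (proj₁ hp) r ℚ.+ vec (proj₁ hq) r) a ≡⟨ θ-cong (vec-++ (proj₁ hp) (proj₁ hq)) a ⟨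
               θ (vec (proj₁ hp ++ proj₁ hq)) a ∎) r ⟩
        vec (proj₁ hp ++ proj₁ hq) r ≡⟨ vec-++ (proj₁ hp) (proj₁ hq) r ⟩
        vec (proj₁ hp) r ℚ.+ vec (proj₁ hq) r ≡⟨ cong₂ ℚ._+_ (spechtVector-coeff (proj₁ hp) r) (spechtVector-coeff (proj₁ hq) r) ⟨
        coeffFV eqTab (φ p hp) r ℚ.+ coeffFV eqTab (φ q hq) r ≡⟨ coeffFV-++ eqTab (φ p hp) (φ q hq) r ⟨
        coeffFV eqTab (φ p hp ++ φ q hq) r ∎)
    ; homog = λ c p hp hcp → φ-EqM (proj₁ hcp) (scaleFV c (φ p hp)) (λ r → begin
        vec (proj₁ hcp) r
          ≡⟨ θ-injective (proj₁ hcp) (scale c (proj₁ hp)) (λ a → begin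
               θ (vec (proj₁ hcp)) a ≡⟨ V-coeff (scaleFV c p) hcp a ⟨
               coeff (scaleFV c p) a ≡⟨ coeffFV-scale eqExp c p a ⟩
               c ℚ.* coeff p a ≡⟨ cong (c ℚ.*_) (V-coeff p hp a) ⟩
               c ℚ.* θ (vec (proj₁ hp)) a ≡⟨ θ-* c (vec (proj₁ hp)) a ⟨
               θ (λ r → c ℚ.* vec (proj₁ hp) r) a ≡⟨ θ-cong (vec-scale c (proj₁ hp)) a ⟨
               θ (vec (scale c (proj₁ hp))) a ∎) r ⟩
        vec (scale c (proj₁ hp)) r ≡⟨ vec-scale c (proj₁ hp) r ⟩
        c ℚ.* vec (proj₁ hp) r ≡⟨ cong (c ℚ.*_) (spechtVector-coeff (proj₁ hp) r) ⟨
        c ℚ.* coeffFV eqTab (φ p hp) r ≡⟨ coeffFV-scale eqTab c (φ p hp) r ⟨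
        coeffFV eqTab (scaleFV c (φ p hp)) r ∎)
    ; equivariant = λ σ perm p hp hσp → let inj = isPerm⇒injB σ perm; π = fromInjB σ inj in
        φ-EqM (proj₁ hσp) (actM {n} {sh} σ (φ p hp)) (λ r → begin
        vec (proj₁ hσp) r
          ≡⟨ θ-injective (proj₁ hσp) (act π (proj₁ hp)) (λ a →
               trans (sym (V-coeff (actP σ p) hσp a)) (act-coeff σ inj p hp a)) r ⟩
        vec (act π (proj₁ hp)) r ≡⟨ vec-act π (proj₁ hp) r ⟩
        vec (proj₁ hp) (r ∘ σ) ≡⟨ spechtVector-coeff (proj₁ hp) (r ∘ σ) ⟨
        coeffFV eqTab (φ p hp) (r ∘ σ) ≡⟨ coeff-actM {n} {sh} σ inj (φ p hp) r ⟨
        coeffFV eqTab (actM {n} {sh} σ (φ p hp)) r ∎)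
    ; injective = λ p q hp hq eq a → trans (V-coeff p hp a) (trans
        (θ-cong (λ r → trans (sym (spechtVector-coeff (proj₁ hp) r)) (trans (eq r) (spechtVector-coeff (proj₁ hq) r))) a)
        (sym (V-coeff q hq a)))
    ; surjective = λ v hv → lincomb (FMT M) (proj₁ hv) , (proj₁ hv , λ a → refl) , λ r → sym (proj₂ hv r)
    }
    where open ≡-Reasoning

theorem2p10 : (n : ℕ) (sh : List ℕ) → IsPartition n sh →
    (M : Box sh → ℕ) → IsSSYT sh M →
    IsBasisOf (SameT {n} {sh}) (λ T → FMT M (proj₁ T)) (InVM n sh M)
    × Invariant (InVM n sh M)
    × HomogeneousOfDegree (entrySum sh M) (InVM n sh M)
    × Irreducible (InVM n sh M)
    × RepIso n sh (InVM n sh M) (InSpecht n sh)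
theorem2p10 n sh partition M ssyt = basis , invariant , homogeneous , irreducible , isomorphism
  where open Main partition M ssyt
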